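{- Let $s,t\geq 1$ be integers and let $p,q,l$ be three distinct primes with $p,q$ odd, $p\equiv 3 \pmod 4$, $\mathrm{ord}_{p^s}(l)=\phi(p^s)/2$, $\mathrm{ord}_{q^t}(l)=\phi(q^t)$ and $\gcd(\phi(p^s),\phi(q^t))=2$. Let $0\leq i\leq s-1$ and $0\leq j\leq t-1$. Then in the ring $\mathbb{F}_l[x]/\langle x^{p^sq^t}-1\rangle$: (i) If $q$ is a quadratic residue modulo $p$, then \[ \begin{aligned}(\chi_{ij}^*)^2=&\frac{p-3}{4}p^{s-i-1}\Big((q-2)q^{t-j-1}\chi_{ij}^*+\phi(q^{t-j})\sum_{j<m\leq t}\chi_{im}^*\Big)\\&+\frac{p+1}{4}p^{s-i-1}\Big((q-2)q^{t-j-1}\chi_{ij}+\phi(q^{t-j})\sum_{j<m\leq t}\chi_{im}\Big). \end{aligned}\] (ii) If $q$ is a quadratic nonresidue modulo $p$, then \[ \begin{aligned}(\chi_{ij}^*)^2=&\frac{p-3}{4}p^{s-i-1}\Big((q-2)q^{t-j-1}\chi_{ij}^*+\phi(q^{t-j})\Big(\sum_{\substack{j<m\leq t\\2\nmid m-j}}\chi_{im}+\sum_{\substack{j<m\leq t\\2\mid m-j}}\chi_{im}^*\Big)\Big)\\ &+\frac{p+1}{4}p^{s-i-1}\Big((q-2)q^{t-j-1}\chi_{ij}+\phi(q^{t-j})\Big(\sum_{\substack{j<m\leq t\\2\nmid m-j}}\chi_{im}^*+\sum_{\substack{j<m\leq t\\2\mid m-j}}\chi_{im}\Big)\Big). \e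nd{aligned}\]
   Context: Here $\phi$ is Euler's phi function (with $\phi(1)=1$) and $\mathrm{ord}_m(k)$ is the multiplicative order of $k$ modulo $m$. Put $n=p^sq^t$. Fix an integer $g$ that is a primitive root both modulo $p^s$ and modulo $q^t$. For an integer $\gamma$, $C_\gamma=\{\gamma l^r \bmod n: r\geq 0\}\subseteq \mathbb{Z}_n$ is the $l$-cyclotomic coset modulo $n$ containing $\gamma$. For $0\leq i\leq s$, $0\leq j\leq t$ set $C_{ij}=C_{p^iq^j}$ and $C_{ij}^*=C_{p^iq^jg}$; in particular $C_{sj}=C_{sj}^*$ and $C_{st}=C_0=\{0\}$. Define elements of $\mathbb{F}_l[x]/\langle x^{n}-1\rangle$ by $\chi_{ij}=\sum_{\alpha\in C_{ij}}x^\alpha$ and $\chi_{ij}^*=\sum_{\alpha\in C_{ij}^*}x^\alpha$; in particular $\chi_{sj}=\chi_{sj}^*$ and $\chi_{st}=1$. Integer coefficients are read in $\mathbb{F}_l$, and empty sums are $0$. -}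

module Defs where

open import Level using (Level; _⊔_)
open import Algebra.Bundles using (CommutativeRing; CommutativeSemigroup)
open import Algebra.Structures using (IsAbelianGroup)
import Algebra.Properties.Ring as RingProperties
import Algebra.Properties.CommutativeSemigroup as CommutativeSemigroupProperties
import Algebra.Properties.Semiring.Exp as Exp
import Algebra.Properties.CommutativeMonoid.Sum as Sum
import Algebra.Properties.Semiring.Divisibility as RingDivisibility
open import Data.Bool.Base using (if_then_else_)
open import Data.Fin.Base using (Fin; toℕ; fromℕ<)
open import Data.Fin.Properties using (toℕ-fromℕ<; toℕ<n; pigeonhole)
import Data.Fin.Properties as Fin
open import Data.Integer.Base as ℤ using (ℤ; +_)
import Data.Integer.Properties as ℤ
import Data.Integer.DivMod as ℤ
import Data.Integer.Divisibility.Signed as ℤ∣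
open import Data.List.Base using (List; []; _∷_; map; length; filter; applyUpTo)
open import Data.Nat.Base as ℕ using (ℕ; zero; suc; NonZero; _≤_; _<_)
import Data.Nat.Properties as ℕ
open import Data.Nat.Coprimality using (coprime?)
open import Data.Nat.Induction using (<-rec)
import Data.Integer.Coprimality as ℤ
open import Data.Product.Base using (∃; _×_; _,_; proj₁; proj₂)
open import Function.Base using (_∘_)
open import Relation.Binary.PropositionalEquality.Core as ≡ using (_≡_)
import Relation.Binary.PropositionalEquality.Properties as ≡
import Relation.Binary.Reasoning.Setoid as SetoidReasoning
open import Relation.Binary.Structures using (IsEquivalence)
open import Relation.Nullary.Decidable as Dec using (Dec; yes; no; does)
open import Relation.Nullary.Negation.Core using (¬_)
open import Relation.Unary using (Pred; Decidable)

------------------------------------------------------------------------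
-- Quotient of a commutative ring by a principal ideal

module _ {c ℓ} (R : CommutativeRing c ℓ) (a : CommutativeRing.Carrier R) where

  open CommutativeRing R
  open RingProperties ring
  open RingDivisibility semiring using (_∣_; _,_)
  open CommutativeSemigroupProperties +-commutativeSemigroup using (interchange)
  open SetoidReasoning setoid

  -- A record rather than a definitional abbreviation, so that the two
  -- elements can be inferred from the type of a congruence.
  record CongruentModulo (x y : Carrier) : Set (c ⊔ ℓ) where
    constructor mkCong
    field
      divides : a ∣ (x - y)

  private
    infix 4 _~_
    _~_ = CongruentModulo

    combine : ∀ {x y} h → h * a ≈ x - y → x ~ y
    combine h eq = mkCong (h , eq)

    ≈⇒~ : ∀ {x y} → x ≈ y → x ~ y
    ≈⇒~ {x} {y} x≈y = combine 0# (begin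
      0# * a  ≈⟨ zeroˡ a ⟩
      0#      ≈⟨ -‿inverseʳ y ⟨
      y - y   ≈⟨ +-congʳ x≈y ⟨
      x - y   ∎)

    ~-sym : ∀ {x y} → x ~ y → y ~ x
    ~-sym {x} {y} (mkCong (h , eq)) = combine (- h) (begin
      - h * a          ≈⟨ -‿distribˡ-* h a ⟨
      - (h * a)        ≈⟨ -‿cong eq ⟩
      - (x - y)        ≈⟨ -‿+-comm x (- y) ⟨
      - x + - - y      ≈⟨ +-congˡ (-‿involutive y) ⟩
      - x + y          ≈⟨ +-comm (- x) y ⟩
      y - x            ∎)

    +-~ : ∀ {x y u v} → x ~ y → u ~ v → (x + u) ~ (y + v)
    +-~ {x} {y} {u} {v} (mkCong (h , eq)) (mkCong (k , eq′)) = combine (h + k) (begin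
      (h + k) * a            ≈⟨ distribʳ a h k ⟩
      h * a + k * a          ≈⟨ +-cong eq eq′ ⟩
      (x - y) + (u - v)      ≈⟨ interchange x (- y) u (- v) ⟩
      (x + u) + (- y + - v)  ≈⟨ +-congˡ (-‿+-comm y v) ⟩
      (x + u) - (y + v)      ∎)

    ~-trans : ∀ {x y z} → x ~ y → y ~ z → x ~ z
    ~-trans {x} {y} {z} (mkCong (h , eq)) (mkCong (k , eq′)) = combine (h + k) (begin
      (h + k) * a            ≈⟨ distribʳ a h k ⟩
      h * a + k * a          ≈⟨ +-cong eq eq′ ⟩
      (x - y) + (y - z)      ≈⟨ +-assoc x (- y) (y - z) ⟩
      x + (- y + (y - z))    ≈⟨ +-congˡ (+-assoc (- y) y (- z)) ⟨
      x + ((- y + y) - z)    ≈⟨ +-congˡ (+-congʳ (-‿inverseˡ y)) ⟩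
      x + (0# - z)           ≈⟨ +-congˡ (+-identityˡ (- z)) ⟩
      x - z                  ∎)

    -‿~ : ∀ {x y} → x ~ y → (- x) ~ (- y)
    -‿~ {x} {y} (mkCong (h , eq)) = combine (- h) (begin
      - h * a      ≈⟨ -‿distribˡ-* h a ⟨
      - (h * a)    ≈⟨ -‿cong eq ⟩
      - (x - y)    ≈⟨ -‿+-comm x (- y) ⟨
      - x - - y    ∎)

    *-~ʳ : ∀ {x y} z → x ~ y → (x * z) ~ (y * z)
    *-~ʳ {x} {y} z (mkCong (h , eq)) = combine (z * h) (begin
      (z * h) * a       ≈⟨ *-assoc z h a ⟩
      z * (h * a)       ≈⟨ *-congˡ eq ⟩
      z * (x - y)       ≈⟨ *-comm z (x - y) ⟩
      (x - y) * z       ≈⟨ distribʳ z x (- y) ⟩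
      x * z + - y * z   ≈⟨ +-congˡ (-‿distribˡ-* y z) ⟨
      x * z - y * z     ∎)

    *-~ : ∀ {x y u v} → x ~ y → u ~ v → (x * u) ~ (y * v)
    *-~ {x} {y} {u} {v} x~y u~v =
      ~-trans (*-~ʳ u x~y)
      (~-trans (≈⇒~ (*-comm y u))
      (~-trans (*-~ʳ y u~v) (≈⇒~ (*-comm v y))))

  infix 9 _/⟨_⟩

  _/⟨_⟩ : CommutativeRing c (c ⊔ ℓ)
  _/⟨_⟩ = record
    { Carrier = Carrier
    ; _≈_     = CongruentModulo
    ; _+_     = _+_
    ; _*_     = _*_
    ; -_      = -_
    ; 0#      = 0#
    ; 1#      = 1#
    ; isCommutativeRing = record
      { isRing = record
        { +-isAbelianGroup = record
          { isGroup = record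
            { isMonoid = record
              { isSemigroup = record
                { isMagma = record
                  { isEquivalence = record
                    { refl = ≈⇒~ refl ; sym = ~-sym ; trans = ~-trans }
                  ; ∙-cong = +-~
                  }
                ; assoc = λ x y z → ≈⇒~ (+-assoc x y z)
                }
              ; identity = ≈⇒~ ∘ +-identityˡ , ≈⇒~ ∘ +-identityʳ
              }
            ; inverse = ≈⇒~ ∘ -‿inverseˡ , ≈⇒~ ∘ -‿inverseʳ
            ; ⁻¹-cong = -‿~
            }
          ; comm = λ x y → ≈⇒~ (+-comm x y)
          }
        ; *-cong     = *-~
        ; *-assoc    = λ x y z → ≈⇒~ (*-assoc x y z)
        ; *-identity = ≈⇒~ ∘ *-identityˡ , ≈⇒~ ∘ *-identityʳ
        ; distrib    = (λ x y z → ≈⇒~ (distribˡ x y z))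
                     , (λ x y z → ≈⇒~ (distribʳ x y z))
        }
      ; *-comm = λ x y → ≈⇒~ (*-comm x y)
      }
    }

------------------------------------------------------------------------
-- Univariate polynomials over a commutative ring

module Polynomial {c ℓ} (R : CommutativeRing c ℓ) where

  open CommutativeRing R
  open RingProperties ring using (-0#≈0#)

  -- Coefficients in increasing degree.  Trailing zeros are allowed, so
  -- equality compares coefficients and not lists.
  Poly : Set c
  Poly = List Carrier

  coeff : Poly → ℕ → Carrier
  coeff []      _       = 0#
  coeff (a ∷ f) zero    = a
  coeff (a ∷ f) (suc k) = coeff f k

  infix 4 _≋_

  record _≋_ (f g : Poly) : Set ℓ where
    constructor coeffwise
    field
      at : ∀ k → coeff f k ≈ coeff g k

  open _≋_ public

  infixl 6 _+ₚ_
  infixl 7 _*ₚ_ _·ₚ_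

  _+ₚ_ : Poly → Poly → Poly
  []      +ₚ g       = g
  (a ∷ f) +ₚ []      = a ∷ f
  (a ∷ f) +ₚ (b ∷ g) = (a + b) ∷ (f +ₚ g)

  -ₚ_ : Poly → Poly
  -ₚ_ = map (-_)

  _·ₚ_ : Carrier → Poly → Poly
  a ·ₚ f = map (a *_) f

  _*ₚ_ : Poly → Poly → Poly
  []      *ₚ g = []
  (a ∷ f) *ₚ g = (a ·ₚ g) +ₚ (0# ∷ (f *ₚ g))

  const : Carrier → Poly
  const a = a ∷ []

  X : Poly
  X = 0# ∷ 1# ∷ []

  coeff-+ : ∀ f g k → coeff (f +ₚ g) k ≈ coeff f k + coeff g k
  coeff-+ []      g       k       = sym (+-identityˡ _)
  coeff-+ (a ∷ f) []      k       = sym (+-identityʳ _)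
  coeff-+ (a ∷ f) (b ∷ g) zero    = refl
  coeff-+ (a ∷ f) (b ∷ g) (suc k) = coeff-+ f g k

  coeff-neg : ∀ f k → coeff (-ₚ f) k ≈ - coeff f k
  coeff-neg []      k       = sym -0#≈0#
  coeff-neg (a ∷ f) zero    = refl
  coeff-neg (a ∷ f) (suc k) = coeff-neg f k

  coeff-· : ∀ a f k → coeff (a ·ₚ f) k ≈ a * coeff f k
  coeff-· a []      k       = sym (zeroʳ a)
  coeff-· a (b ∷ f) zero    = refl
  coeff-· a (b ∷ f) (suc k) = coeff-· a f k

  ≋-isEquivalence : IsEquivalence _≋_
  ≋-isEquivalence = record
    { refl  = coeffwise λ _ → refl
    ; sym   = λ p → coeffwise λ k → sym (at p k)
    ; trans = λ p q → coeffwise λ k → trans (at p k) (at q k)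
    }

  +ₚ-cong : ∀ {f f′ g g′} → f ≋ f′ → g ≋ g′ → f +ₚ g ≋ f′ +ₚ g′
  +ₚ-cong {f} {f′} {g} {g′} p q = coeffwise λ k →
    trans (coeff-+ f g k) (trans (+-cong (at p k) (at q k)) (sym (coeff-+ f′ g′ k)))

  +ₚ-isAbelianGroup : IsAbelianGroup _≋_ _+ₚ_ [] (-ₚ_)
  +ₚ-isAbelianGroup = record
    { isGroup = record
      { isMonoid = record
        { isSemigroup = record
          { isMagma = record { isEquivalence = ≋-isEquivalence ; ∙-cong = +ₚ-cong }
          ; assoc = λ f g h → coeffwise λ k →
              trans (trans (coeff-+ (f +ₚ g) h k) (+-congʳ (coeff-+ f g k)))
              (trans (+-assoc _ _ _)
              (sym (trans (coeff-+ f (g +ₚ h) k) (+-congˡ (coeff-+ g h k)))))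
          }
        ; identity = (λ f → coeffwise λ k → refl)
                   , (λ f → coeffwise λ k → trans (coeff-+ f [] k) (+-identityʳ _))
        }
      ; inverse =
          (λ f → coeffwise λ k → trans (coeff-+ (-ₚ f) f k)
            (trans (+-congʳ (coeff-neg f k)) (-‿inverseˡ _)))
        , (λ f → coeffwise λ k → trans (coeff-+ f (-ₚ f) k)
            (trans (+-congˡ (coeff-neg f k)) (-‿inverseʳ _)))
      ; ⁻¹-cong = λ {f} {g} p → coeffwise λ k →
          trans (coeff-neg f k) (trans (-‿cong (at p k)) (sym (coeff-neg g k)))
      }
    ; comm = λ f g → coeffwise λ k →
        trans (coeff-+ f g k) (trans (+-comm _ _) (sym (coeff-+ g f k)))
    }

  private
    module P = IsAbelianGroup +ₚ-isAbelianGroup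

    +ₚ-commutativeSemigroup : CommutativeSemigroup c ℓ
    +ₚ-commutativeSemigroup = record
      { isCommutativeSemigroup = record { isSemigroup = P.isSemigroup ; comm = P.comm } }

    open CommutativeSemigroupProperties +ₚ-commutativeSemigroup
      using (interchange; x∙yz≈y∙xz)
    open SetoidReasoning P.setoid

  ∷-cong : ∀ {a b f g} → a ≈ b → f ≋ g → a ∷ f ≋ b ∷ g
  ∷-cong p q = coeffwise λ { zero → p ; (suc k) → at q k }

  ·ₚ-cong : ∀ {a b f g} → a ≈ b → f ≋ g → a ·ₚ f ≋ b ·ₚ g
  ·ₚ-cong {a} {b} {f} {g} p q = coeffwise λ k →
    trans (coeff-· a f k) (trans (*-cong p (at q k)) (sym (coeff-· b g k)))

  ·ₚ-distribˡ : ∀ a f g → a ·ₚ (f +ₚ g) ≋ a ·ₚ f +ₚ a ·ₚ g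
  ·ₚ-distribˡ a f g = coeffwise λ k →
    trans (coeff-· a (f +ₚ g) k) (trans (*-congˡ (coeff-+ f g k)) (trans (distribˡ _ _ _)
      (sym (trans (coeff-+ (a ·ₚ f) (a ·ₚ g) k) (+-cong (coeff-· a f k) (coeff-· a g k))))))

  ·ₚ-assoc : ∀ a b f → (a * b) ·ₚ f ≋ a ·ₚ (b ·ₚ f)
  ·ₚ-assoc a b f = coeffwise λ k →
    trans (coeff-· (a * b) f k) (trans (*-assoc _ _ _)
      (sym (trans (coeff-· a (b ·ₚ f) k) (*-congˡ (coeff-· b f k)))))

  ·ₚ-identity : ∀ f → 1# ·ₚ f ≋ f
  ·ₚ-identity f = coeffwise λ k → trans (coeff-· 1# f k) (*-identityˡ _)

  ·ₚ-zero : ∀ f → 0# ·ₚ f ≋ []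
  ·ₚ-zero f = coeffwise λ k → trans (coeff-· 0# f k) (zeroˡ _)

  0∷[]≋[] : 0# ∷ [] ≋ []
  0∷[]≋[] = coeffwise λ { zero → refl ; (suc k) → refl }

  0∷-+ : ∀ f g → 0# ∷ (f +ₚ g) ≋ (0# ∷ f) +ₚ (0# ∷ g)
  0∷-+ f g = ∷-cong (sym (+-identityˡ 0#)) P.refl

  *ₚ-zeroʳ : ∀ f → f *ₚ [] ≋ []
  *ₚ-zeroʳ []      = P.refl
  *ₚ-zeroʳ (a ∷ f) = P.trans (∷-cong refl (*ₚ-zeroʳ f)) 0∷[]≋[]

  *ₚ-∷ʳ : ∀ f b g → f *ₚ (b ∷ g) ≋ b ·ₚ f +ₚ (0# ∷ (f *ₚ g))
  *ₚ-∷ʳ []      b g = P.sym 0∷[]≋[]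
  *ₚ-∷ʳ (a ∷ f) b g = ∷-cong (+-congʳ (*-comm a b)) (begin
    a ·ₚ g +ₚ f *ₚ (b ∷ g)                ≈⟨ P.∙-congˡ (*ₚ-∷ʳ f b g) ⟩
    a ·ₚ g +ₚ (b ·ₚ f +ₚ (0# ∷ f *ₚ g))   ≈⟨ x∙yz≈y∙xz (a ·ₚ g) (b ·ₚ f) _ ⟩
    b ·ₚ f +ₚ (a ·ₚ g +ₚ (0# ∷ f *ₚ g))   ∎)

  *ₚ-comm : ∀ f g → f *ₚ g ≋ g *ₚ f
  *ₚ-comm []      g = P.sym (*ₚ-zeroʳ g)
  *ₚ-comm (a ∷ f) g = P.trans (P.∙-congˡ {a ·ₚ g} (∷-cong refl (*ₚ-comm f g)))
                              (P.sym (*ₚ-∷ʳ g a f))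

  *ₚ-congˡ : ∀ f {g h} → g ≋ h → f *ₚ g ≋ f *ₚ h
  *ₚ-congˡ []      p = P.refl
  *ₚ-congˡ (a ∷ f) p = +ₚ-cong (·ₚ-cong refl p) (∷-cong refl (*ₚ-congˡ f p))

  *ₚ-cong : ∀ {f f′ g g′} → f ≋ f′ → g ≋ g′ → f *ₚ g ≋ f′ *ₚ g′
  *ₚ-cong {f} {f′} {g} {g′} p q = begin
    f *ₚ g    ≈⟨ *ₚ-congˡ f q ⟩
    f *ₚ g′   ≈⟨ *ₚ-comm f g′ ⟩
    g′ *ₚ f   ≈⟨ *ₚ-congˡ g′ p ⟩
    g′ *ₚ f′  ≈⟨ *ₚ-comm g′ f′ ⟩
    f′ *ₚ g′  ∎

  *ₚ-distribˡ : ∀ f g h → f *ₚ (g +ₚ h) ≋ f *ₚ g +ₚ f *ₚ h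
  *ₚ-distribˡ []      g h = P.refl
  *ₚ-distribˡ (a ∷ f) g h = begin
    a ·ₚ (g +ₚ h) +ₚ (0# ∷ f *ₚ (g +ₚ h))
      ≈⟨ +ₚ-cong (·ₚ-distribˡ a g h)
           (P.trans (∷-cong refl (*ₚ-distribˡ f g h)) (0∷-+ (f *ₚ g) (f *ₚ h))) ⟩
    (a ·ₚ g +ₚ a ·ₚ h) +ₚ ((0# ∷ f *ₚ g) +ₚ (0# ∷ f *ₚ h))
      ≈⟨ interchange (a ·ₚ g) (a ·ₚ h) (0# ∷ f *ₚ g) (0# ∷ f *ₚ h) ⟩
    (a ∷ f) *ₚ g +ₚ (a ∷ f) *ₚ h
      ∎

  *ₚ-distribʳ : ∀ f g h → (g +ₚ h) *ₚ f ≋ g *ₚ f +ₚ h *ₚ f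
  *ₚ-distribʳ f g h = begin
    (g +ₚ h) *ₚ f        ≈⟨ *ₚ-comm (g +ₚ h) f ⟩
    f *ₚ (g +ₚ h)        ≈⟨ *ₚ-distribˡ f g h ⟩
    f *ₚ g +ₚ f *ₚ h     ≈⟨ +ₚ-cong (*ₚ-comm f g) (*ₚ-comm f h) ⟩
    g *ₚ f +ₚ h *ₚ f     ∎

  ·ₚ-*ₚ : ∀ a f g → (a ·ₚ f) *ₚ g ≋ a ·ₚ (f *ₚ g)
  ·ₚ-*ₚ a []      g = P.refl
  ·ₚ-*ₚ a (b ∷ f) g = begin
    (a * b) ·ₚ g +ₚ (0# ∷ (a ·ₚ f) *ₚ g)
      ≈⟨ +ₚ-cong (·ₚ-assoc a b g) (∷-cong (sym (zeroʳ a)) (·ₚ-*ₚ a f g)) ⟩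
    a ·ₚ (b ·ₚ g) +ₚ a ·ₚ (0# ∷ f *ₚ g)
      ≈⟨ ·ₚ-distribˡ a (b ·ₚ g) (0# ∷ f *ₚ g) ⟨
    a ·ₚ ((b ∷ f) *ₚ g)
      ∎

  *ₚ-assoc : ∀ f g h → (f *ₚ g) *ₚ h ≋ f *ₚ (g *ₚ h)
  *ₚ-assoc []      g h = P.refl
  *ₚ-assoc (a ∷ f) g h = begin
    (a ·ₚ g +ₚ (0# ∷ f *ₚ g)) *ₚ h
      ≈⟨ *ₚ-distribʳ h (a ·ₚ g) (0# ∷ f *ₚ g) ⟩
    (a ·ₚ g) *ₚ h +ₚ (0# ·ₚ h +ₚ (0# ∷ (f *ₚ g) *ₚ h))
      ≈⟨ +ₚ-cong (·ₚ-*ₚ a g h) (+ₚ-cong (·ₚ-zero h) (∷-cong refl (*ₚ-assoc f g h))) ⟩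
    a ·ₚ (g *ₚ h) +ₚ (0# ∷ f *ₚ (g *ₚ h))
      ∎

  *ₚ-identityˡ : ∀ f → const 1# *ₚ f ≋ f
  *ₚ-identityˡ f = begin
    1# ·ₚ f +ₚ (0# ∷ [])  ≈⟨ +ₚ-cong (·ₚ-identity f) 0∷[]≋[] ⟩
    f +ₚ []               ≈⟨ P.identityʳ f ⟩
    f                     ∎

  polynomialRing : CommutativeRing c ℓ
  polynomialRing = record
    { Carrier = Poly
    ; _≈_     = _≋_
    ; _+_     = _+ₚ_
    ; _*_     = _*ₚ_
    ; -_      = -ₚ_
    ; 0#      = []
    ; 1#      = const 1#
    ; isCommutativeRing = record
      { isRing = record
        { +-isAbelianGroup = +ₚ-isAbelianGroup
        ; *-cong     = *ₚ-cong
        ; *-assoc    = *ₚ-assoc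
        ; *-identity = *ₚ-identityˡ
                     , (λ f → P.trans (*ₚ-comm f (const 1#)) (*ₚ-identityˡ f))
        ; distrib    = *ₚ-distribˡ , *ₚ-distribʳ
        }
      ; *-comm = *ₚ-comm
      }
    }

------------------------------------------------------------------------
-- Number theory

-- The residue ring ℤ/mℤ: carrier ℤ, equality is congruence modulo m.
ℤ/_ : ℕ → CommutativeRing _ _
ℤ/ m = ℤ.+-*-commutativeRing /⟨ + m ⟩

infix 4 _≡_[mod_]

_≡_[mod_] : ℤ → ℤ → ℕ → Set
a ≡ b [mod m ] = CommutativeRing._≈_ (ℤ/ m) a b

φ : ℕ → ℕ
φ m = length (filter (λ k → coprime? k m) (applyUpTo suc m))

-- HasOrder m k d says that ord_m(k) is defined and equals d; the first two
-- components already force k to be coprime to m.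
HasOrder : (m : ℕ) (k : ℤ) (d : ℕ) → Set
HasOrder m k d = 0 < d
               × (k ℤ.^ d) ≡ + 1 [mod m ]
               × (∀ e → 0 < e → (k ℤ.^ e) ≡ + 1 [mod m ] → d ≤ e)

IsPrimitiveRoot : ℤ → ℕ → Set
IsPrimitiveRoot g m = HasOrder m g (φ m)

IsQuadraticResidue : ℤ → ℕ → Set
IsQuadraticResidue a m = ℤ.Coprime a (+ m) × ∃ λ x → (x ℤ.* x) ≡ a [mod m ]

IsQuadraticNonresidue : ℤ → ℕ → Set
IsQuadraticNonresidue a m = ℤ.Coprime a (+ m) × ¬ (∃ λ x → (x ℤ.* x) ≡ a [mod m ])

------------------------------------------------------------------------
-- Cyclotomic cosets

-- ℤₙ is represented by Fin n.
CyclotomicCoset : (l n : ℕ) → ℤ → Pred (Fin n) _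
CyclotomicCoset l n γ α = ∃ λ r → (+ toℕ α) ≡ (γ ℤ.* (+ l) ℤ.^ r) [mod n ]

[mod]? : ∀ m a b → Dec (a ≡ b [mod m ])
[mod]? m a b = Dec.map′
  (λ { (ℤ∣.divides h eq) → mkCong (h , ≡.sym eq) })
  (λ { (mkCong (h , eq)) → ℤ∣.divides h (≡.sym eq) })
  (+ m ℤ∣.∣? (a ℤ.- b))
  where open RingDivisibility (CommutativeRing.semiring ℤ.+-*-commutativeRing) using (_,_)

-- The powers of l modulo n are eventually periodic, so the exponent r can be
-- taken below n; this makes membership in a coset decidable.
module _ (l n : ℕ) (γ : ℤ) where

  private
    module M = CommutativeRing (ℤ/ n)

    pw : ℕ → ℤ
    pw r = γ ℤ.* (+ l) ℤ.^ r

    pw-+ : ∀ i e → pw (i ℕ.+ e) ≡ pw i ℤ.* (+ l) ℤ.^ e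
    pw-+ i e = ≡.trans (≡.cong (γ ℤ.*_) (ℤ.^-distribˡ-+-* (+ l) i e))
                       (≡.sym (ℤ.*-assoc γ _ _))

    collision : .{{_ : NonZero n}} → ∃ λ i → ∃ λ j → i < j × j ≤ n × M._≈_ (pw i) (pw j)
    collision with pigeonhole (ℕ.n<1+n n) (λ i → fromℕ< (ℤ.n%ℕd<d (pw (toℕ i)) n))
    ... | i , j , i<j , eq = toℕ i , toℕ j , i<j , ℕ.≤-pred (toℕ<n j)
                           , M.trans (toRep (toℕ i)) (M.trans (M.reflexive (≡.cong +_ rep≡)) (M.sym (toRep (toℕ j))))
      where
      open RingDivisibility (CommutativeRing.semiring ℤ.+-*-commutativeRing) using (_,_)
      rep≡ : pw (toℕ i) ℤ.%ℕ n ≡ pw (toℕ j) ℤ.%ℕ n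
      rep≡ = ≡.trans (≡.sym (toℕ-fromℕ< _)) (≡.trans (≡.cong toℕ eq) (toℕ-fromℕ< _))
      toRep : ∀ r → M._≈_ (pw r) (+ (pw r ℤ.%ℕ n))
      toRep r = mkCong (pw r ℤ./ℕ n , (begin
        u                          ≡⟨ ℤ.+-identityʳ u ⟨
        u ℤ.+ + 0                  ≡⟨ ≡.cong (λ z → u ℤ.+ z) (ℤ.+-inverseʳ v) ⟨
        u ℤ.+ (v ℤ.- v)            ≡⟨ ℤ.+-assoc u v (ℤ.- v) ⟨
        (u ℤ.+ v) ℤ.- v            ≡⟨ ≡.cong (ℤ._- v) (ℤ.+-comm u v) ⟩
        (v ℤ.+ u) ℤ.- v            ≡⟨ ≡.cong (ℤ._- v) (ℤ.a≡a%ℕn+[a/ℕn]*n (pw r) n) ⟨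
        pw r ℤ.- v                 ∎))
        where
        open ≡.≡-Reasoning
        u v : ℤ
        u = (pw r ℤ./ℕ n) ℤ.* + n
        v = + (pw r ℤ.%ℕ n)

    reduce : .{{_ : NonZero n}} → ∀ r → ∃ λ r′ → r′ < n × M._≈_ (pw r) (pw r′)
    reduce = <-rec _ step
      where
      step : ∀ r → (∀ {r₁} → r₁ < r → ∃ λ r′ → r′ < n × M._≈_ (pw r₁) (pw r′))
           → ∃ λ r′ → r′ < n × M._≈_ (pw r) (pw r′)
      step r rec with r ℕ.<? n
      ... | yes r<n = r , r<n , M.refl
      ... | no  r≮n with collision
      ...   | i , j , i<j , j≤n , eq = proj₁ next , proj₁ (proj₂ next)
                                     , M.trans shift (proj₂ (proj₂ next))
        where
        e : ℕ
        e = r ℕ.∸ j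
        j+e≡r : j ℕ.+ e ≡ r
        j+e≡r = ℕ.m+[n∸m]≡n (ℕ.≤-trans j≤n (ℕ.≮⇒≥ r≮n))
        next : ∃ λ r′ → r′ < n × M._≈_ (pw (i ℕ.+ e)) (pw r′)
        next = rec (≡.subst (i ℕ.+ e <_) j+e≡r (ℕ.+-monoˡ-< e i<j))
        shift : M._≈_ (pw r) (pw (i ℕ.+ e))
        shift = M.trans (M.reflexive (≡.trans (≡.cong pw (≡.sym j+e≡r)) (pw-+ j e)))
               (M.trans (M.*-congʳ (M.sym eq)) (M.reflexive (≡.sym (pw-+ i e))))

  cyclotomicCoset? : Decidable (CyclotomicCoset l n γ)
  cyclotomicCoset? α = Dec.map′
    (λ { (r , p) → toℕ r , p })
    (λ { (r , p) → let r′ , r′<n , eq = reduce {{Fin.nonZeroIndex α}} r in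
         fromℕ< r′<n
       , ≡.subst (λ k → M._≈_ (+ toℕ α) (pw k)) (≡.sym (toℕ-fromℕ< r′<n)) (M.trans p eq) })
    (Fin.any? λ r → [mod]? n (+ toℕ α) (pw (toℕ r)))

------------------------------------------------------------------------
-- The ring 𝔽ₗ[x]/⟨xⁿ − 1⟩

𝔽_[X]/⟨X^_-1⟩ : ℕ → ℕ → CommutativeRing _ _
𝔽 l [X]/⟨X^ n -1⟩ = polynomialRing /⟨ X ^ n - 1# ⟩
  where
  open Polynomial (ℤ/ l)
  open CommutativeRing polynomialRing
  open Exp semiring using (_^_)

module Setting (s t p q l : ℕ) (g : ℤ) where

  n : ℕ
  n = p ℕ.^ s ℕ.* q ℕ.^ t

  open CommutativeRing (𝔽 l [X]/⟨X^ n -1⟩) public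
    using (Carrier)
    renaming (_≈_ to _≈ᴿ_; _+_ to _+ᴿ_; _*_ to _*ᴿ_; 0# to 0ᴿ; semiring to semiringᴿ;
              +-commutativeMonoid to +ᴿ-commutativeMonoid)
  open Exp semiringᴿ public using () renaming (_^_ to _^ᴿ_)
  open Polynomial (ℤ/ l) using (X; const)
  open Sum +ᴿ-commutativeMonoid using (sum)

  -- Scalar multiplication by the image of an integer in 𝔽ₗ.
  infixr 7 _·_
  _·_ : ℕ → Carrier → Carrier
  c · f = const (+ c) *ᴿ f

  sumWhere : ∀ {k ℓ} {P : Pred (Fin k) ℓ} → Decidable P → (Fin k → Carrier) → Carrier
  sumWhere P? f = sum λ i → if does (P? i) then f i else 0ᴿ

  -- ∑≤ u P? f is the sum of f m over all 0 ≤ m ≤ u satisfying P.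
  ∑≤ : ∀ {ℓ} (u : ℕ) {P : Pred ℕ ℓ} → Decidable P → (ℕ → Carrier) → Carrier
  ∑≤ u P? f = sumWhere {suc u} (λ m → P? (toℕ m)) (λ m → f (toℕ m))

  cosetSum : ℤ → Carrier
  cosetSum γ = sumWhere (cyclotomicCoset? l n γ) (λ α → X ^ᴿ toℕ α)

  χ χ* : ℕ → ℕ → Carrier
  χ  i j = cosetSum (+ (p ℕ.^ i ℕ.* q ℕ.^ j))
  χ* i j = cosetSum (+ (p ℕ.^ i ℕ.* q ℕ.^ j) ℤ.* g)

module Submission where

-- Modulo pˢ the powers of l form a subgroup of index two and of odd order, so
-- it misses -1 and the units are its union with its negative; modulo qᵗ the
-- powers of l exhaust the units; and the two orders are coprime.  Hence, with
-- Res the set of powers of l modulo p, the coset C_{ij} consists of the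
-- pⁱqʲu with u in Res and, when j < t, q ∤ u; and C*_{ij} likewise with -u in
-- Res.  The coefficients of (χ*_{ij})², a polynomial in Y = X^(pⁱqʲ), are
-- therefore counts of u with conditions on u and c - u modulo p and modulo q.
-- By the Chinese remainder theorem they factor into a cyclotomic number modulo
-- p, worth (p-3)/4 or (p+1)/4, and a count modulo q, worth q-2 or q-1.  The
-- terms with q ∣ c form a sum of the same kind at level j + 1, in which Res
-- is replaced by its negative exactly when q is a nonresidue; iterating gives
-- the sums over j < m ≤ t.

open import Defs
open import Algebra.Bundles using (CommutativeRing; CommutativeSemiring)
import Algebra.Properties.CommutativeSemigroup as CommutativeSemigroupProperties
import Algebra.Properties.Ring as RingProperties
import Algebra.Properties.Semiring.Divisibility as RingDivisibility
import Algebra.Properties.Semiring.Exp as Exp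
import Algebra.Properties.Semiring.Sum as SemiringSum
open import Data.Bool.Base using (if_then_else_)
open import Data.Fin.Base using (Fin; toℕ; fromℕ<)
open import Data.Fin.Permutation using (permutation)
import Data.Fin.Properties as Fin
open import Data.Integer.Base as ℤ using (ℤ; +_)
import Data.Integer.Divisibility.Signed as ℤ∣
import Data.Integer.DivMod as ℤ
import Data.Integer.Properties as ℤ
open import Data.Integer.Tactic.RingSolver using (solve-∀)
open import Data.List.Base using (length; filter; applyUpTo; lookup)
open import Data.List.Membership.Propositional using (_∈_)
open import Data.List.Membership.Propositional.Properties using (∈-applyUpTo⁺; ∈-filter⁺)
import Data.List.Relation.Unary.Any as Any
open import Data.List.Relation.Unary.Any.Properties using (lookup-index)
open import Data.Nat.Base as ℕ using (ℕ; zero; suc; NonZero; _≤_; _<_; _∸_; z≤n; s≤s)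
open import Data.Nat.Coprimality as Coprimality using (Coprime; coprime?; coprime-divisor; coprime-Bézout)
open import Data.Nat.Divisibility using (_∤_; _∣?_)
import Data.Nat.Divisibility as ℕ∣
open import Data.Nat.DivMod using (m*n/n≡m; m≡m%n+[m/n]*n)
open import Data.Nat.GCD using (gcd; gcd-greatest; module Bézout)
open import Data.Nat.Primality using (Prime; euclidsLemma; prime⇒irreducible; prime⇒nonZero; prime⇒nonTrivial)
open import Data.Nat.Properties using (_<?_)
import Data.Nat.Properties as ℕ
import Data.Nat.Tactic.RingSolver as ℕ-Solver
open import Data.Product.Base using (∃; ∃₂; _×_; _,_; proj₁; proj₂)
open import Data.Sign.Base as Sign using (Sign)
open import Data.Sum.Base as Sum using (_⊎_; inj₁; inj₂; [_,_]′)
open import Function.Base using (_∘_; _⟨_⟩_)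
open import Level using (_⊔_; 0ℓ)
open import Relation.Binary.PropositionalEquality as ≡ using (_≡_; _≢_)
import Relation.Binary.Reasoning.Setoid as SetoidReasoning
open import Relation.Nullary.Decidable as Dec using (Dec; yes; no; does; ¬?; toSum; _×-dec_; _⊎-dec_)
open import Relation.Nullary.Negation.Core using (¬_; contradiction)
open import Relation.Unary using (Pred; Decidable)

-- A coset condition modulo p^s can be tested modulo p alone because the units modulo p^s split into
-- ⟨l⟩ and g⟨l⟩, and these reduce into the disjoint sets Res and -Res: the side on which a number
-- falls modulo p decides which of the two cosets contains it. Modulo q^t the factor g is absorbed
-- by the powers of l, and coprimality of the two orders lets one exponent serve both moduli. The
-- cyclotomic numbers are found without character sums. A double count shows that 1 has as many
-- representations u + v with u and v in H as with u in H and v in -H; together these number |H| - 1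
-- = (p-3)/2, so each is (p-3)/4. For -1 the total is |H|, because -1 is not in H, and this produces
-- the other constant (p+1)/4. These arguments cancel 2 and |H|, which may vanish in characteristic
-- l. All counting is therefore done in the natural numbers, and only finished identities are
-- carried into the ring.

module Mod (m : ℕ) = CommutativeRing (ℤ/ m)

-- Congruences of integers and their least residues.

module _ {m : ℕ} where

  open RingDivisibility (CommutativeRing.semiring ℤ.+-*-commutativeRing) using (_,_)

  ∣⇒mod : ∀ {a b} → + m ℤ∣.∣ a ℤ.- b → a ≡ b [mod m ]
  ∣⇒mod (ℤ∣.divides h eq) = mkCong (h , ≡.sym eq)

  mod⇒∣ : ∀ {a b} → a ≡ b [mod m ] → + m ℤ∣.∣ a ℤ.- b
  mod⇒∣ (mkCong (h , eq)) = ℤ∣.divides h (≡.sym eq)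

mod-∣ : ∀ {k m a b} → k ℕ∣.∣ m → a ≡ b [mod m ] → a ≡ b [mod k ]
mod-∣ {k} {m} k∣m a≡b = ∣⇒mod (ℤ∣.∣-trans (ℤ∣.∣ᵤ⇒∣ {+ k} {+ m} k∣m) (mod⇒∣ a≡b))

mod-+ⁿ : ∀ m a → a ℤ.+ + m ≡ a [mod m ]
mod-+ⁿ m a = ∣⇒mod (ℤ∣.divides (+ 1) (ring a (+ m)))
  where
  ring : ∀ a m → a ℤ.+ m ℤ.- a ≡ + 1 ℤ.* m
  ring = solve-∀

residue : ∀ z m .{{_ : NonZero m}} → z ≡ + (z ℤ.%ℕ m) [mod m ]
residue z m = ∣⇒mod (ℤ∣.divides (z ℤ./ℕ m)
  (≡.trans (≡.cong (ℤ._- r) (ℤ.a≡a%ℕn+[a/ℕn]*n z m)) (ring r _)))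
  where
  r = + (z ℤ.%ℕ m)
  ring : ∀ r x → r ℤ.+ x ℤ.- r ≡ x
  ring = solve-∀

mod⇒≡ : ∀ {m a b} → a < m → b < m → + a ≡ + b [mod m ] → a ≡ b
mod⇒≡ {m} {a} {b} a<m b<m a≡b with ℤ.∣ + a ℤ.- + b ∣ in eq | ℤ∣.∣⇒∣ᵤ (mod⇒∣ a≡b)
... | zero  | _ = ℤ.+-injective (ℤ.i-j≡0⇒i≡j (+ a) (+ b) (ℤ.∣i∣≡0⇒i≡0 eq))
... | suc d | m∣d = contradiction m∣d (ℕ∣.>⇒∤ (≡.subst (_< m) eq
  (ℕ.≤-<-trans (≡.subst (λ z → ℤ.∣ z ∣ ≤ a ℕ.⊔ b) (≡.sym (ℤ.m-n≡m⊖n a b)) (ℤ.∣m⊝n∣≤m⊔n a b))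
               (ℕ.⊔-lub a<m b<m))))

-- Sums over complete residue systems.

module RangeSum {c ℓ} (R : CommutativeSemiring c ℓ) where

  open CommutativeSemiring R
  open SemiringSum semiring
  open CommutativeSemigroupProperties +-commutativeSemigroup using (interchange)
  open SetoidReasoning setoid

  -- Defined by recursion on n rather than as a sum over Fin n, so that the
  -- summand can be inferred by unification.
  Σ< : ℕ → (ℕ → Carrier) → Carrier
  Σ< zero    f = 0#
  Σ< (suc n) f = f 0 + Σ< n (f ∘ suc)

  syntax Σ< n (λ k → x) = Σ[ k < n ] x

  Periodic : ℕ → (ℤ → Carrier) → Set ℓ
  Periodic m G = ∀ {x y} → x ≡ y [mod m ] → G x ≈ G y

  sum≡Σ< : ∀ n f → sum {n} (λ i → f (toℕ i)) ≡ Σ< n f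
  sum≡Σ< zero    f = ≡.refl
  sum≡Σ< (suc n) f = ≡.cong (_+_ (f 0)) (sum≡Σ< n (f ∘ suc))

  Σ-cong< : ∀ n {f g} → (∀ k → k < n → f k ≈ g k) → Σ< n f ≈ Σ< n g
  Σ-cong< zero    eq = refl
  Σ-cong< (suc n) eq = +-cong (eq 0 (s≤s z≤n)) (Σ-cong< n (λ k k<n → eq (suc k) (s≤s k<n)))

  Σ-cong : ∀ n {f g} → (∀ k → f k ≈ g k) → Σ< n f ≈ Σ< n g
  Σ-cong n eq = Σ-cong< n (λ k _ → eq k)

  Σ-+ : ∀ n f g → Σ[ k < n ] (f k + g k) ≈ Σ< n f + Σ< n g
  Σ-+ zero    f g = sym (+-identityˡ _)
  Σ-+ (suc n) f g = trans (+-congˡ (Σ-+ n (f ∘ suc) (g ∘ suc))) (interchange _ _ _ _)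

  Σ-*ˡ : ∀ n x f → x * Σ< n f ≈ Σ[ k < n ] (x * f k)
  Σ-*ˡ zero    x f = zeroʳ x
  Σ-*ˡ (suc n) x f = trans (distribˡ x _ _) (+-congˡ (Σ-*ˡ n x (f ∘ suc)))

  Σ-*ʳ : ∀ n x f → Σ< n f * x ≈ Σ[ k < n ] (f k * x)
  Σ-*ʳ n x f = trans (*-comm _ x) (trans (Σ-*ˡ n x f) (Σ-cong n (λ k → *-comm x (f k))))

  Σ-zero : ∀ n → Σ[ k < n ] 0# ≈ 0#
  Σ-zero zero    = refl
  Σ-zero (suc n) = trans (+-identityˡ _) (Σ-zero n)

  Σ-comm : ∀ m n (f : ℕ → ℕ → Carrier) → Σ[ j < m ] Σ[ k < n ] f j k ≈ Σ[ k < n ] Σ[ j < m ] f j k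
  Σ-comm zero    n f = sym (Σ-zero n)
  Σ-comm (suc m) n f = trans (+-congˡ (Σ-comm m n (f ∘ suc))) (sym (Σ-+ n (f 0) _))

  Σ-head< : ∀ n f .{{_ : NonZero n}} → (∀ k → 0 < k → k < n → f k ≈ 0#) → Σ< n f ≈ f 0
  Σ-head< (suc n) f eq = begin
    f 0 + Σ< n (f ∘ suc)  ≈⟨ +-congˡ (trans (Σ-cong< n (λ k k<n → eq (suc k) (s≤s z≤n) (s≤s k<n))) (Σ-zero n)) ⟩
    f 0 + 0#              ≈⟨ +-identityʳ _ ⟩
    f 0                   ∎

  Σ-append : ∀ m n f → Σ< (m ℕ.+ n) f ≈ Σ< m f + Σ[ k < n ] f (m ℕ.+ k)
  Σ-append zero    n f = sym (+-identityˡ _)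
  Σ-append (suc m) n f = trans (+-congˡ (Σ-append m n (f ∘ suc))) (sym (+-assoc _ _ _))

  Σ-product : ∀ m n f → Σ< (m ℕ.* n) f ≈ Σ[ y < m ] Σ[ x < n ] f (y ℕ.* n ℕ.+ x)
  Σ-product zero    n f = refl
  Σ-product (suc m) n f = begin
    Σ< (n ℕ.+ m ℕ.* n) f
      ≈⟨ Σ-append n (m ℕ.* n) f ⟩
    Σ< n f + Σ[ k < m ℕ.* n ] f (n ℕ.+ k)
      ≈⟨ +-congˡ (Σ-product m n (λ k → f (n ℕ.+ k))) ⟩
    Σ< n f + Σ[ y < m ] Σ[ x < n ] f (n ℕ.+ (y ℕ.* n ℕ.+ x))
      ≈⟨ +-congˡ (Σ-cong m λ y → Σ-cong n λ x → reflexive (≡.cong f (≡.sym (ℕ.+-assoc n (y ℕ.* n) x)))) ⟩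
    Σ< n f + Σ[ y < m ] Σ[ x < n ] f (n ℕ.+ y ℕ.* n ℕ.+ x) ∎

  Σ-last : ∀ n f → Σ< (suc n) f ≈ Σ< n f + f n
  Σ-last zero    f = +-comm _ _
  Σ-last (suc n) f = trans (+-congˡ (Σ-last n (f ∘ suc))) (sym (+-assoc _ _ _))

  Σ-rotate : ∀ n f → f n ≈ f 0 → Σ< n (f ∘ suc) ≈ Σ< n f
  Σ-rotate zero    f eq = refl
  Σ-rotate (suc n) f eq = begin
    Σ< (suc n) (f ∘ suc)       ≈⟨ Σ-last n (f ∘ suc) ⟩
    Σ< n (f ∘ suc) + f (suc n) ≈⟨ +-comm _ _ ⟩
    f (suc n) + Σ< n (f ∘ suc) ≈⟨ +-congʳ eq ⟩
    f 0 + Σ< n (f ∘ suc)       ∎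

  Σ-shift : ∀ a n f → (∀ k → f (k ℕ.+ n) ≈ f k) → Σ[ k < n ] f (a ℕ.+ k) ≈ Σ< n f
  Σ-shift zero    n f per = refl
  Σ-shift (suc a) n f per = trans (Σ-shift a n (f ∘ suc) (λ k → per (suc k))) (Σ-rotate n f (per 0))

  -- Because w inverts a, `y ↦ b + a y` permutes the residues modulo m, with inverse
  -- `y ↦ w (y - b)`. Periodicity of G makes the passage to representatives below m harmless.
  Σ-affine : ∀ m a w b {G} → a ℤ.* w ≡ + 1 [mod m ] → Periodic m G →
             Σ[ y < m ] G (b ℤ.+ a ℤ.* + y) ≈ Σ[ y < m ] G (+ y)
  Σ-affine zero      a w b {G} aw≡1 per = refl
  Σ-affine m@(suc _) a w b {G} aw≡1 per = sym (begin
    Σ[ y < m ] G (+ y)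
      ≡⟨ sum≡Σ< m (λ y → G (+ y)) ⟨
    sum {m} (λ i → G (+ toℕ i))
      ≈⟨ sum-permute (λ i → G (+ toℕ i))
           (permutation (red σ) (red τ) (cancel σ τ σ-cong στ) (cancel τ σ τ-cong τσ)) ⟩
    sum {m} (λ i → G (+ toℕ (red σ i)))
      ≈⟨ sum-cong-≋ {m} (λ i → per (M.sym (red-mod σ i))) ⟩
    sum {m} (λ i → G (σ (+ toℕ i)))
      ≡⟨ sum≡Σ< m (λ y → G (σ (+ y))) ⟩
    Σ[ y < m ] G (b ℤ.+ a ℤ.* + y) ∎)
    where
    module M = Mod m
    σ τ : ℤ → ℤ
    σ y = b ℤ.+ a ℤ.* y
    τ y = w ℤ.* (y ℤ.- b)
    red : (ℤ → ℤ) → Fin m → Fin m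
    red ρ i = fromℕ< (ℤ.n%ℕd<d (ρ (+ toℕ i)) m)
    red-mod : ∀ ρ i → ρ (+ toℕ i) M.≈ + toℕ (red ρ i)
    red-mod ρ i = M.trans (residue (ρ (+ toℕ i)) m)
      (M.reflexive (≡.cong +_ (≡.sym (Fin.toℕ-fromℕ< _))))
    σ-cong : ∀ {x y} → x M.≈ y → σ x M.≈ σ y
    σ-cong x≈y = M.+-congˡ {b} (M.*-congˡ {a} x≈y)
    τ-cong : ∀ {x y} → x M.≈ y → τ x M.≈ τ y
    τ-cong x≈y = M.*-congˡ {w} (M.+-congʳ {ℤ.- b} x≈y)
    στ : ∀ y → σ (τ y) M.≈ y
    στ y = M.trans (M.reflexive (ring a w b y))
      (M.trans (M.+-congˡ {b} (M.*-congʳ {y ℤ.- b} aw≡1)) (M.reflexive (ring′ b y)))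
      where
      ring : ∀ a w b y → b ℤ.+ a ℤ.* (w ℤ.* (y ℤ.- b)) ≡ b ℤ.+ (a ℤ.* w) ℤ.* (y ℤ.- b)
      ring = solve-∀
      ring′ : ∀ b y → b ℤ.+ (+ 1) ℤ.* (y ℤ.- b) ≡ y
      ring′ = solve-∀
    τσ : ∀ y → τ (σ y) M.≈ y
    τσ y = M.trans (M.reflexive (ring a w b y)) (M.trans (M.*-congʳ {y} aw≡1) (M.*-identityˡ y))
      where
      ring : ∀ a w b y → w ℤ.* ((b ℤ.+ a ℤ.* y) ℤ.- b) ≡ (a ℤ.* w) ℤ.* y
      ring = solve-∀
    cancel : ∀ ρ ψ → (∀ {x y} → x M.≈ y → ρ x M.≈ ρ y) → (∀ y → ρ (ψ y) M.≈ y) →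
             ∀ i → red ρ (red ψ i) ≡ i
    cancel ρ ψ ρ-cong ρψ i = Fin.toℕ-injective (mod⇒≡ (Fin.toℕ<n _) (Fin.toℕ<n i)
      (M.trans (M.sym (red-mod ρ (red ψ i))) (M.trans (ρ-cong (M.sym (red-mod ψ i))) (ρψ (+ toℕ i)))))

  Σ-reflect : ∀ m c {G} → Periodic m G → Σ[ y < m ] G (c ℤ.- + y) ≈ Σ[ y < m ] G (+ y)
  Σ-reflect m c {G} per = trans
    (Σ-cong m λ y → reflexive (≡.cong G (≡.cong (λ z → c ℤ.+ z) (≡.sym (ℤ.-1*i≡-i (+ y))))))
    (Σ-affine m (ℤ.- + 1) (ℤ.- + 1) c (Mod.refl m) per)

  Σ-repeat : ∀ k m {G} → Periodic m G → Σ[ y < k ℕ.* m ] G (+ y) ≈ Σ[ _ < k ] Σ[ y < m ] G (+ y)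
  Σ-repeat k m {G} per = trans (Σ-product k m (λ y → G (+ y)))
    (Σ-cong k λ y → Σ-cong m λ x → per (shift y x))
    where
    shift : ∀ y x → + (y ℕ.* m ℕ.+ x) ≡ + x [mod m ]
    shift y x = ∣⇒mod (ℤ∣.divides (+ y)
      (≡.trans (≡.cong (λ z → z ℤ.+ + x ℤ.- + x) (ℤ.pos-* y m)) (ring (+ y ℤ.* + m) (+ x))))
      where
      ring : ∀ a x → a ℤ.+ x ℤ.- x ≡ a
      ring = solve-∀

  -- Write u = x + m y with x < m and y < n. F sees only x, and for fixed x the values x + m y run
  -- through all residues modulo n since m is invertible there.
  Σ-crt : ∀ m n w {F G} → + m ℤ.* w ≡ + 1 [mod n ] → Periodic m F → Periodic n G →
          Σ[ y < n ℕ.* m ] (F (+ y) * G (+ y)) ≈ Σ[ y < m ] F (+ y) * Σ[ y < n ] G (+ y)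
  Σ-crt m n w {F} {G} mw≡1 perF perG = begin
    Σ[ u < n ℕ.* m ] (F (+ u) * G (+ u))
      ≈⟨ Σ-product n m _ ⟩
    Σ[ y < n ] Σ[ x < m ] (F (+ (y ℕ.* m ℕ.+ x)) * G (+ (y ℕ.* m ℕ.+ x)))
      ≈⟨ Σ-cong n (λ y → Σ-cong m λ x → *-cong (perF (shift y x)) (reflexive (≡.cong G (flip y x)))) ⟩
    Σ[ y < n ] Σ[ x < m ] (F (+ x) * G (+ x ℤ.+ + m ℤ.* + y))
      ≈⟨ Σ-comm n m _ ⟩
    Σ[ x < m ] Σ[ y < n ] (F (+ x) * G (+ x ℤ.+ + m ℤ.* + y))
      ≈⟨ Σ-cong m (λ x → trans (sym (Σ-*ˡ n (F (+ x)) _)) (*-congˡ (Σ-affine n (+ m) w (+ x) mw≡1 perG))) ⟩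
    Σ[ x < m ] (F (+ x) * Σ[ y < n ] G (+ y))
      ≈⟨ Σ-*ʳ m _ _ ⟨
    Σ[ x < m ] F (+ x) * Σ[ y < n ] G (+ y) ∎
    where
    flip : ∀ y x → + (y ℕ.* m ℕ.+ x) ≡ + x ℤ.+ + m ℤ.* + y
    flip y x = ≡.trans (≡.cong +_ (≡.trans (ℕ.+-comm (y ℕ.* m) x) (≡.cong (x ℕ.+_) (ℕ.*-comm y m))))
                       (≡.cong (λ z → + x ℤ.+ z) (ℤ.pos-* m y))
    shift : ∀ y x → + (y ℕ.* m ℕ.+ x) ≡ + x [mod m ]
    shift y x = ∣⇒mod (ℤ∣.divides (+ y)
      (≡.trans (≡.cong (ℤ._- + x) (flip y x)) (ring (+ m) (+ y) (+ x))))
      where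
      ring : ∀ m y x → x ℤ.+ m ℤ.* y ℤ.- x ≡ y ℤ.* m
      ring = solve-∀

module ℕΣ = RangeSum ℕ.+-*-commutativeSemiring

-- Indicator functions and counts of nonmultiples.

module ResidueCounts where

  open ≡ using (refl; sym; trans; cong; cong₂; subst)
  open import Data.Nat.Base using (_+_; _*_)
  open ℕΣ

  infix 4 _∣ᶻ_ _∤ᶻ_ _∣ᶻ?_

  _∣ᶻ_ _∤ᶻ_ : ℕ → ℤ → Set
  m ∣ᶻ z = + m ℤ∣.∣ z
  m ∤ᶻ z = ¬ (m ∣ᶻ z)

  _∣ᶻ?_ : ∀ m z → Dec (m ∣ᶻ z)
  m ∣ᶻ? z = + m ℤ∣.∣? z

  ∣ᶻ-resp : ∀ {m x y} → x ≡ y [mod m ] → m ∣ᶻ x → m ∣ᶻ y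
  ∣ᶻ-resp {m} {x} {y} x≡y m∣x = subst (m ∣ᶻ_) (ring x y) (ℤ∣.∣m∣n⇒∣m-n m∣x (mod⇒∣ x≡y))
    where
    ring : ∀ x y → x ℤ.- (x ℤ.- y) ≡ y
    ring = solve-∀

  ∤ᶻ-resp : ∀ {m x y} → x ≡ y [mod m ] → m ∤ᶻ x → m ∤ᶻ y
  ∤ᶻ-resp {m} x≡y m∤x m∣y = m∤x (∣ᶻ-resp (Mod.sym m x≡y) m∣y)

  ind : ∀ {a} {P : Set a} → Dec P → ℕ
  ind (yes _) = 1
  ind (no  _) = 0

  ind-yes : ∀ {a} {P : Set a} (P? : Dec P) → P → ind P? ≡ 1
  ind-yes (yes _) p = refl
  ind-yes (no ¬p) p = contradiction p ¬p

  ind-no : ∀ {a} {P : Set a} (P? : Dec P) → ¬ P → ind P? ≡ 0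
  ind-no (yes p) ¬p = contradiction p ¬p
  ind-no (no _)  ¬p = refl

  ind-cong : ∀ {a b} {P : Set a} {Q : Set b} (P? : Dec P) (Q? : Dec Q) →
             (P → Q) → (Q → P) → ind P? ≡ ind Q?
  ind-cong (yes p) Q? f g = sym (ind-yes Q? (f p))
  ind-cong (no ¬p) Q? f g = sym (ind-no Q? (¬p ∘ g))

  ind-¬ : ∀ {a} {P : Set a} (P? : Dec P) → ind (¬? P?) + ind P? ≡ 1
  ind-¬ (yes _) = refl
  ind-¬ (no _)  = refl

  Σ-const : ∀ n a → Σ< n (λ _ → a) ≡ n * a
  Σ-const zero    a = refl
  Σ-const (suc n) a = cong (_+_ a) (Σ-const n a)

  multiple nonmultiple : ℕ → ℤ → ℕ
  multiple    m z = ind (m ∣ᶻ? z)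
  nonmultiple m z = ind (¬? (m ∣ᶻ? z))

  multiple-periodic : ∀ m → Periodic m (multiple m)
  multiple-periodic m {x} {y} x≡y = ind-cong (m ∣ᶻ? x) (m ∣ᶻ? y) (∣ᶻ-resp x≡y) (∣ᶻ-resp (Mod.sym m x≡y))

  nonmultiple-periodic : ∀ m → Periodic m (nonmultiple m)
  nonmultiple-periodic m {x} {y} x≡y =
    ind-cong (¬? (m ∣ᶻ? x)) (¬? (m ∣ᶻ? y)) (∤ᶻ-resp x≡y) (∤ᶻ-resp (Mod.sym m x≡y))

  nonmultiple+multiple : ∀ m z → nonmultiple m z + multiple m z ≡ 1
  nonmultiple+multiple m z = ind-¬ (m ∣ᶻ? z)

  minus-periodic : ∀ {m} c {F} → Periodic m F → Periodic m (λ z → F (c ℤ.- z))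
  minus-periodic {m} c per x≡y = per (Mod.+-congˡ m {c} (Mod.-‿cong m x≡y))

  *-periodic : ∀ {m F G} → Periodic m F → Periodic m G → Periodic m (λ z → F z * G z)
  *-periodic perF perG x≡y = cong₂ _*_ (perF x≡y) (perG x≡y)

  Σ-multiple : ∀ m .{{_ : NonZero m}} (F : ℤ → ℕ) → Σ[ u < m ] (F (+ u) * multiple m (+ u)) ≡ F (+ 0)
  Σ-multiple m F = trans
    (Σ-head< m _ λ k 0<k k<m →
      trans (cong (F (+ k) *_) (ind-no (m ∣ᶻ? + k) (∤-small 0<k k<m))) (ℕ.*-zeroʳ (F (+ k))))
    (trans (cong (F (+ 0) *_) (ind-yes (m ∣ᶻ? + 0) (ℤ∣.divides (+ 0) refl))) (ℕ.*-identityʳ _))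
    where
    ∤-small : ∀ {k} → 0 < k → k < m → m ∤ᶻ + k
    ∤-small {suc k} _ k<m m∣k = ℕ∣.>⇒∤ k<m (ℤ∣.∣⇒∣ᵤ m∣k)

  Σ-nonmultiple : ∀ m .{{_ : NonZero m}} → Σ[ u < m ] nonmultiple m (+ u) + 1 ≡ m
  Σ-nonmultiple m = begin
    Σ[ u < m ] nonmultiple m (+ u) + 1
      ≡⟨ cong (_+_ (Σ[ u < m ] nonmultiple m (+ u))) (Σ-multiple m (λ _ → 1)) ⟨
    Σ[ u < m ] nonmultiple m (+ u) + Σ[ u < m ] (1 * multiple m (+ u))
      ≡⟨ Σ-+ m _ _ ⟨
    Σ[ u < m ] (nonmultiple m (+ u) + 1 * multiple m (+ u))
      ≡⟨ Σ-cong m (λ u → trans (cong (_+_ (nonmultiple m (+ u))) (ℕ.*-identityˡ _)) (nonmultiple+multiple m (+ u))) ⟩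
    Σ[ u < m ] 1
      ≡⟨ trans (Σ-const m 1) (ℕ.*-identityʳ m) ⟩
    m ∎
    where open ≡.≡-Reasoning

  -- Only the class u ≡ c contributes; the reflection u ↦ c - u moves it to 0.
  Σ-reflected-multiple : ∀ m .{{_ : NonZero m}} c {F} → Periodic m F →
                         Σ[ u < m ] (F (+ u) * multiple m (c ℤ.- + u)) ≡ F c
  Σ-reflected-multiple m c {F} per = begin
    Σ[ u < m ] (F (+ u) * multiple m (c ℤ.- + u))
      ≡⟨ Σ-reflect m c {λ z → F z * multiple m (c ℤ.- z)} (*-periodic per (minus-periodic c (multiple-periodic m))) ⟨
    Σ[ u < m ] (F (c ℤ.- + u) * multiple m (c ℤ.- (c ℤ.- + u)))
      ≡⟨ Σ-cong m (λ u → cong (λ z → F (c ℤ.- + u) * multiple m z) (ring c (+ u))) ⟩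
    Σ[ u < m ] (F (c ℤ.- + u) * multiple m (+ u))
      ≡⟨ Σ-multiple m (λ z → F (c ℤ.- z)) ⟩
    F (c ℤ.- + 0)
      ≡⟨ cong F (ℤ.+-identityʳ c) ⟩
    F c ∎
    where
    open ≡.≡-Reasoning
    ring : ∀ c u → c ℤ.- (c ℤ.- u) ≡ u
    ring = solve-∀

  -- Stated additively to avoid subtraction: among the m classes, the summand 1 accounts for u ≡ 0,
  -- and `nonmultiple m c` for u ≡ c when that is a different class.
  Σ-nonmultiple²+ : ∀ m .{{_ : NonZero m}} c →
    Σ[ u < m ] (nonmultiple m (+ u) * nonmultiple m (c ℤ.- + u)) + nonmultiple m c + 1 ≡ m
  Σ-nonmultiple²+ m c = begin
    Σ[ u < m ] (ν (+ u) * ν (c ℤ.- + u)) + ν c + 1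
      ≡⟨ cong (λ x → Σ[ u < m ] (ν (+ u) * ν (c ℤ.- + u)) + x + 1) (Σ-reflected-multiple m c (nonmultiple-periodic m)) ⟨
    Σ[ u < m ] (ν (+ u) * ν (c ℤ.- + u)) + Σ[ u < m ] (ν (+ u) * μ (c ℤ.- + u)) + 1
      ≡⟨ cong (λ x → x + 1) (Σ-+ m (λ u → ν (+ u) * ν (c ℤ.- + u)) (λ u → ν (+ u) * μ (c ℤ.- + u))) ⟨
    Σ[ u < m ] (ν (+ u) * ν (c ℤ.- + u) + ν (+ u) * μ (c ℤ.- + u)) + 1
      ≡⟨ cong (λ x → x + 1) (Σ-cong m absorb) ⟩
    Σ[ u < m ] ν (+ u) + 1
      ≡⟨ Σ-nonmultiple m ⟩
    m ∎
    where
    open ≡.≡-Reasoning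
    ν μ : ℤ → ℕ
    ν = nonmultiple m
    μ = multiple m
    absorb : ∀ u → ν (+ u) * ν (c ℤ.- + u) + ν (+ u) * μ (c ℤ.- + u) ≡ ν (+ u)
    absorb u = begin
      ν (+ u) * ν (c ℤ.- + u) + ν (+ u) * μ (c ℤ.- + u)  ≡⟨ ℕ.*-distribˡ-+ (ν (+ u)) (ν (c ℤ.- + u)) (μ (c ℤ.- + u)) ⟨
      ν (+ u) * (ν (c ℤ.- + u) + μ (c ℤ.- + u))          ≡⟨ cong (ν (+ u) *_) (nonmultiple+multiple m (c ℤ.- + u)) ⟩
      ν (+ u) * 1                                        ≡⟨ ℕ.*-identityʳ (ν (+ u)) ⟩
      ν (+ u)                                            ∎

  -- The classes 0 and c are excluded: two classes when q does not divide c, a single one when it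
  -- does.
  Σ-nonmultiple² : ∀ q → 2 ≤ q → ∀ c →
    Σ[ u < q ] (nonmultiple q (+ u) * nonmultiple q (c ℤ.- + u)) ≡
    (q ∸ 2) * nonmultiple q c + (q ∸ 1) * multiple q c
  Σ-nonmultiple² q 2≤q c = ℕ.+-cancelʳ-≡ (ν + 1) N _ (begin
    N + (ν + 1)                                     ≡⟨ ℕ.+-assoc N ν 1 ⟨
    N + ν + 1                                       ≡⟨ Σ-nonmultiple²+ q {{ℕ.>-nonZero (ℕ.≤-trans (s≤s z≤n) 2≤q)}} c ⟩
    q                                               ≡⟨ value q 2≤q ν μ (nonmultiple+multiple q c) ⟩
    (q ∸ 2) * ν + (q ∸ 1) * μ + (ν + 1)             ∎)
    where
    open ≡.≡-Reasoning
    N ν μ : ℕ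
    N = Σ[ u < q ] (nonmultiple q (+ u) * nonmultiple q (c ℤ.- + u))
    ν = nonmultiple q c
    μ = multiple q c
    value : ∀ q → 2 ≤ q → ∀ ν μ → ν + μ ≡ 1 → q ≡ (q ∸ 2) * ν + (q ∸ 1) * μ + (ν + 1)
    value (suc zero)    (s≤s ()) ν μ eq
    value (suc (suc q)) _        ν μ eq = begin
      1 + (1 + q)                          ≡⟨ cong suc (ℕ.*-identityʳ (1 + q)) ⟨
      1 + (1 + q) * 1                      ≡⟨ cong (λ x → 1 + (1 + q) * x) eq ⟨
      1 + (1 + q) * (ν + μ)                ≡⟨ ring q ν μ ⟩
      q * ν + (1 + q) * μ + (ν + 1)        ∎
      where
      ring : ∀ q ν μ → 1 + (1 + q) * (ν + μ) ≡ q * ν + (1 + q) * μ + (ν + 1)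
      ring = ℕ-Solver.solve-∀

  -- An index-two subgroup of the units modulo p that avoids -1, given as a predicate on integers.
  -- The counts below use only these properties, so l does not appear in them.
  record HalfSystem (p : ℕ) (H : Pred ℤ 0ℓ) : Set where
    field
      H?       : Decidable H
      resp     : ∀ {x y} → x ≡ y [mod p ] → H x → H y
      mul      : ∀ {x y} → H x → H y → H (x ℤ.* y)
      one      : H (+ 1)
      unit     : ∀ {x} → H x → p ∤ᶻ x
      inverse  : ∀ {x} → H x → ∃ λ w → x ℤ.* w ≡ + 1 [mod p ]
      cover    : ∀ x → p ∤ᶻ x → H x ⊎ H (ℤ.- x)
      disjoint : ∀ {x} → H x → ¬ H (ℤ.- x)

  -- Cyclotomic numbers of order two modulo p.

  module Cyclotomy (p k : ℕ) (p≡4k+3 : p ≡ 4 * k + 3) {H : Pred ℤ 0ℓ} (hs : HalfSystem p H) where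

    open HalfSystem hs
    open ≡.≡-Reasoning
    module M = Mod p

    instance
      p≢0 : NonZero p
      p≢0 = subst NonZero (sym (trans p≡4k+3 (ℕ.+-comm (4 * k) 3))) _

    -- The indicators of H, of its complement among the units, and of the multiples of p. The
    -- complement is -H, hence the reflected `r`.
    r n o : ℤ → ℕ
    r z = ind (H? z)
    n z = r (ℤ.- z)
    o   = multiple p

    r-periodic : Periodic p r
    r-periodic x≡y = ind-cong (H? _) (H? _) (resp x≡y) (resp (M.sym x≡y))

    n-periodic : Periodic p n
    n-periodic x≡y = r-periodic (M.-‿cong x≡y)

    partition : ∀ z → r z + n z + o z ≡ 1
    partition z with toSum (p ∣ᶻ? z)
    ... | inj₁ p∣z = cong₂ _+_ (cong₂ _+_ (ind-no (H? z) λ h → unit h p∣z)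
                                         (ind-no (H? (ℤ.- z)) λ h → unit h (ℤ∣.∣m⇒∣-m p∣z)))
                              (ind-yes (p ∣ᶻ? z) p∣z)
    ... | inj₂ p∤z with cover z p∤z
    ...   | inj₁ h = cong₂ _+_ (cong₂ _+_ (ind-yes (H? z) h) (ind-no (H? (ℤ.- z)) (disjoint h)))
                               (ind-no (p ∣ᶻ? z) p∤z)
    ...   | inj₂ h = cong₂ _+_ (cong₂ _+_ (ind-no (H? z) λ h′ → disjoint h′ h) (ind-yes (H? (ℤ.- z)) h))
                               (ind-no (p ∣ᶻ? z) p∤z)

    -- If x were not in H, then -x would be, and so would a(-x) = -(ax), against disjointness. This
    -- replaces an inverse of a inside H.
    mul-cancel : ∀ {a x} → H a → H (a ℤ.* x) → H x
    mul-cancel {a} {x} ha hax with cover x (λ p∣x → unit hax (ℤ∣.∣n⇒∣m*n a p∣x))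
    ... | inj₁ h = h
    ... | inj₂ h = contradiction (subst H (sym (ℤ.neg-distribʳ-* a x)) (mul ha h)) (disjoint hax)

    r-scale : ∀ {a} → H a → ∀ x → r (a ℤ.* x) ≡ r x
    r-scale {a} ha x = ind-cong (H? _) (H? _) (mul-cancel ha) (mul ha)

    S : (ℤ → ℕ) → ℕ
    S F = Σ[ u < p ] F (+ u)

    S-cong : ∀ {F G : ℤ → ℕ} → (∀ z → F z ≡ G z) → S F ≡ S G
    S-cong eq = Σ-cong p (λ u → eq (+ u))

    -- Unnormalised cyclotomic numbers: representations c = u + v with u in H, and v in H for `RR`
    -- or in -H for `RN`.
    RR RN : ℤ → ℕ
    RR c = S (λ u → r u * r (c ℤ.- u))
    RN c = S (λ u → r u * n (c ℤ.- u))

    -- Negation exchanges H and -H, so they have equal size, and with the class of 0 they make up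
    -- all p residues.
    size : S r ≡ 2 * k + 1
    size = ℕ.*-cancelˡ-≡ _ _ 2 (ℕ.+-cancelʳ-≡ 1 _ _ (begin
      2 * S r + 1                         ≡⟨ cong (λ x → S r + x + 1) (ℕ.+-identityʳ (S r)) ⟩
      S r + S r + 1                       ≡⟨ cong₂ (λ a b → S r + a + b) reflected (Σ-multiple p (λ _ → 1)) ⟨
      S r + S n + S (λ u → 1 * o u)       ≡⟨ cong (_+ S (λ u → 1 * o u)) (Σ-+ p _ _) ⟨
      S (λ u → r u + n u) + S (λ u → 1 * o u) ≡⟨ Σ-+ p _ _ ⟨
      S (λ u → r u + n u + 1 * o u)       ≡⟨ S-cong (λ u → trans (cong (_+_ (r u + n u)) (ℕ.*-identityˡ (o u))) (partition u)) ⟩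
      S (λ _ → 1)                         ≡⟨ trans (Σ-const p 1) (ℕ.*-identityʳ p) ⟩
      p                                   ≡⟨ p≡4k+3 ⟩
      4 * k + 3                           ≡⟨ ring k ⟩
      2 * (2 * k + 1) + 1                 ∎))
      where
      ring : ∀ k → 4 * k + 3 ≡ 2 * (2 * k + 1) + 1
      ring = ℕ-Solver.solve-∀
      reflected : S n ≡ S r
      reflected = trans (S-cong λ u → cong r (sym (ℤ.+-identityˡ (ℤ.- u)))) (Σ-reflect p (+ 0) r-periodic)

    -- For u in H the difference c - u lies in H, in -H, or is divisible by p. The last case means u
    -- ≡ c, which happens once if c is in H and never otherwise.
    row : ∀ c → RR c + RN c + r c ≡ 2 * k + 1
    row c = begin
      RR c + RN c + r c
        ≡⟨ cong (_+_ (RR c + RN c)) (Σ-reflected-multiple p c r-periodic) ⟨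
      RR c + RN c + S (λ u → r u * o (c ℤ.- u))
        ≡⟨ cong (_+ S (λ u → r u * o (c ℤ.- u))) (Σ-+ p _ _) ⟨
      S (λ u → r u * r (c ℤ.- u) + r u * n (c ℤ.- u)) + S (λ u → r u * o (c ℤ.- u))
        ≡⟨ Σ-+ p _ _ ⟨
      S (λ u → r u * r (c ℤ.- u) + r u * n (c ℤ.- u) + r u * o (c ℤ.- u))
        ≡⟨ S-cong (λ u → trans (ring (r u) (r (c ℤ.- u)) (n (c ℤ.- u)) (o (c ℤ.- u)))
                    (trans (cong (r u *_) (partition (c ℤ.- u))) (ℕ.*-identityʳ (r u)))) ⟩
      S r
        ≡⟨ size ⟩
      2 * k + 1 ∎
      where
      ring : ∀ a b c d → a * b + a * c + a * d ≡ a * (b + c + d)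
      ring = ℕ-Solver.solve-∀

    dilate : ∀ {a} → H a → ∀ {F} → Periodic p F → S F ≡ S (λ u → F (a ℤ.* u))
    dilate {a} ha {F} per with inverse ha
    ... | w , aw≡1 = sym (trans (S-cong λ u → cong F (sym (ℤ.+-identityˡ (a ℤ.* u)))) (Σ-affine p a w (+ 0) aw≡1 per))

    -- Multiplying u by a permutes the residues and preserves H.
    RR-scale : ∀ {a} → H a → ∀ c → RR (a ℤ.* c) ≡ RR c
    RR-scale {a} ha c = trans
      (dilate ha {λ u → r u * r (a ℤ.* c ℤ.- u)} (*-periodic r-periodic (minus-periodic (a ℤ.* c) r-periodic)))
      (S-cong λ u → cong₂ _*_ (r-scale ha u) (trans (cong r (ring a c u)) (r-scale ha (c ℤ.- u))))
      where
      ring : ∀ a c u → a ℤ.* c ℤ.- a ℤ.* u ≡ a ℤ.* (c ℤ.- u)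
      ring = solve-∀

    RN-scale : ∀ {a} → H a → ∀ c → RN (a ℤ.* c) ≡ RN c
    RN-scale {a} ha c = trans
      (dilate ha {λ u → r u * n (a ℤ.* c ℤ.- u)} (*-periodic r-periodic (minus-periodic (a ℤ.* c) n-periodic)))
      (S-cong λ u → cong₂ _*_ (r-scale ha u) (trans (cong r (ring a c u)) (r-scale ha (ℤ.- (c ℤ.- u)))))
      where
      ring : ∀ a c u → ℤ.- (a ℤ.* c ℤ.- a ℤ.* u) ≡ a ℤ.* (ℤ.- (c ℤ.- u))
      ring = solve-∀

    -- Invariance under H makes f constant on H, with value f(1).
    weighted : ∀ (f : ℤ → ℕ) → (∀ {a} → H a → ∀ c → f (a ℤ.* c) ≡ f c) →
               S (λ a → r a * f a) ≡ (2 * k + 1) * f (+ 1)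
    weighted f scale = begin
      S (λ a → r a * f a)        ≡⟨ S-cong step ⟩
      S (λ a → r a * f (+ 1))    ≡⟨ Σ-*ʳ p (f (+ 1)) (λ u → r (+ u)) ⟨
      S r * f (+ 1)              ≡⟨ cong (_* f (+ 1)) size ⟩
      (2 * k + 1) * f (+ 1)      ∎
      where
      step : ∀ a → r a * f a ≡ r a * f (+ 1)
      step a with H? a
      ... | yes ha = cong (_+ 0) (trans (cong f (sym (ℤ.*-identityʳ a))) (scale ha (+ 1)))
      ... | no  _  = refl

    -- Both sides count pairs a , u in H, up to the factor |H|: those with
    -- a - u in H, and those with u - a in H.
    RR1≡RN1 : RR (+ 1) ≡ RN (+ 1)
    RR1≡RN1 = ℕ.*-cancelˡ-≡ _ _ (2 * k + 1) {{subst NonZero (ℕ.+-comm 1 (2 * k)) _}} (begin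
      (2 * k + 1) * RR (+ 1)
        ≡⟨ weighted RR RR-scale ⟨
      S (λ a → r a * RR a)
        ≡⟨ S-cong (λ a → Σ-*ˡ p (r a) (λ u → r (+ u) * r (a ℤ.- + u))) ⟩
      S (λ a → S (λ u → r a * (r u * r (a ℤ.- u))))
        ≡⟨ Σ-comm p p _ ⟩
      S (λ u → S (λ a → r a * (r u * r (a ℤ.- u))))
        ≡⟨ S-cong (λ u → S-cong λ a → trans (ring (r a) (r u) _) (cong (λ z → r u * (r a * r z)) (ring′ u a))) ⟩
      S (λ u → S (λ a → r u * (r a * n (u ℤ.- a))))
        ≡⟨ S-cong (λ u → Σ-*ˡ p (r u) (λ a → r (+ a) * n (u ℤ.- + a))) ⟨
      S (λ u → r u * RN u)
        ≡⟨ weighted RN RN-scale ⟩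
      (2 * k + 1) * RN (+ 1) ∎)
      where
      ring : ∀ a b c → a * (b * c) ≡ b * (a * c)
      ring = ℕ-Solver.solve-∀
      ring′ : ∀ u a → a ℤ.- u ≡ ℤ.- (u ℤ.- a)
      ring′ = solve-∀

    -- Since 1 is in H, `row` leaves 2k to be shared by two equal counts.
    RR1 : RR (+ 1) ≡ k
    RR1 = ℕ.*-cancelˡ-≡ _ _ 2 (ℕ.+-cancelʳ-≡ 1 _ _ (begin
      2 * RR (+ 1) + 1                  ≡⟨ cong (λ x → RR (+ 1) + x + 1) (ℕ.+-identityʳ (RR (+ 1))) ⟩
      RR (+ 1) + RR (+ 1) + 1           ≡⟨ cong₂ (λ a b → RR (+ 1) + a + b) RR1≡RN1 (sym (ind-yes (H? (+ 1)) one)) ⟩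
      RR (+ 1) + RN (+ 1) + r (+ 1)     ≡⟨ row (+ 1) ⟩
      2 * k + 1                         ∎))

    -- `RN (-1)` counts u with u and u + 1 in H, and `RN 1` counts u with u and u - 1 in H;
    -- translation by 1 matches them.
    RN-1 : RN (ℤ.- + 1) ≡ k
    RN-1 = begin
      RN (ℤ.- + 1)
        ≡⟨ S-cong (λ u → trans (ℕ.*-comm (r u) (n (ℤ.- + 1 ℤ.- u))) (cong₂ (λ x y → r x * r y) (ring₁ u) (ring₂ u))) ⟩
      S (λ u → r (+ 1 ℤ.+ + 1 ℤ.* u) * n (+ 1 ℤ.- (+ 1 ℤ.+ + 1 ℤ.* u)))
        ≡⟨ Σ-affine p (+ 1) (+ 1) (+ 1) {λ u → r u * n (+ 1 ℤ.- u)} M.refl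
             (*-periodic r-periodic (minus-periodic (+ 1) n-periodic)) ⟩
      RN (+ 1)
        ≡⟨ RR1≡RN1 ⟨
      RR (+ 1)
        ≡⟨ RR1 ⟩
      k ∎
      where
      ring₁ : ∀ u → ℤ.- (ℤ.- + 1 ℤ.- u) ≡ + 1 ℤ.+ + 1 ℤ.* u
      ring₁ = solve-∀
      ring₂ : ∀ u → u ≡ ℤ.- (+ 1 ℤ.- (+ 1 ℤ.+ + 1 ℤ.* u))
      ring₂ = solve-∀

    -- Now `row` loses nothing to its last term, because -1 is not in H: the total stays 2k + 1, of
    -- which `RN` takes k.
    RR-1 : RR (ℤ.- + 1) ≡ 1 + k
    RR-1 = ℕ.+-cancelʳ-≡ k _ _ (begin
      RR (ℤ.- + 1) + k                                   ≡⟨ cong (_+_ (RR (ℤ.- + 1))) RN-1 ⟨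
      RR (ℤ.- + 1) + RN (ℤ.- + 1)                        ≡⟨ ℕ.+-identityʳ _ ⟨
      RR (ℤ.- + 1) + RN (ℤ.- + 1) + 0                    ≡⟨ cong (_+_ (RR (ℤ.- + 1) + RN (ℤ.- + 1)))
                                                               (ind-no (H? (ℤ.- + 1)) (disjoint one)) ⟨
      RR (ℤ.- + 1) + RN (ℤ.- + 1) + r (ℤ.- + 1)          ≡⟨ row (ℤ.- + 1) ⟩
      2 * k + 1                                          ≡⟨ ring k ⟩
      1 + k + k                                          ∎)
      where
      ring : ∀ k → 2 * k + 1 ≡ 1 + k + k
      ring = ℕ-Solver.solve-∀

    -- By scaling, c may be taken to be 1 or -1 when p does not divide it. If p divides c, then c -
    -- u ≡ -u is never in H together with u, and both sides vanish.
    RR-value : ∀ c → RR c ≡ k * r c + (1 + k) * n c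
    RR-value c with p ∣ᶻ? c
    ... | yes p∣c = trans (trans (S-cong vanish) (Σ-zero p)) (sym (cong₂ (λ a b → k * a + (1 + k) * b)
                      (ind-no (H? c) (λ h → unit h p∣c)) (ind-no (H? (ℤ.- c)) (λ h → unit h (ℤ∣.∣m⇒∣-m p∣c)))
                      ⟨ trans ⟩ cong₂ _+_ (ℕ.*-zeroʳ k) (ℕ.*-zeroʳ (1 + k))))
      where
      vanish : ∀ u → r u * r (c ℤ.- u) ≡ 0
      vanish u with H? u
      ... | no _  = refl
      ... | yes h = trans (ℕ.+-identityʳ _) (ind-no (H? _) (λ h′ →
        disjoint h (resp (∣⇒mod (subst (p ∣ᶻ_) (ring c u) p∣c)) h′)))
        where
        ring : ∀ c u → c ≡ c ℤ.- u ℤ.- (ℤ.- u)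
        ring = solve-∀
    ... | no p∤c with cover c p∤c
    ...   | inj₁ h = begin
      RR c                         ≡⟨ cong RR (ℤ.*-identityʳ c) ⟨
      RR (c ℤ.* + 1)               ≡⟨ RR-scale h (+ 1) ⟩
      RR (+ 1)                     ≡⟨ RR1 ⟩
      k                            ≡⟨ ring k ⟩
      k * 1 + (1 + k) * 0          ≡⟨ cong₂ (λ a b → k * a + (1 + k) * b)
                                         (ind-yes (H? c) h) (ind-no (H? (ℤ.- c)) (disjoint h)) ⟨
      k * r c + (1 + k) * n c      ∎
      where
      ring : ∀ k → k ≡ k * 1 + (1 + k) * 0
      ring = ℕ-Solver.solve-∀
    ...   | inj₂ h = begin
      RR c                         ≡⟨ cong RR (ringᶻ c) ⟩
      RR (ℤ.- c ℤ.* (ℤ.- + 1))     ≡⟨ RR-scale h (ℤ.- + 1) ⟩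
      RR (ℤ.- + 1)                 ≡⟨ RR-1 ⟩
      1 + k                        ≡⟨ ring k ⟩
      k * 0 + (1 + k) * 1          ≡⟨ cong₂ (λ a b → k * a + (1 + k) * b)
                                         (ind-no (H? c) (λ h′ → disjoint h′ h)) (ind-yes (H? (ℤ.- c)) h) ⟨
      k * r c + (1 + k) * n c      ∎
      where
      ring : ∀ k → 1 + k ≡ k * 0 + (1 + k) * 1
      ring = ℕ-Solver.solve-∀
      ringᶻ : ∀ c → c ≡ ℤ.- c ℤ.* (ℤ.- + 1)
      ringᶻ = solve-∀

    -- Negating u turns this count into `RR (- c)`; so the smaller constant k goes with -H here.
    NN-value : ∀ c → S (λ u → n u * n (c ℤ.- u)) ≡ k * n c + (1 + k) * r c
    NN-value c = begin
      S (λ u → n u * n (c ℤ.- u))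
        ≡⟨ Σ-reflect p (+ 0) {λ u → n u * n (c ℤ.- u)} (*-periodic n-periodic (minus-periodic c n-periodic)) ⟨
      S (λ u → n (+ 0 ℤ.- u) * n (c ℤ.- (+ 0 ℤ.- u)))
        ≡⟨ S-cong (λ u → cong₂ (λ x y → r x * r y) (ring₁ u) (ring₂ c u)) ⟩
      RR (ℤ.- c)
        ≡⟨ RR-value (ℤ.- c) ⟩
      k * r (ℤ.- c) + (1 + k) * n (ℤ.- c)
        ≡⟨ cong (λ z → k * n c + (1 + k) * r z) (ℤ.neg-involutive c) ⟩
      k * n c + (1 + k) * r c ∎
      where
      ring₁ : ∀ u → ℤ.- (+ 0 ℤ.- u) ≡ u
      ring₁ = solve-∀
      ring₂ : ∀ c u → ℤ.- (c ℤ.- (+ 0 ℤ.- u)) ≡ ℤ.- c ℤ.- u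
      ring₂ = solve-∀

open ResidueCounts

-- Units, totients and orders modulo prime powers.

module PrimePowers where

  open ≡ using (refl; sym; trans; cong; cong₂; subst)
  open import Data.Nat.Base using (_+_; _*_)
  open ℕΣ

  length-filter-applyUpTo : ∀ {a} {P : Pred ℕ a} (P? : Decidable P) f n →
    length (filter P? (applyUpTo f n)) ≡ Σ[ k < n ] ind (P? (f k))
  length-filter-applyUpTo P? f zero = refl
  length-filter-applyUpTo P? f (suc n) with P? (f 0)
  ... | yes _ = cong suc (length-filter-applyUpTo P? (f ∘ suc) n)
  ... | no  _ = length-filter-applyUpTo P? (f ∘ suc) n

  prime∤1 : ∀ {p} → Prime p → ¬ p ℕ∣.∣ 1
  prime∤1 {p} pp p∣1 = ℕ.nonTrivial⇒≢1 {{prime⇒nonTrivial pp}} (ℕ∣.∣1⇒≡1 p∣1)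

  prime∣^ : ∀ {p} → Prime p → ∀ a e → p ℕ∣.∣ a ℕ.^ e → p ℕ∣.∣ a
  prime∣^ pp a zero    p∣1 = contradiction p∣1 (prime∤1 pp)
  prime∣^ pp a (suc e) p∣aᵉ with euclidsLemma a (a ℕ.^ e) pp p∣aᵉ
  ... | inj₁ p∣a = p∣a
  ... | inj₂ p∣ = prime∣^ pp a e p∣

  coprime-prime^ : ∀ {p k} → Prime p → ¬ p ℕ∣.∣ k → ∀ e → Coprime k (p ℕ.^ e)
  coprime-prime^ pp p∤k zero    (_ , d∣1) = ℕ∣.∣1⇒≡1 d∣1
  coprime-prime^ {p} {k} pp p∤k (suc e) {d} (d∣k , d∣pᵉ) =
    coprime-prime^ pp p∤k e (d∣k , coprime-divisor d⊥p d∣pᵉ)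
    where
    d⊥p : Coprime d p
    d⊥p {c} (c∣d , c∣p) with prime⇒irreducible pp c∣p
    ... | inj₁ c≡1 = c≡1
    ... | inj₂ refl = contradiction (ℕ∣.∣-trans c∣d d∣k) p∤k

  ∣⇒∣ᶻ : ∀ {m a} → m ℕ∣.∣ a → m ∣ᶻ + a
  ∣⇒∣ᶻ {m} {a} = ℤ∣.∣ᵤ⇒∣ {+ m} {+ a}

  ∣ᶻ⇒∣ : ∀ {m a} → m ∣ᶻ + a → m ℕ∣.∣ a
  ∣ᶻ⇒∣ = ℤ∣.∣⇒∣ᵤ

  -- Being coprime to p^(e+1) means not being divisible by p, a condition of period p, which is met
  -- p - 1 times in each of p^e periods.
  φ-prime^ : ∀ {p} → Prime p → ∀ e → φ (p ℕ.^ suc e) ≡ p ℕ.^ e * (p ∸ 1)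
  φ-prime^ {p} pp e = begin
    φ P
      ≡⟨ length-filter-applyUpTo (λ k → coprime? k P) suc P ⟩
    Σ[ k < P ] ind (coprime? (suc k) P)
      ≡⟨ Σ-cong P (λ k → ind-cong (coprime? (suc k) P) (¬? (p ∣ᶻ? + suc k)) to from) ⟩
    Σ[ k < P ] nonmultiple p (+ suc k)
      -- The totient runs over 1, ..., P and the sum over 0, ..., P - 1; the summands at 0 and P
      -- agree.
      ≡⟨ Σ-rotate P (λ k → nonmultiple p (+ k)) (nonmultiple-periodic p
           (∣⇒mod (subst (p ∣ᶻ_) (sym (ℤ.+-identityʳ (+ P))) (∣⇒∣ᶻ {p} {P} (ℕ∣.m∣m*n (p ℕ.^ e)))))) ⟩
    Σ[ k < P ] nonmultiple p (+ k)
      ≡⟨ cong (λ n → Σ[ k < n ] nonmultiple p (+ k)) (ℕ.*-comm p (p ℕ.^ e)) ⟩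
    Σ[ k < p ℕ.^ e * p ] nonmultiple p (+ k)
      ≡⟨ Σ-repeat (p ℕ.^ e) p (nonmultiple-periodic p) ⟩
    Σ[ _ < p ℕ.^ e ] Σ[ k < p ] nonmultiple p (+ k)
      ≡⟨ Σ-const (p ℕ.^ e) (Σ[ k < p ] nonmultiple p (+ k)) ⟩
    p ℕ.^ e * Σ[ k < p ] nonmultiple p (+ k)
      ≡⟨ cong (p ℕ.^ e *_) (sym (ℕ.m+n∸n≡m (Σ[ k < p ] nonmultiple p (+ k)) 1)) ⟩
    p ℕ.^ e * (Σ[ k < p ] nonmultiple p (+ k) + 1 ∸ 1)
      ≡⟨ cong (λ x → p ℕ.^ e * (x ∸ 1)) (Σ-nonmultiple p {{prime⇒nonZero pp}}) ⟩
    p ℕ.^ e * (p ∸ 1) ∎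
    where
    open ≡.≡-Reasoning
    P = p ℕ.^ suc e
    to : ∀ {k} → Coprime (suc k) P → p ∤ᶻ + suc k
    to c p∣k = prime∤1 pp (subst (p ℕ∣.∣_) (c (∣ᶻ⇒∣ p∣k , ℕ∣.m∣m*n (p ℕ.^ e))) ℕ∣.∣-refl)
    from : ∀ {k} → p ∤ᶻ + suc k → Coprime (suc k) P
    from p∤k = coprime-prime^ pp (p∤k ∘ ∣⇒∣ᶻ) (suc e)

  -- Modulo pᵉ there are φ(pᵉ) residues prime to p.
  unit-collision : ∀ {p} → Prime p → ∀ e (f : ℕ → ℤ) → (∀ i → p ∤ᶻ f i) →
    ∃₂ λ i j → i < j × j ≤ φ (p ℕ.^ suc e) × f i ≡ f j [mod p ℕ.^ suc e ]
  unit-collision {p} pp e f units =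
    -- φ(P) is by definition the length of the list `L`, so among φ(P) + 1 units two occupy the same
    -- position.
    let i , j , i<j , eq = Fin.pigeonhole (ℕ.n<1+n (φ P)) (λ i → Any.index (listed (toℕ i)))
    in toℕ i , toℕ j , i<j , ℕ.≤-pred (Fin.toℕ<n j) ,
       M.trans (residue (f (toℕ i)) P) (M.trans (M.reflexive (cong +_
         (trans (lookup-index (listed (toℕ i)))
           (trans (cong (lookup L) eq) (sym (lookup-index (listed (toℕ j))))))))
         (M.sym (residue (f (toℕ j)) P)))
    where
    P = p ℕ.^ suc e
    module M = Mod P
    L = filter (λ k → coprime? k P) (applyUpTo suc P)
    instance
      P≢0 : NonZero P
      P≢0 = ℕ.m^n≢0 p (suc e) {{prime⇒nonZero pp}}
    r : ℕ → ℕ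
    r i = f i ℤ.%ℕ P
    p∤r : ∀ i → ¬ p ℕ∣.∣ r i
    p∤r i p∣r = units i (∣ᶻ-resp (mod-∣ (ℕ∣.m∣m*n (p ℕ.^ e)) (M.sym (residue (f i) P))) (∣⇒∣ᶻ p∣r))
    ∈-suc : ∀ {x} → x ≢ 0 → x < P → x ∈ applyUpTo suc P
    ∈-suc {zero}  x≢0 _   = contradiction refl x≢0
    ∈-suc {suc x} _   x<P = ∈-applyUpTo⁺ suc (ℕ.<-trans (ℕ.n<1+n x) x<P)
    listed : ∀ i → r i ∈ L
    listed i = ∈-filter⁺ (λ k → coprime? k P)
      (∈-suc (λ r≡0 → p∤r i (subst (p ℕ∣.∣_) (sym r≡0) (p ℕ∣.∣0))) (ℤ.n%ℕd<d (f i) P))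
      (coprime-prime^ pp (p∤r i) (suc e))

  module _ {m : ℕ} where

    private module M = Mod m

    ^-cong-mod : ∀ {a b} r → a ≡ b [mod m ] → a ℤ.^ r ≡ b ℤ.^ r [mod m ]
    ^-cong-mod zero    a≡b = M.refl
    ^-cong-mod {a} {b} (suc r) a≡b = M.*-cong {a} {b} a≡b (^-cong-mod r a≡b)

    Invertible : ℤ → Set
    Invertible a = ∃ λ w → a ℤ.* w ≡ + 1 [mod m ]

    mod-cancelˡ : ∀ a → Invertible a → ∀ x y → a ℤ.* x ≡ a ℤ.* y [mod m ] → x ≡ y [mod m ]
    mod-cancelˡ a (w , aw≡1) x y eq = M.trans (expand x) (M.trans (M.*-congˡ {w} eq) (M.sym (expand y)))
      where
      ring : ∀ a w x → (a ℤ.* w) ℤ.* x ≡ w ℤ.* (a ℤ.* x)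
      ring = solve-∀
      expand : ∀ x → x ≡ w ℤ.* (a ℤ.* x) [mod m ]
      expand x = M.trans (M.sym (M.trans (M.*-congʳ {x} aw≡1) (M.*-identityˡ x))) (M.reflexive (ring a w x))

    1^-mod : ∀ {a} r → a ≡ + 1 [mod m ] → a ℤ.^ r ≡ + 1 [mod m ]
    1^-mod r a≡1 = M.trans (^-cong-mod r a≡1) (M.reflexive (ℤ.^-zeroˡ r))

    power-1 : ∀ a d e → a ℤ.^ d ≡ + 1 [mod m ] → a ℤ.^ (d * e) ≡ + 1 [mod m ]
    power-1 a d e aᵈ≡1 = M.trans (M.reflexive (sym (ℤ.^-*-assoc a d e))) (1^-mod {a ℤ.^ d} e aᵈ≡1)

    -- If a^(1+d) ≡ 1, the inverse of a^e is a^(de), as the exponents add up to (1+d)e.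
    power-invertible : ∀ {a d} → 0 < d → a ℤ.^ d ≡ + 1 [mod m ] → ∀ e → Invertible (a ℤ.^ e)
    power-invertible {a} {suc d} 0<d aᵈ≡1 e = (a ℤ.^ (d * e)) ,
      M.trans (M.reflexive (sym (ℤ.^-distribˡ-+-* a e (d * e)))) (power-1 a (suc d) e aᵈ≡1)

    -- Cancelling a^i from the congruence would leave a^(j-i) ≡ 1 with 0 < j - i < d.
    order-injective : ∀ {a d} → HasOrder m a d → ∀ {i j} → i < j → j < i + d →
                      ¬ (a ℤ.^ i ≡ a ℤ.^ j [mod m ])
    order-injective {a} {d} (0<d , aᵈ≡1 , least) {i} {j} i<j j<i+d eq = ℕ.<⇒≱ e<d
      (least e (ℕ.m<n⇒0<n∸m i<j) (M.sym (mod-cancelˡ (a ℤ.^ i) (power-invertible 0<d aᵈ≡1 i) (+ 1) (a ℤ.^ e)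
        (M.trans (M.reflexive (ℤ.*-identityʳ (a ℤ.^ i)))
          (M.trans eq (M.reflexive (trans (cong (a ℤ.^_) (sym i+e≡j)) (ℤ.^-distribˡ-+-* a i e))))))))
      where
      e = j ∸ i
      i+e≡j : i + e ≡ j
      i+e≡j = ℕ.m+[n∸m]≡n (ℕ.<⇒≤ i<j)
      e<d : e < d
      e<d = ℕ.+-cancelˡ-< i e d (subst (_< i + d) (sym i+e≡j) j<i+d)

  prime-∣ᶻ-* : ∀ {p} → Prime p → ∀ a b → p ∣ᶻ a ℤ.* b → p ∣ᶻ a ⊎ p ∣ᶻ b
  prime-∣ᶻ-* {p} pp a b p∣ab with euclidsLemma ℤ.∣ a ∣ ℤ.∣ b ∣ pp (subst (p ℕ∣.∣_) (ℤ.abs-* a b) (ℤ∣.∣⇒∣ᵤ p∣ab))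
  ... | inj₁ p∣a = inj₁ (ℤ∣.∣ᵤ⇒∣ p∣a)
  ... | inj₂ p∣b = inj₂ (ℤ∣.∣ᵤ⇒∣ p∣b)

  prime-∤ᶻ-* : ∀ {p} → Prime p → ∀ {a b} → p ∤ᶻ a → p ∤ᶻ b → p ∤ᶻ a ℤ.* b
  prime-∤ᶻ-* pp {a} {b} p∤a p∤b p∣ab = [ p∤a , p∤b ]′ (prime-∣ᶻ-* pp a b p∣ab)

  prime-∤ᶻ-^ : ∀ {p} → Prime p → ∀ {a} → p ∤ᶻ a → ∀ e → p ∤ᶻ a ℤ.^ e
  prime-∤ᶻ-^ pp     p∤a zero    p∣1 = prime∤1 pp (∣ᶻ⇒∣ p∣1)
  prime-∤ᶻ-^ pp {a} p∤a (suc e) = prime-∤ᶻ-* pp {a} p∤a (prime-∤ᶻ-^ pp p∤a e)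

  power-1⇒∤ : ∀ {p} → Prime p → ∀ {a d} → 0 < d → a ℤ.^ d ≡ + 1 [mod p ] → p ∤ᶻ a
  power-1⇒∤ pp {a} {suc d} _ aᵈ≡1 p∣a =
    prime∤1 pp (∣ᶻ⇒∣ (∣ᶻ-resp aᵈ≡1 (ℤ∣.∣m⇒∣m*n (a ℤ.^ d) p∣a)))

  module _ {P Q h H : ℕ} {a : ℤ}
           (aʰ≡1 : a ℤ.^ h ≡ + 1 [mod P ]) (aᴴ≡1 : a ℤ.^ H ≡ + 1 [mod Q ]) where

    private
      module P = Mod P
      module Q = Mod Q

    -- The exponent sought is 0 modulo h and 1 modulo H, an idempotent of the Chinese remainder
    -- theorem supplied by Bézout coefficients.
    exponent-idempotent : Coprime h H → ∃ λ e → a ℤ.^ e ≡ + 1 [mod P ] × a ℤ.^ e ≡ a [mod Q ]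
    exponent-idempotent c with coprime-Bézout c
    ... | Bézout.+- x y 1+yH≡xh = h * x , power-1 a h x aʰ≡1 ,
      Q.trans (Q.reflexive (cong (a ℤ.^_) (trans (ℕ.*-comm h x) (trans (sym 1+yH≡xh) (cong suc (ℕ.*-comm y H))))))
        (Q.trans (Q.*-congˡ {a} (power-1 a H y aᴴ≡1)) (Q.*-identityʳ a))
    -- Here -xh is 1 modulo H; the factor H - 1 stands for -1 to keep the exponent a natural number.
    ... | Bézout.-+ x y 1+xh≡yH = h * (x * (H ∸ 1)) , power-1 a h (x * (H ∸ 1)) aʰ≡1 ,
      Q.trans (Q.sym (Q.trans (Q.*-congˡ {a ℤ.^ e} aˡ≡1) (Q.*-identityʳ (a ℤ.^ e))))
        (Q.trans (Q.reflexive (trans (sym (ℤ.^-distribˡ-+-* a e (1 + x * h))) (cong (a ℤ.^_) (index H 0<H))))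
          (Q.trans (Q.*-congˡ {a} (power-1 a H (x * h) aᴴ≡1)) (Q.*-identityʳ a)))
      where
      e = h * (x * (H ∸ 1))
      aˡ≡1 : a ℤ.^ (1 + x * h) ≡ + 1 [mod Q ]
      aˡ≡1 = Q.trans (Q.reflexive (cong (a ℤ.^_) (trans 1+xh≡yH (ℕ.*-comm y H)))) (power-1 a H y aᴴ≡1)
      0<H : 0 < H
      0<H = ℕ.n≢0⇒n>0 λ { refl → ℕ.1+n≢0 (trans 1+xh≡yH (ℕ.*-zeroʳ y)) }
      index : ∀ H → 0 < H → h * (x * (H ∸ 1)) + (1 + x * h) ≡ 1 + H * (x * h)
      index (suc H) _ = ring h x H
        where
        ring : ∀ h x H → h * (x * H) + (1 + x * h) ≡ 1 + (1 + H) * (x * h)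
        ring = ℕ-Solver.solve-∀

  -- With f the idempotent that is 1 modulo h and 0 modulo H, and e the opposite one, the exponent
  -- fi + ej acts as i modulo P and as j modulo Q.
  exponent-crt : ∀ {P Q h H : ℕ} {a : ℤ} →
    a ℤ.^ h ≡ + 1 [mod P ] → a ℤ.^ H ≡ + 1 [mod Q ] → Coprime h H →
    ∀ i j → ∃ λ r → a ℤ.^ r ≡ a ℤ.^ i [mod P ] × a ℤ.^ r ≡ a ℤ.^ j [mod Q ]
  exponent-crt {P} {Q} {h} {H} {a} aʰ≡1 aᴴ≡1 c i j =
    let e , e≡1 , e≡a = exponent-idempotent {P} {Q} aʰ≡1 aᴴ≡1 c
        f , f≡1 , f≡a = exponent-idempotent {Q} {P} aᴴ≡1 aʰ≡1 (Coprimality.sym c)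
    in f * i + e * j ,
       Mod.trans P (split {P} e f) (Mod.trans P
         (Mod.*-cong P {(a ℤ.^ f) ℤ.^ i} {a ℤ.^ i} (^-cong-mod i f≡a) (1^-mod j e≡1)) (Mod.*-identityʳ P (a ℤ.^ i))) ,
       Mod.trans Q (split {Q} e f) (Mod.trans Q
         (Mod.*-cong Q {(a ℤ.^ f) ℤ.^ i} {+ 1} (1^-mod i f≡1) (^-cong-mod j e≡a)) (Mod.*-identityˡ Q (a ℤ.^ j)))
    where
    split : ∀ {m} e f → a ℤ.^ (f * i + e * j) ≡ (a ℤ.^ f) ℤ.^ i ℤ.* (a ℤ.^ e) ℤ.^ j [mod m ]
    split {m} e f = Mod.reflexive m (trans (ℤ.^-distribˡ-+-* a (f * i) (e * j))
      (cong₂ ℤ._*_ (sym (ℤ.^-*-assoc a f i)) (sym (ℤ.^-*-assoc a e j))))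

  coprime-∣ : ∀ {P Q} → Coprime Q P → ∀ {x} → P ∣ᶻ x → Q ∣ᶻ x → (P * Q) ∣ᶻ x
  coprime-∣ {P} {Q} c {x} P∣x Q∣x with ℤ∣.∣⇒∣ᵤ P∣x
  ... | ℕ∣.divides w eq = ℤ∣.∣ᵤ⇒∣ (subst (P * Q ℕ∣.∣_) (trans (ℕ.*-comm P w) (sym eq))
    (ℕ∣.*-monoʳ-∣ P (coprime-divisor c (subst (Q ℕ∣.∣_) (trans eq (ℕ.*-comm w P)) (ℤ∣.∣⇒∣ᵤ Q∣x)))))

open PrimePowers

-- Cyclotomic cosets as sets of multiples.

module Cosets where

  open ≡ using (refl; sym; trans; cong; cong₂; subst)
  open import Data.Nat.Base using (_+_; _*_)

  Odd : ℕ → Set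
  Odd n = ∃ λ e → n ≡ 1 + 2 * e

  odd-* : ∀ {m n} → Odd m → Odd n → Odd (m * n)
  odd-* (a , refl) (b , refl) = a + b + 2 * a * b , ring a b
    where
    ring : ∀ a b → (1 + 2 * a) * (1 + 2 * b) ≡ 1 + 2 * (a + b + 2 * a * b)
    ring = ℕ-Solver.solve-∀

  odd-^ : ∀ {m} → Odd m → ∀ e → Odd (m ℕ.^ e)
  odd-^ o zero    = 0 , refl
  odd-^ o (suc e) = odd-* o (odd-^ o e)

  odd⇒2∤ : ∀ {n} → Odd n → ¬ 2 ℕ∣.∣ n
  odd⇒2∤ (e , refl) 2∣n with ℕ∣.∣1⇒≡1 (ℕ∣.∣m+n∣m⇒∣n (subst (2 ℕ∣.∣_) (ℕ.+-comm 1 (2 * e)) 2∣n) (ℕ∣.m∣m*n e))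
  ... | ()

  neg-^-odd : ∀ {n} → Odd n → ∀ x → (ℤ.- x) ℤ.^ n ≡ ℤ.- (x ℤ.^ n)
  neg-^-odd (e , refl) x = trans (cong (ℤ.- x ℤ.*_) (trans (sym (ℤ.^-*-assoc (ℤ.- x) 2 e))
    (trans (cong (ℤ._^ e) (ring x)) (ℤ.^-*-assoc x 2 e)))) (sym (ℤ.neg-distribˡ-* x (x ℤ.^ (2 * e))))
    where
    ring : ∀ x → ℤ.- x ℤ.* (ℤ.- x ℤ.* + 1) ≡ x ℤ.* (x ℤ.* + 1)
    ring = solve-∀

  infixr 8 _◁_
  -- The sign names the family: + for the cosets C, - for the cosets C*, whose members satisfy the
  -- same condition after negation.
  _◁_ : Sign → ℤ → ℤ
  Sign.+ ◁ z = z
  Sign.- ◁ z = ℤ.- z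

  -- The exponents are `suc s` and `suc t`, so `s` and `t` are one less than in the theorem and
  -- positivity is built in. The constant k is (p-3)/4.
  record Admissible (s t p q l k : ℕ) (g : ℤ) : Set where
    field
      pp        : Prime p
      qp        : Prime q
      p≢q       : p ≢ q
      p≡4k+3    : p ≡ 4 * k + 3
      l-order-P : HasOrder (p ℕ.^ suc s) (+ l) (φ (p ℕ.^ suc s) ℕ./ 2)
      l-order-Q : HasOrder (q ℕ.^ suc t) (+ l) (φ (q ℕ.^ suc t))
      gcd≡2     : gcd (φ (p ℕ.^ suc s)) (φ (q ℕ.^ suc t)) ≡ 2
      g-order-P : IsPrimitiveRoot g (p ℕ.^ suc s)
      g-order-Q : IsPrimitiveRoot g (q ℕ.^ suc t)

  module Arithmetic {s t p q l k : ℕ} {g : ℤ} (admissible : Admissible s t p q l k g) where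

    open Admissible admissible public

    P Q h H : ℕ
    P = p ℕ.^ suc s
    Q = q ℕ.^ suc t
    h = φ P ℕ./ 2
    H = φ Q

    lᶻ : ℤ
    lᶻ = + l

    module MP = Mod P
    module MQ = Mod Q
    module Mp = Mod p

    p∣P : p ℕ∣.∣ P
    p∣P = ℕ∣.m∣m*n (p ℕ.^ s)

    q∣Q : q ℕ∣.∣ Q
    q∣Q = ℕ∣.m∣m*n (q ℕ.^ t)

    φP : φ P ≡ p ℕ.^ s * (1 + 2 * k) * 2
    φP = trans (φ-prime^ pp s) (trans (cong (λ x → p ℕ.^ s * (x ∸ 1)) (trans p≡4k+3 (ℕ.+-comm (4 * k) 3)))
           (trans (cong (p ℕ.^ s *_) (ring k)) (sym (ℕ.*-assoc (p ℕ.^ s) (1 + 2 * k) 2))))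
      where
      ring : ∀ k → 2 + 4 * k ≡ (1 + 2 * k) * 2
      ring = ℕ-Solver.solve-∀

    h-value : h ≡ p ℕ.^ s * (1 + 2 * k)
    h-value = trans (cong (ℕ._/ 2) φP) (m*n/n≡m (p ℕ.^ s * (1 + 2 * k)) 2)

    φP≡h+h : φ P ≡ h + h
    φP≡h+h = trans φP (trans (cong (_* 2) (sym h-value)) (ring h))
      where
      ring : ∀ x → x * 2 ≡ x + x
      ring = ℕ-Solver.solve-∀

    -- h is p^s times (p-1)/2, and (p-1)/2 = 2k + 1 because p ≡ 3 modulo 4.
    h-odd : Odd h
    h-odd = subst Odd (sym h-value) (odd-* (odd-^ (1 + 2 * k , trans p≡4k+3 (ring k)) s) (k , refl))
      where
      ring : ∀ k → 4 * k + 3 ≡ 1 + 2 * (1 + 2 * k)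
      ring = ℕ-Solver.solve-∀

    0<h : 0 < h
    0<h = proj₁ l-order-P

    lʰ≡1 : lᶻ ℤ.^ h ≡ + 1 [mod P ]
    lʰ≡1 = proj₁ (proj₂ l-order-P)

    lᴴ≡1 : lᶻ ℤ.^ H ≡ + 1 [mod Q ]
    lᴴ≡1 = proj₁ (proj₂ l-order-Q)

    -- φ(P) = 2h, so a common divisor of h and H divides the gcd 2; it is not 2, since h is odd.
    coprime-hH : Coprime h H
    coprime-hH {d} (d∣h , d∣H) = divisor d (subst (d ℕ∣.∣_) gcd≡2 (gcd-greatest d∣φP d∣H)) d∣h
      where
      d∣φP : d ℕ∣.∣ φ P
      d∣φP = subst (d ℕ∣.∣_) (sym φP≡h+h) (ℕ∣.∣m∣n⇒∣m+n d∣h d∣h)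
      divisor : ∀ d → d ℕ∣.∣ 2 → d ℕ∣.∣ h → d ≡ 1
      divisor d d∣2 d∣h with ℕ∣.∣⇒≤ d∣2
      divisor 0 d∣2 d∣h | _ = contradiction (ℕ∣.0∣⇒≡0 d∣2) λ ()
      divisor 1 d∣2 d∣h | _ = refl
      divisor 2 d∣2 d∣h | _ = contradiction d∣h (odd⇒2∤ h-odd)
      divisor (suc (suc (suc _))) d∣2 d∣h | s≤s (s≤s ())

    p∤l : p ∤ᶻ lᶻ
    p∤l = power-1⇒∤ pp 0<h (mod-∣ p∣P lʰ≡1)

    q∤l : q ∤ᶻ lᶻ
    q∤l = power-1⇒∤ qp (proj₁ l-order-Q) (mod-∣ q∣Q lᴴ≡1)

    p∤g : p ∤ᶻ g
    p∤g = power-1⇒∤ pp (proj₁ g-order-P) (mod-∣ p∣P (proj₁ (proj₂ g-order-P)))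

    q∤g : q ∤ᶻ g
    q∤g = power-1⇒∤ qp (proj₁ g-order-Q) (mod-∣ q∣Q (proj₁ (proj₂ g-order-Q)))

    order-invertible : ∀ {m a d} → HasOrder m a d → Invertible {m} a
    order-invertible {m} {a} {d} (0<d , aᵈ≡1 , _) with power-invertible {m} {a} {d} 0<d aᵈ≡1 1
    ... | w , aw≡1 = w , Mod.trans m (Mod.reflexive m (cong (ℤ._* w) (sym (ℤ.^-identityʳ a)))) aw≡1

    -- Raising to the power h kills all powers of l and would give g^h ≡ 1, while g has order φ(P) =
    -- 2h.
    g-not-power : ∀ a b → ¬ (lᶻ ℤ.^ a ≡ g ℤ.* lᶻ ℤ.^ b [mod P ])
    g-not-power a b eq = ℕ.<⇒≱ (ℕ.m<m+n h 0<h) (subst (_≤ h) φP≡h+h (proj₂ (proj₂ g-order-P) h 0<h gʰ≡1))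
      where
      lᵉʰ≡1 : ∀ e → (lᶻ ℤ.^ e) ℤ.^ h ≡ + 1 [mod P ]
      lᵉʰ≡1 e = MP.trans (MP.reflexive (trans (ℤ.^-*-assoc lᶻ e h) (cong (lᶻ ℤ.^_) (ℕ.*-comm e h))))
        (power-1 lᶻ h e lʰ≡1)
      *-^ : ∀ x y n → (x ℤ.* y) ℤ.^ n ≡ x ℤ.^ n ℤ.* y ℤ.^ n
      *-^ x y zero    = refl
      *-^ x y (suc n) = trans (cong (x ℤ.* y ℤ.*_) (*-^ x y n)) (ring x y (x ℤ.^ n) (y ℤ.^ n))
        where
        ring : ∀ a b c d → a ℤ.* b ℤ.* (c ℤ.* d) ≡ (a ℤ.* c) ℤ.* (b ℤ.* d)
        ring = solve-∀
      gʰ≡1 : g ℤ.^ h ≡ + 1 [mod P ]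
      gʰ≡1 = MP.trans (MP.sym (MP.*-identityʳ (g ℤ.^ h)))
        (MP.trans (MP.*-congˡ {g ℤ.^ h} (MP.sym (lᵉʰ≡1 b)))
        (MP.trans (MP.reflexive (sym (*-^ g (lᶻ ℤ.^ b) h)))
        (MP.trans (^-cong-mod h (MP.sym eq)) (lᵉʰ≡1 a))))

    abstract
      -- The units l^i and g l^i with i < h are 2h = φ(P) distinct ones. Placing z in front of them
      -- gives one unit too many, and the forced coincidence must involve z.
      cover-P : ∀ z → p ∤ᶻ z → (∃ λ a → z ≡ lᶻ ℤ.^ a [mod P ]) ⊎ (∃ λ a → z ≡ g ℤ.* lᶻ ℤ.^ a [mod P ])
      cover-P z p∤z = let i , j , i<j , j≤φ , eq = unit-collision pp s f f-unit in decide i j i<j j≤φ eq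
        where
        split : ∀ i → i < h ⊎ h ≤ i
        split i = Sum.map₂ ℕ.≮⇒≥ (toSum (i ℕ.<? h))
        f′ : ∀ i → i < h ⊎ h ≤ i → ℤ
        f′ i (inj₁ _) = lᶻ ℤ.^ i
        f′ i (inj₂ _) = g ℤ.* lᶻ ℤ.^ (i ∸ h)
        f : ℕ → ℤ
        f zero    = z
        f (suc i) = f′ i (split i)
        f′-unit : ∀ i c → p ∤ᶻ f′ i c
        f′-unit i (inj₁ _) = prime-∤ᶻ-^ pp p∤l i
        f′-unit i (inj₂ _) = prime-∤ᶻ-* pp {g} p∤g (prime-∤ᶻ-^ pp p∤l (i ∸ h))
        f-unit : ∀ i → p ∤ᶻ f i
        f-unit zero    = p∤z
        f-unit (suc i) = f′-unit i (split i)
        distinct : ∀ i j c d → i < j → j < h + h → ¬ (f′ i c ≡ f′ j d [mod P ])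
        distinct i j (inj₁ i<h) (inj₁ j<h) i<j j<2h eq =
          order-injective l-order-P i<j (ℕ.<-≤-trans j<h (ℕ.m≤n+m h i)) eq
        distinct i j (inj₁ i<h) (inj₂ h≤j) i<j j<2h eq = g-not-power i (j ∸ h) eq
        distinct i j (inj₂ h≤i) (inj₁ j<h) i<j j<2h eq = ℕ.<⇒≱ (ℕ.<-trans i<j j<h) h≤i
        distinct i j (inj₂ h≤i) (inj₂ h≤j) i<j j<2h eq = order-injective l-order-P {i ∸ h} {j ∸ h}
          (ℕ.∸-monoˡ-< i<j h≤i)
          (ℕ.<-≤-trans (subst (j ∸ h <_) (ℕ.m+n∸n≡m h h) (ℕ.∸-monoˡ-< j<2h h≤j)) (ℕ.m≤n+m h (i ∸ h)))
          (mod-cancelˡ g (order-invertible g-order-P) (lᶻ ℤ.^ (i ∸ h)) (lᶻ ℤ.^ (j ∸ h)) eq)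
        found : ∀ j c → z ≡ f′ j c [mod P ] →
                (∃ λ a → z ≡ lᶻ ℤ.^ a [mod P ]) ⊎ (∃ λ a → z ≡ g ℤ.* lᶻ ℤ.^ a [mod P ])
        found j (inj₁ _) eq = inj₁ (j , eq)
        found j (inj₂ _) eq = inj₂ (j ∸ h , eq)
        decide : ∀ i j → i < j → j ≤ φ P → f i ≡ f j [mod P ] →
                 (∃ λ a → z ≡ lᶻ ℤ.^ a [mod P ]) ⊎ (∃ λ a → z ≡ g ℤ.* lᶻ ℤ.^ a [mod P ])
        decide zero    (suc j) _         _   eq = found j (split j) eq
        decide (suc i) (suc j) (s≤s i<j) j≤φ eq =
          contradiction eq (distinct i j (split i) (split j) i<j (subst (j <_) φP≡h+h j≤φ))

      -- The same pigeonhole with the H = φ(Q) distinct units c l^i. The factor c, later 1 or g,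
      -- lets both families of cosets share the argument.
      cover-Q : ∀ c → q ∤ᶻ c → Invertible {Q} c → ∀ z → q ∤ᶻ z → ∃ λ b → z ≡ c ℤ.* lᶻ ℤ.^ b [mod Q ]
      cover-Q c q∤c c-inv z q∤z =
        let i , j , i<j , j≤φ , eq = unit-collision qp t f f-unit in decide i j i<j j≤φ eq
        where
        f : ℕ → ℤ
        f zero    = z
        f (suc i) = c ℤ.* lᶻ ℤ.^ i
        f-unit : ∀ i → q ∤ᶻ f i
        f-unit zero    = q∤z
        f-unit (suc i) = prime-∤ᶻ-* qp {c} q∤c (prime-∤ᶻ-^ qp q∤l i)
        decide : ∀ i j → i < j → j ≤ H → f i ≡ f j [mod Q ] → ∃ λ b → z ≡ c ℤ.* lᶻ ℤ.^ b [mod Q ]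
        decide zero    (suc j) _         _   eq = j , eq
        decide (suc i) (suc j) (s≤s i<j) j≤H eq = contradiction
          (mod-cancelˡ c c-inv (lᶻ ℤ.^ i) (lᶻ ℤ.^ j) eq)
          (order-injective l-order-Q i<j (ℕ.<-≤-trans j≤H (ℕ.m≤n+m H i)))

    -- Taken modulo p, not modulo P: this is the form in which coset membership becomes a condition
    -- of period p.
    Res : ℤ → Set
    Res z = ∃ λ r → z ≡ lᶻ ℤ.^ r [mod p ]

    res-power : ∀ {z} → Res z → z ℤ.^ h ≡ + 1 [mod p ]
    res-power {z} (r , z≡lʳ) = Mp.trans (^-cong-mod h z≡lʳ)
      (Mp.trans (Mp.reflexive (trans (ℤ.^-*-assoc lᶻ r h) (cong (lᶻ ℤ.^_) (ℕ.*-comm r h))))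
        (power-1 lᶻ h r (mod-∣ p∣P lʰ≡1)))

    -1≢1 : ¬ (ℤ.- + 1 ≡ + 1 [mod p ])
    -1≢1 eq = ℕ∣.>⇒∤ (subst (2 <_) (sym p≡4k+3) (ℕ.m≤n+m 3 (4 * k))) (ℤ∣.∣⇒∣ᵤ (mod⇒∣ eq))

    -- Both z and -z would have h-th power 1; as h is odd, this would force -1 ≡ 1 modulo p.
    res-disjoint : ∀ {z} → Res z → ¬ Res (ℤ.- z)
    res-disjoint {z} res res- = -1≢1 (Mp.trans (Mp.-‿cong (Mp.sym (res-power res)))
      (Mp.trans (Mp.reflexive (sym (neg-^-odd h-odd z))) (res-power res-)))

    res-resp : ∀ {x y} → x ≡ y [mod p ] → Res x → Res y
    res-resp x≡y (r , x≡lʳ) = r , Mp.trans (Mp.sym x≡y) x≡lʳ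

    res-mul : ∀ {x y} → Res x → Res y → Res (x ℤ.* y)
    res-mul {x} {y} (a , x≡lᵃ) (b , y≡lᵇ) = a + b ,
      Mp.trans (Mp.*-cong {x} {lᶻ ℤ.^ a} x≡lᵃ y≡lᵇ) (Mp.reflexive (sym (ℤ.^-distribˡ-+-* lᶻ a b)))

    res-one : Res (+ 1)
    res-one = 0 , Mp.refl

    -- Since h is odd, -1 lies outside ⟨l⟩ modulo pˢ, hence in the coset of g.
    res-neg-g : Res (ℤ.- g)
    res-neg-g = [ inside , outside ]′ (cover-P (ℤ.- g) p∤-g)
      where
      p∤-g : p ∤ᶻ ℤ.- g
      p∤-g p∣-g = p∤g (subst (p ∣ᶻ_) (ℤ.neg-involutive g) (ℤ∣.∣m⇒∣-m p∣-g))
      ring : ∀ g → g ℤ.* (ℤ.- + 1) ≡ ℤ.- g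
      ring = solve-∀
      inside : (∃ λ b → ℤ.- g ≡ lᶻ ℤ.^ b [mod P ]) → Res (ℤ.- g)
      inside (b , eq) = b , mod-∣ p∣P eq
      res-neg-1 : ∀ b → ℤ.- g ≡ g ℤ.* lᶻ ℤ.^ b [mod P ] → Res (ℤ.- + 1)
      res-neg-1 b eq = b , mod-∣ p∣P (mod-cancelˡ g (order-invertible g-order-P) (ℤ.- + 1) (lᶻ ℤ.^ b)
        (MP.trans (MP.reflexive (ring g)) eq))
      outside : (∃ λ b → ℤ.- g ≡ g ℤ.* lᶻ ℤ.^ b [mod P ]) → Res (ℤ.- g)
      outside (b , eq) = contradiction (res-neg-1 b eq) (res-disjoint res-one)

    res-neg-g* : ∀ {z a} → z ≡ g ℤ.* lᶻ ℤ.^ a [mod P ] → Res (ℤ.- z)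
    res-neg-g* {z} {a} eq = res-resp
      (Mp.trans (Mp.reflexive (sym (ℤ.neg-distribˡ-* g (lᶻ ℤ.^ a)))) (Mp.-‿cong (Mp.sym (mod-∣ p∣P eq))))
      (res-mul res-neg-g (a , Mp.refl))

    abstract
      res-cover : ∀ z → p ∤ᶻ z → Res z ⊎ Res (ℤ.- z)
      res-cover z p∤z = Sum.map inside outside (cover-P z p∤z)
        where
        inside : (∃ λ a → z ≡ lᶻ ℤ.^ a [mod P ]) → Res z
        inside (a , eq) = a , mod-∣ p∣P eq
        outside : (∃ λ a → z ≡ g ℤ.* lᶻ ℤ.^ a [mod P ]) → Res (ℤ.- z)
        outside (a , eq) = res-neg-g* {z} {a} eq

      res-unit : ∀ {z} → Res z → p ∤ᶻ z
      res-unit res = power-1⇒∤ pp 0<h (res-power res)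

      -- Decided by the side of `res-cover` on which z falls, the two sides being disjoint.
      res? : Decidable Res
      res? z = [ divisible , indivisible ]′ (toSum (p ∣ᶻ? z))
        where
        divisible : p ∣ᶻ z → Dec (Res z)
        divisible p∣z = no (λ res → res-unit res p∣z)
        indivisible : p ∤ᶻ z → Dec (Res z)
        indivisible p∤z = [ yes , (λ res- → no (λ res → res-disjoint res res-)) ]′ (res-cover z p∤z)

    halfSystem : HalfSystem p Res
    halfSystem = record
      { H?       = res?
      ; resp     = res-resp
      ; mul      = res-mul
      ; one      = res-one
      ; unit     = res-unit
      ; inverse  = λ {z} res → let w , eq = power-invertible {p} {z} 0<h (res-power res) 1
                               in w , Mp.trans (Mp.reflexive (cong (ℤ._* w) (sym (ℤ.^-identityʳ z)))) eq
      ; cover    = res-cover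
      ; disjoint = res-disjoint
      }

    p∤q : p ∤ᶻ + q
    p∤q p∣q with prime⇒irreducible qp (∣ᶻ⇒∣ p∣q)
    ... | inj₁ refl = prime∤1 pp ℕ∣.∣-refl
    ... | inj₂ p≡q  = p≢q p≡q

    -- If x² ≡ q, then x or -x lies in `Res`, and both have square q.
    quadraticResidue⇒res : IsQuadraticResidue (+ q) p → Res (+ q)
    quadraticResidue⇒res (_ , x , x²≡q) = [ positive , negative ]′ (res-cover x p∤x)
      where
      p∤x : p ∤ᶻ x
      p∤x p∣x = p∤q (∣ᶻ-resp x²≡q (ℤ∣.∣m⇒∣m*n x p∣x))
      positive : Res x → Res (+ q)
      positive res = res-resp x²≡q (res-mul res res)
      ring : ∀ x → ℤ.- x ℤ.* ℤ.- x ≡ x ℤ.* x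
      ring = solve-∀
      negative : Res (ℤ.- x) → Res (+ q)
      negative res = res-resp x²≡q (subst Res (ring x) (res-mul res res))

    -- For n = 1 + 2e the square root is z^(1+e), because its square is z times z^n.
    odd-power-1⇒square : ∀ {n} z → Odd n → z ℤ.^ n ≡ + 1 [mod p ] → ∃ λ x → x ℤ.* x ≡ z [mod p ]
    odd-power-1⇒square z (e , refl) zⁿ≡1 = z ℤ.^ (1 + e) ,
      Mp.trans (Mp.reflexive (trans (sym (ℤ.^-distribˡ-+-* z (1 + e) (1 + e))) (cong (z ℤ.^_) (ring e))))
        (Mp.trans (Mp.*-congˡ {z} zⁿ≡1) (Mp.*-identityʳ z))
      where
      ring : ∀ e → 1 + e + (1 + e) ≡ 1 + (1 + 2 * e)
      ring = ℕ-Solver.solve-∀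

    -- Were q in `Res`, its h-th power would be 1 with h odd, making q a square.
    quadraticNonresidue⇒res : IsQuadraticNonresidue (+ q) p → Res (ℤ.- + q)
    quadraticNonresidue⇒res (_ , nonsquare) = [ square , (λ res → res) ]′ (res-cover (+ q) p∤q)
      where
      square : Res (+ q) → Res (ℤ.- + q)
      square res = contradiction (odd-power-1⇒square {h} (+ q) h-odd (res-power {+ q} res)) nonsquare

    core : Sign → ℤ
    core Sign.+ = + 1
    core Sign.- = g

    -- Complementary divisors of the modulus: the multiples of `D i m` in ℤₙ correspond to the
    -- residues modulo `U i m`.
    D U : ℕ → ℕ → ℕ
    D i m = p ℕ.^ i * q ℕ.^ m
    U i m = p ℕ.^ (suc s ∸ i) * q ℕ.^ (suc t ∸ m)

    -- At the last level `suc t` the complementary divisor has no factor q left, so divisibility by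
    -- q imposes nothing there.
    Primitive : ℕ → ℕ → Set
    Primitive m u = suc t ≤ m ⊎ q ∤ᶻ + u

    D*U : ∀ i m → i ≤ suc s → m ≤ suc t → D i m * U i m ≡ P * Q
    D*U i m i≤s m≤t = trans (ring (p ℕ.^ i) (q ℕ.^ m) (p ℕ.^ (suc s ∸ i)) (q ℕ.^ (suc t ∸ m)))
      (cong₂ _*_ (merge p i≤s) (merge q m≤t))
      where
      ring : ∀ a b c d → a * b * (c * d) ≡ (a * c) * (b * d)
      ring = ℕ-Solver.solve-∀
      merge : ∀ x {a b} → a ≤ b → x ℕ.^ a * x ℕ.^ (b ∸ a) ≡ x ℕ.^ b
      merge x {a} {b} a≤b = trans (sym (ℕ.^-distribˡ-+-* x a (b ∸ a))) (cong (x ℕ.^_) (ℕ.m+[n∸m]≡n a≤b))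

    D≢0 : ∀ i m → NonZero (D i m)
    D≢0 i m = ℕ.m*n≢0 (p ℕ.^ i) (q ℕ.^ m)
      {{ℕ.m^n≢0 p i {{prime⇒nonZero pp}}}} {{ℕ.m^n≢0 q m {{prime⇒nonZero qp}}}}

    ∣^ : ∀ x {a b} → a < b → x ℕ∣.∣ x ℕ.^ (b ∸ a)
    ∣^ x {zero}  {suc b} _         = ℕ∣.m∣m*n (x ℕ.^ b)
    ∣^ x {suc a} {suc b} (s≤s a<b) = ∣^ x a<b

    p∣U : ∀ {i m} → i ≤ s → p ℕ∣.∣ U i m
    p∣U {i} {m} i≤s = ℕ∣.∣m⇒∣m*n (q ℕ.^ (suc t ∸ m)) (∣^ p (s≤s i≤s))

    q∣U : ∀ {i m} → m < suc t → q ℕ∣.∣ U i m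
    q∣U {i} {m} m<t = ℕ∣.∣n⇒∣m*n (p ℕ.^ (suc s ∸ i)) (∣^ q m<t)

    ◁-res-core : ∀ ε r → Res (ε ◁ (core ε ℤ.* lᶻ ℤ.^ r))
    ◁-res-core Sign.+ r = r , Mp.reflexive (ℤ.*-identityˡ (lᶻ ℤ.^ r))
    ◁-res-core Sign.- r = res-neg-g* {g ℤ.* lᶻ ℤ.^ r} {r} MP.refl

    ◁-resp : ∀ ε {x y} → x ≡ y [mod p ] → Res (ε ◁ x) → Res (ε ◁ y)
    ◁-resp Sign.+ x≡y = res-resp x≡y
    ◁-resp Sign.- x≡y = res-resp (Mp.-‿cong x≡y)

    q∤core : ∀ ε → q ∤ᶻ core ε
    q∤core Sign.+ = prime∤1 qp ∘ ∣ᶻ⇒∣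
    q∤core Sign.- = q∤g

    core-invertible : ∀ ε → Invertible {Q} (core ε)
    core-invertible Sign.+ = + 1 , MQ.refl
    core-invertible Sign.- = order-invertible g-order-Q

    -- Lifts from modulo p to modulo P: z lies in ⟨l⟩ or in g⟨l⟩, and the wrong choice would put
    -- both z and -z in `Res`.
    cover-core : ∀ ε z → Res (ε ◁ z) → ∃ λ a → z ≡ core ε ℤ.* lᶻ ℤ.^ a [mod P ]
    cover-core Sign.+ z res = [ inside , outside ]′ (cover-P z (res-unit res))
      where
      inside : (∃ λ a → z ≡ lᶻ ℤ.^ a [mod P ]) → ∃ λ a → z ≡ + 1 ℤ.* lᶻ ℤ.^ a [mod P ]
      inside (a , eq) = a , MP.trans eq (MP.reflexive (sym (ℤ.*-identityˡ (lᶻ ℤ.^ a))))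
      outside : (∃ λ a → z ≡ g ℤ.* lᶻ ℤ.^ a [mod P ]) → ∃ λ a → z ≡ + 1 ℤ.* lᶻ ℤ.^ a [mod P ]
      outside (a , eq) = contradiction (res-neg-g* {z} {a} eq) (res-disjoint res)
    cover-core Sign.- z res = [ inside , (λ x → x) ]′ (cover-P z (λ p∣z → res-unit res (ℤ∣.∣m⇒∣-m p∣z)))
      where
      inside : (∃ λ a → z ≡ lᶻ ℤ.^ a [mod P ]) → ∃ λ a → z ≡ g ℤ.* lᶻ ℤ.^ a [mod P ]
      inside (a , eq) = contradiction res (res-disjoint (a , mod-∣ p∣P eq))

    mod-divide : ∀ d u .{{_ : NonZero d}} a y → + a ≡ + d ℤ.* y [mod d * u ] →
                 ∃ λ b → (a ≡ b * d) × + b ≡ y [mod u ]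
    mod-divide d u a y eq = b , a≡bd , ∣⇒mod
      (ℤ∣.*-cancelˡ-∣ (+ d) {+ u} {+ b ℤ.- y} (subst (ℤ∣._∣ (+ d ℤ.* (+ b ℤ.- y))) (ℤ.pos-* d u)
        (subst (d * u ∣ᶻ_) expand (mod⇒∣ eq))))
      where
      d∣a : d ℕ∣.∣ a
      d∣a = ∣ᶻ⇒∣ (∣ᶻ-resp (mod-∣ (ℕ∣.m∣m*n u) (Mod.sym (d * u) eq)) (ℤ∣.∣m⇒∣m*n y (ℤ∣.∣-refl {+ d})))
      b = ℕ∣.quotient d∣a
      a≡bd : a ≡ b * d
      a≡bd = ℕ∣.m∣n⇒n≡quotient*m d∣a
      expand : + a ℤ.- + d ℤ.* y ≡ + d ℤ.* (+ b ℤ.- y)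
      expand = trans (cong (λ x → x ℤ.- + d ℤ.* y) (trans (cong +_ a≡bd) (ℤ.pos-* b d))) (ring (+ b) (+ d) y)
        where
        ring : ∀ b d y → b ℤ.* d ℤ.- d ℤ.* y ≡ d ℤ.* (b ℤ.- y)
        ring = solve-∀

    -- Dividing by `D i m` leaves a congruence for u modulo `U i m`. This number is divisible by p
    -- as i ≤ s, and by q below the last level, so both conditions on u can be read off.
    coset⇒multiple : ∀ ε {i m} → i ≤ s → ∀ a r →
                     + a ≡ (+ D i m ℤ.* core ε) ℤ.* lᶻ ℤ.^ r [mod D i m * U i m ] →
                     ∃ λ u → a ≡ u * D i m × Res (ε ◁ + u) × Primitive m u
    coset⇒multiple ε {i} {m} i≤s a r eq = u , proj₁ (proj₂ divided) ,
        ◁-resp ε (Mp.sym (mod-∣ (p∣U {i} {m} i≤s) u≡y)) (◁-res-core ε r) ,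
        [ inj₁ , (λ m≱t → inj₂ (λ q∣u → q∤y (∣ᶻ-resp (mod-∣ (q∣U {i} {m} (ℕ.≰⇒> m≱t)) u≡y) q∣u))) ]′
          (toSum (suc t ℕ.≤? m))
      where
      y : ℤ
      y = core ε ℤ.* lᶻ ℤ.^ r
      q∤y : q ∤ᶻ y
      q∤y = prime-∤ᶻ-* qp {core ε} (q∤core ε) (prime-∤ᶻ-^ qp q∤l r)
      divided : ∃ λ u → (a ≡ u * D i m) × + u ≡ y [mod U i m ]
      divided = mod-divide (D i m) (U i m) {{D≢0 i m}} a y
        (Mod.trans (D i m * U i m) eq (Mod.reflexive (D i m * U i m) (ℤ.*-assoc (+ D i m) (core ε) (lᶻ ℤ.^ r))))
      u = proj₁ divided
      u≡y : + u ≡ y [mod U i m ]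
      u≡y = proj₂ (proj₂ divided)

    coprime-QP : Coprime Q P
    coprime-QP = coprime-prime^ pp (λ p∣Q → p∤q (∣⇒∣ᶻ (prime∣^ pp q (suc t) p∣Q))) (suc s)

    -- The condition on u gives an exponent modulo P. If q does not divide u there is also one
    -- modulo Q, and the two are merged; at the last level Q divides `D i m`, so the congruence
    -- modulo Q is automatic.
    multiple⇒coset : ∀ ε {i m} → ∀ u → Res (ε ◁ + u) → Primitive m u →
                     ∃ λ r → + (u * D i m) ≡ (+ D i m ℤ.* core ε) ℤ.* lᶻ ℤ.^ r [mod P * Q ]
    multiple⇒coset ε {i} {m} u res prim = [ full , proper ]′ prim
      where
      a : ℕ
      a = proj₁ (cover-core ε (+ u) res)
      u≡P : + u ≡ core ε ℤ.* lᶻ ℤ.^ a [mod P ]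
      u≡P = proj₂ (cover-core ε (+ u) res)
      factor : ∀ r → + D i m ℤ.* (+ u ℤ.- core ε ℤ.* lᶻ ℤ.^ r) ≡ + (u * D i m) ℤ.- (+ D i m ℤ.* core ε) ℤ.* lᶻ ℤ.^ r
      factor r = trans (ring (+ D i m) (+ u) (core ε) (lᶻ ℤ.^ r))
        (cong (λ x → x ℤ.- (+ D i m ℤ.* core ε) ℤ.* lᶻ ℤ.^ r) (sym (ℤ.pos-* u (D i m))))
        where
        ring : ∀ d u c x → d ℤ.* (u ℤ.- c ℤ.* x) ≡ u ℤ.* d ℤ.- d ℤ.* c ℤ.* x
        ring = solve-∀
      conclude : ∀ r → P ∣ᶻ + u ℤ.- core ε ℤ.* lᶻ ℤ.^ r → Q ∣ᶻ + D i m ℤ.* (+ u ℤ.- core ε ℤ.* lᶻ ℤ.^ r) →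
                 + (u * D i m) ≡ (+ D i m ℤ.* core ε) ℤ.* lᶻ ℤ.^ r [mod P * Q ]
      conclude r P∣ Q∣ = ∣⇒mod (subst (P * Q ∣ᶻ_) (factor r) (coprime-∣ coprime-QP (ℤ∣.∣n⇒∣m*n (+ D i m) P∣) Q∣))
      full : suc t ≤ m → ∃ λ r → + (u * D i m) ≡ (+ D i m ℤ.* core ε) ℤ.* lᶻ ℤ.^ r [mod P * Q ]
      full t≤m = a , conclude a (mod⇒∣ u≡P) (ℤ∣.∣m⇒∣m*n (+ u ℤ.- core ε ℤ.* lᶻ ℤ.^ a)
        (∣⇒∣ᶻ {Q} {D i m} (ℕ∣.∣n⇒∣m*n (p ℕ.^ i) (subst (λ x → Q ℕ∣.∣ q ℕ.^ x) (ℕ.m+[n∸m]≡n t≤m)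
          (subst (Q ℕ∣.∣_) (sym (ℕ.^-distribˡ-+-* q (suc t) (m ∸ suc t))) (ℕ∣.m∣m*n (q ℕ.^ (m ∸ suc t))))))))
      proper : q ∤ᶻ + u → ∃ λ r → + (u * D i m) ≡ (+ D i m ℤ.* core ε) ℤ.* lᶻ ℤ.^ r [mod P * Q ]
      proper q∤u = r , conclude r (mod⇒∣ (MP.trans u≡P (MP.*-congˡ {core ε} (MP.sym r≡a))))
                    (ℤ∣.∣n⇒∣m*n (+ D i m) (mod⇒∣ (MQ.trans u≡Q (MQ.*-congˡ {core ε} (MQ.sym r≡b)))))
        where
        b : ℕ
        b = proj₁ (cover-Q (core ε) (q∤core ε) (core-invertible ε) (+ u) q∤u)
        u≡Q : + u ≡ core ε ℤ.* lᶻ ℤ.^ b [mod Q ]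
        u≡Q = proj₂ (cover-Q (core ε) (q∤core ε) (core-invertible ε) (+ u) q∤u)
        exponent : ∃ λ r → lᶻ ℤ.^ r ≡ lᶻ ℤ.^ a [mod P ] × lᶻ ℤ.^ r ≡ lᶻ ℤ.^ b [mod Q ]
        exponent = exponent-crt {P} {Q} {h} {H} {lᶻ} lʰ≡1 lᴴ≡1 coprime-hH a b
        r = proj₁ exponent
        r≡a : lᶻ ℤ.^ r ≡ lᶻ ℤ.^ a [mod P ]
        r≡a = proj₁ (proj₂ exponent)
        r≡b : lᶻ ℤ.^ r ≡ lᶻ ℤ.^ b [mod Q ]
        r≡b = proj₂ (proj₂ exponent)

open Cosets

-- Separates counting from the target ring: counts are natural numbers and enter the ring as scalars
-- through ι.
record NatHom {c ℓ} (R : CommutativeSemiring c ℓ) : Set (c ⊔ ℓ) where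
  open CommutativeSemiring R
  field
    ι   : ℕ → Carrier
    ι-0 : ι 0 ≈ 0#
    ι-1 : ι 1 ≈ 1#
    ι-+ : ∀ a b → ι (a ℕ.+ b) ≈ ι a + ι b
    ι-* : ∀ a b → ι (a ℕ.* b) ≈ ι a * ι b

-- Selected sums and generating sums in a commutative semiring.

module SelectedSum {c ℓ} (R : CommutativeSemiring c ℓ) where

  open CommutativeSemiring R
  open RangeSum R
  open SetoidReasoning setoid

  -- Has the shape of the summands of `sumWhere`, so that the sums of the theorem unfold to it.
  when : ∀ {a} {P : Set a} → Dec P → Carrier → Carrier
  when P? x = if does P? then x else 0#

  when-yes : ∀ {a} {P : Set a} (P? : Dec P) x → P → when P? x ≈ x
  when-yes (yes _) x p = refl
  when-yes (no ¬p) x p = contradiction p ¬p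

  when-no : ∀ {a} {P : Set a} (P? : Dec P) x → ¬ P → when P? x ≈ 0#
  when-no (yes p) x ¬p = contradiction p ¬p
  when-no (no _)  x ¬p = refl

  Σ-when-none : ∀ n {a} {P : Pred ℕ a} (P? : Decidable P) (f : ℕ → Carrier) →
                (∀ m → m < n → ¬ P m) →
                Σ[ m < n ] when (P? m) (f m) ≈ 0#
  Σ-when-none n P? f none = trans (Σ-cong< n (λ m m<n → when-no (P? m) (f m) (none m m<n))) (Σ-zero n)

  Σ-when-cong : ∀ n {a b} {P : Pred ℕ a} {Q : Pred ℕ b} (P? : Decidable P) (Q? : Decidable Q)
                (f : ℕ → Carrier) →
                (∀ {m} → P m → Q m) → (∀ {m} → Q m → P m) →
                Σ[ m < n ] when (P? m) (f m) ≈ Σ[ m < n ] when (Q? m) (f m)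
  Σ-when-cong n P? Q? f to from = Σ-cong n λ m → [ both m , neither m ]′ (toSum (P? m))
    where
    both : ∀ m → _ → when (P? m) (f m) ≈ when (Q? m) (f m)
    both m p = trans (when-yes (P? m) (f m) p) (sym (when-yes (Q? m) (f m) (to p)))
    neither : ∀ m → ¬ _ → when (P? m) (f m) ≈ when (Q? m) (f m)
    neither m ¬p = trans (when-no (P? m) (f m) ¬p) (sym (when-no (Q? m) (f m) (¬p ∘ from)))

  Σ-when-≡ : ∀ n j (f : ℕ → Carrier) → j < n → Σ[ m < n ] when (m ℕ.≟ j) (f m) ≈ f j
  Σ-when-≡ (suc n) zero    f _         = trans (+-congˡ (Σ-zero n)) (+-identityʳ (f 0))
  Σ-when-≡ (suc n) (suc j) f (s≤s j<n) = trans (+-identityˡ _) (Σ-when-≡ n j (f ∘ suc) j<n)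

  Σ-when-split : ∀ n {a b} {P : Pred ℕ a} {Q : Pred ℕ b} (P? : Decidable P) (Q? : Decidable Q)
                 (f : ℕ → Carrier) j → j < n →
                 (∀ {m} → P m → m ≡ j ⊎ Q m) → P j → (∀ {m} → Q m → P m) → ¬ Q j →
                 Σ[ m < n ] when (P? m) (f m) ≈ f j + Σ[ m < n ] when (Q? m) (f m)
  Σ-when-split n {P = P} {Q} P? Q? f j j<n cases Pj Q⇒P ¬Qj = begin
    Σ[ m < n ] when (P? m) (f m)
      ≈⟨ Σ-cong n (λ m → pointwise m (m ℕ.≟ j) (P? m) (Q? m)) ⟩
    Σ[ m < n ] (when (m ℕ.≟ j) (f m) + when (Q? m) (f m))
      ≈⟨ Σ-+ n _ _ ⟩
    Σ[ m < n ] when (m ℕ.≟ j) (f m) + Σ[ m < n ] when (Q? m) (f m)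
      ≈⟨ +-congʳ (Σ-when-≡ n j f j<n) ⟩
    f j + Σ[ m < n ] when (Q? m) (f m) ∎
    where
    pointwise : ∀ m (≡? : Dec (m ≡ j)) (P? : Dec (P m)) (Q? : Dec (Q m)) →
                when P? (f m) ≈ when ≡? (f m) + when Q? (f m)
    pointwise m (yes ≡.refl) P? (yes q) = contradiction q ¬Qj
    pointwise m (yes ≡.refl) P? (no _)  = trans (when-yes P? (f m) Pj) (sym (+-identityʳ (f m)))
    pointwise m (no  m≢j)    P? (yes q) = trans (when-yes P? (f m) (Q⇒P q)) (sym (+-identityˡ (f m)))
    pointwise m (no  m≢j)    P? (no ¬q) = trans (when-no P? (f m) ([ m≢j , ¬q ]′ ∘ cases)) (sym (+-identityˡ 0#))

module Generating {c ℓ} (R : CommutativeSemiring c ℓ) (hom : NatHom R) where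

  open CommutativeSemiring R
  open NatHom hom
  open RangeSum R
  open SelectedSum R
  open Exp semiring
  open SemiringSum semiring using (sum; sum-cong-≋)
  open SetoidReasoning setoid

  ι-cong : ∀ {a b} → a ≡ b → ι a ≈ ι b
  ι-cong = reflexive ∘ ≡.cong ι

  ι-Σ : ∀ n f → ι (ℕΣ.Σ< n f) ≈ Σ[ k < n ] ι (f k)
  ι-Σ zero    f = ι-0
  ι-Σ (suc n) f = trans (ι-+ (f 0) (ℕΣ.Σ< n (f ∘ suc))) (+-congˡ (ι-Σ n (f ∘ suc)))

  ι-ind : ∀ {a} {P : Set a} (P? : Dec P) x → ι (ind P?) * x ≈ when P? x
  ι-ind (yes _) x = trans (*-congʳ ι-1) (*-identityˡ x)
  ι-ind (no _)  x = trans (*-congʳ ι-0) (zeroˡ x)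

  gen : ℕ → Carrier → (ℤ → ℕ) → Carrier
  gen n y f = Σ[ u < n ] (ι (f (+ u)) * y ^ u)

  gen-cong : ∀ n y f g → (∀ u → f (+ u) ≡ g (+ u)) → gen n y f ≈ gen n y g
  gen-cong n y f g eq = Σ-cong n λ u → *-congʳ (ι-cong (eq u))

  gen-+ : ∀ n y f g → gen n y (λ u → f u ℕ.+ g u) ≈ gen n y f + gen n y g
  gen-+ n y f g = trans (Σ-cong n λ u → trans (*-congʳ (ι-+ (f (+ u)) (g (+ u)))) (distribʳ (y ^ u) _ _)) (Σ-+ n _ _)

  gen-* : ∀ n y a f → gen n y (λ u → a ℕ.* f u) ≈ ι a * gen n y f
  gen-* n y a f = trans (Σ-cong n λ u → trans (*-congʳ (ι-* a (f (+ u)))) (*-assoc _ _ _)) (sym (Σ-*ˡ n (ι a) _))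

  -- As y^n = 1, exponents add modulo n and coefficients undergo cyclic convolution. The argument c
  -- - a of g leaves the range, hence its periodicity.
  gen-convolution : ∀ n y f g → y ^ n ≈ 1# → ℕΣ.Periodic n g →
    gen n y f * gen n y g ≈ gen n y (λ c → ℕΣ.Σ[ a < n ] (f (+ a) ℕ.* g (c ℤ.- + a)))
  gen-convolution n y f g yⁿ≈1 per = begin
    gen n y f * gen n y g
      ≈⟨ Σ-*ʳ n (gen n y g) _ ⟩
    Σ[ a < n ] (ι (f (+ a)) * y ^ a * gen n y g)
      ≈⟨ Σ-cong n (λ a → trans (*-assoc _ _ _) (trans (*-congˡ (shifted a)) (Σ-*ˡ n _ _))) ⟩
    Σ[ a < n ] Σ[ c < n ] (ι (f (+ a)) * (ι (g (+ c ℤ.- + a)) * y ^ c))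
      ≈⟨ Σ-comm n n _ ⟩
    Σ[ c < n ] Σ[ a < n ] (ι (f (+ a)) * (ι (g (+ c ℤ.- + a)) * y ^ c))
      ≈⟨ Σ-cong n (λ c → trans (Σ-cong n λ a → trans (sym (*-assoc _ _ _)) (*-congʳ (sym (ι-* _ _))))
                                (sym (Σ-*ʳ n (y ^ c) _))) ⟩
    Σ[ c < n ] (Σ[ a < n ] ι (f (+ a) ℕ.* g (+ c ℤ.- + a)) * y ^ c)
      ≈⟨ Σ-cong n (λ c → *-congʳ (ι-Σ n _)) ⟨
    gen n y (λ c → ℕΣ.Σ[ a < n ] (f (+ a) ℕ.* g (c ℤ.- + a))) ∎
    where
    shifted : ∀ a → y ^ a * gen n y g ≈ Σ[ c < n ] (ι (g (+ c ℤ.- + a)) * y ^ c)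
    shifted a = begin
      y ^ a * gen n y g
        ≈⟨ Σ-*ˡ n (y ^ a) _ ⟩
      Σ[ b < n ] (y ^ a * (ι (g (+ b)) * y ^ b))
        ≈⟨ Σ-cong n (λ b → trans (x∙yz≈y∙xz (y ^ a) (ι (g (+ b))) (y ^ b))
             (*-cong (ι-cong (≡.cong g (≡.sym (ring (+ a) (+ b))))) (sym (^-homo-* y a b)))) ⟩
      Σ[ b < n ] (ι (g (+ (a ℕ.+ b) ℤ.- + a)) * y ^ (a ℕ.+ b))
        ≈⟨ Σ-shift a n (λ c → ι (g (+ c ℤ.- + a)) * y ^ c) period ⟩
      Σ[ c < n ] (ι (g (+ c ℤ.- + a)) * y ^ c) ∎
      where
      open CommutativeSemigroupProperties *-commutativeSemigroup using (x∙yz≈y∙xz)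
      ring : ∀ a b → a ℤ.+ b ℤ.- a ≡ b
      ring = solve-∀
      period : ∀ k → ι (g (+ (k ℕ.+ n) ℤ.- + a)) * y ^ (k ℕ.+ n) ≈ ι (g (+ k ℤ.- + a)) * y ^ k
      period k = *-cong
        (ι-cong (per (Mod.+-congʳ n {ℤ.- + a} (mod-+ⁿ n (+ k)))))
        (trans (^-homo-* y k n) (trans (*-congˡ yⁿ≈1) (*-identityʳ (y ^ k))))

  Σ-multiples : ∀ u d .{{_ : NonZero d}} F → (∀ y x → 0 < x → x < d → F (y ℕ.* d ℕ.+ x) ≈ 0#) →
                Σ< (u ℕ.* d) F ≈ Σ[ y < u ] F (y ℕ.* d)
  Σ-multiples u d F vanish = trans (Σ-product u d F) (Σ-cong u λ y →
    trans (Σ-head< d (λ x → F (y ℕ.* d ℕ.+ x)) (vanish y)) (reflexive (≡.cong F (ℕ.+-identityʳ (y ℕ.* d)))))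

  not-multiple : ∀ d y x → 0 < x → x < d → ∀ u → y ℕ.* d ℕ.+ x ≢ u ℕ.* d
  not-multiple d y (suc x) _ x<d u eq =
    ℕ∣.>⇒∤ x<d (ℕ∣.∣m+n∣m⇒∣n (ℕ∣.divides u eq) (ℕ∣.n∣m*n y))

  -- Only exponents v d survive, which turns the sum into a polynomial in y^d with the indicator of
  -- `E` as coefficients.
  sumWhere-multiples : ∀ n u d .{{_ : NonZero d}} y {a b} {P : Pred (Fin n) a} {E : Pred ℕ b}
    (P? : Decidable P) (E? : Decidable E) → n ≡ u ℕ.* d →
    (∀ α → P α → ∃ λ v → toℕ α ≡ v ℕ.* d × E v) →
    (∀ α v → toℕ α ≡ v ℕ.* d → E v → P α) →
    sum (λ α → when (P? α) (y ^ toℕ α)) ≈ Σ[ v < u ] (ι (ind (E? v)) * (y ^ d) ^ v)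
  sumWhere-multiples n u d y {P = P} {E} P? E? n≡ud to from = begin
    sum (λ α → when (P? α) (y ^ toℕ α))
      ≈⟨ sum-cong-≋ pointwise ⟩
    sum {n} (λ α → F (toℕ α))
      ≡⟨ sum≡Σ< n F ⟩
    Σ< n F
      ≡⟨ ≡.cong (λ m → Σ< m F) n≡ud ⟩
    Σ< (u ℕ.* d) F
      ≈⟨ Σ-multiples u d F (λ v x 0<x x<d → when-no (M? (v ℕ.* d ℕ.+ x)) _
           λ (w , eq , _) → not-multiple d v x 0<x x<d w eq) ⟩
    Σ[ v < u ] F (v ℕ.* d)
      ≈⟨ Σ-cong u term ⟩
    Σ[ v < u ] (ι (ind (E? v)) * (y ^ d) ^ v) ∎
    where
    M : Pred ℕ _
    M a = ∃ λ v → a ≡ v ℕ.* d × E v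
    M? : Decidable M
    M? a with d ℕ∣.∣? a
    ... | no  d∤a = no λ (v , eq , _) → d∤a (ℕ∣.divides v eq)
    ... | yes (ℕ∣.divides v eq) = Dec.map′ (λ e → v , eq , e)
      (λ (w , eq′ , e) → ≡.subst E (ℕ.*-cancelʳ-≡ w v d (≡.trans (≡.sym eq′) eq)) e) (E? v)
    F : ℕ → Carrier
    F a = when (M? a) (y ^ a)
    pointwise : ∀ α → when (P? α) (y ^ toℕ α) ≈ F (toℕ α)
    pointwise α = [ (λ p → trans (when-yes (P? α) _ p) (sym (when-yes (M? (toℕ α)) _ (to α p))))
                  , (λ ¬p → trans (when-no (P? α) _ ¬p)
                      (sym (when-no (M? (toℕ α)) _ λ (v , eq , e) → ¬p (from α v eq e)))) ]′ (toSum (P? α))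
    term : ∀ v → F (v ℕ.* d) ≈ ι (ind (E? v)) * (y ^ d) ^ v
    term v = begin
      F (v ℕ.* d)                       ≈⟨ [ present , absent ]′ (toSum (E? v)) ⟩
      when (E? v) (y ^ (v ℕ.* d))       ≈⟨ ι-ind (E? v) _ ⟨
      ι (ind (E? v)) * y ^ (v ℕ.* d)    ≈⟨ *-congˡ (trans (reflexive (≡.cong (y ^_) (ℕ.*-comm v d)))
                                                      (sym (^-assocʳ y d v))) ⟩
      ι (ind (E? v)) * (y ^ d) ^ v      ∎
      where
      present : E v → F (v ℕ.* d) ≈ when (E? v) (y ^ (v ℕ.* d))
      present e = trans (when-yes (M? (v ℕ.* d)) _ (v , ≡.refl , e)) (sym (when-yes (E? v) _ e))
      absent : ¬ E v → F (v ℕ.* d) ≈ when (E? v) (y ^ (v ℕ.* d))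
      absent ¬e = trans (when-no (M? (v ℕ.* d)) _ λ (w , eq , e) → ¬e (≡.subst E (ℕ.*-cancelʳ-≡ w v d (≡.sym eq)) e))
                        (sym (when-no (E? v) _ ¬e))

-- Inverses, powers and parity.

coprime⇒invertible : ∀ {m n} → Coprime m n → Invertible {n} (+ m)
coprime⇒invertible {m} {n} c with coprime-Bézout c
... | Bézout.+- x y 1+yn≡xm = + x , ∣⇒mod (ℤ∣.divides (+ y)
  (≡.trans (≡.cong (ℤ._- + 1) (≡.trans (≡.trans (≡.sym (ℤ.pos-* m x))
      (≡.cong +_ (≡.trans (ℕ.*-comm m x) (≡.sym 1+yn≡xm))))
    (≡.trans (ℤ.pos-+ 1 (y ℕ.* n)) (≡.cong (λ z → + 1 ℤ.+ z) (ℤ.pos-* y n))))) (ring (+ y ℤ.* + n))))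
  where
  ring : ∀ a → + 1 ℤ.+ a ℤ.- + 1 ≡ a
  ring = solve-∀
... | Bézout.-+ x y 1+xm≡yn = ℤ.- + x , ∣⇒mod (ℤ∣.divides (ℤ.- + y)
  (≡.trans (ring (+ x) (+ m)) (≡.trans (≡.cong ℤ.-_ (≡.trans (≡.cong (λ z → + 1 ℤ.+ z) (≡.sym (ℤ.pos-* x m)))
    (≡.trans (≡.sym (ℤ.pos-+ 1 (x ℕ.* m))) (≡.trans (≡.cong +_ 1+xm≡yn) (ℤ.pos-* y n))))) (ℤ.neg-distribˡ-* (+ y) (+ n)))))
  where
  ring : ∀ x m → m ℤ.* (ℤ.- x) ℤ.- + 1 ≡ ℤ.- (+ 1 ℤ.+ x ℤ.* m)
  ring = solve-∀

ind-× : ∀ {a b} {P : Set a} {Q : Set b} (P? : Dec P) (Q? : Dec Q) → ind (P? ×-dec Q?) ≡ ind P? ℕ.* ind Q?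
ind-× (yes _) (yes _) = ≡.refl
ind-× (yes _) (no  _) = ≡.refl
ind-× (no  _) _       = ≡.refl

periodic-∣ : ∀ {m n F} → m ℕ∣.∣ n → ℕΣ.Periodic m F → ℕΣ.Periodic n F
periodic-∣ m∣n per x≡y = per (mod-∣ m∣n x≡y)

^-∸ : ∀ x {a b} → a < b → x ℕ.^ (b ∸ a) ≡ x ℕ.^ (b ∸ a ∸ 1) ℕ.* x
^-∸ x {zero}  {suc b} _         = ℕ.*-comm x (x ℕ.^ b)
^-∸ x {suc a} {suc b} (s≤s a<b) = ^-∸ x a<b

∸-suc : ∀ {j m} → j < m → m ∸ j ≡ suc (m ∸ suc j)
∸-suc {j} {suc m} (s≤s j≤m) = ℕ.+-∸-assoc 1 j≤m

2∣n⇒2∤1+n : ∀ {n} → 2 ℕ∣.∣ n → ¬ 2 ℕ∣.∣ suc n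
2∣n⇒2∤1+n {n} 2∣n 2∣1+n = contradiction
  (ℕ∣.∣1⇒≡1 (ℕ∣.∣m+n∣m⇒∣n (≡.subst (2 ℕ∣.∣_) (ℕ.+-comm 1 n) 2∣1+n) 2∣n)) λ ()

2∣n⊎2∣1+n : ∀ n → 2 ℕ∣.∣ n ⊎ 2 ℕ∣.∣ suc n
2∣n⊎2∣1+n zero    = inj₁ (2 ℕ∣.∣0)
2∣n⊎2∣1+n (suc n) = Sum.swap (Sum.map₁ (ℕ∣.∣m∣n⇒∣m+n ℕ∣.∣-refl) (2∣n⊎2∣1+n n))

2∤1+n⇒2∣n : ∀ {n} → ¬ 2 ℕ∣.∣ suc n → 2 ℕ∣.∣ n
2∤1+n⇒2∣n {n} odd = [ (λ even → even) , (λ even → contradiction even odd) ]′ (2∣n⊎2∣1+n n)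

2∤n⇒2∣1+n : ∀ {n} → ¬ 2 ℕ∣.∣ n → 2 ℕ∣.∣ suc n
2∤n⇒2∣1+n {n} odd = [ (λ even → contradiction even odd) , (λ even → even) ]′ (2∣n⊎2∣1+n n)

-- The coefficients of the square.

module Counting {s t p q l k : ℕ} {g : ℤ} (admissible : Admissible s t p q l k g) where

  open Arithmetic admissible
  module Cyc = Cyclotomy p k p≡4k+3 halfSystem
  open ≡.≡-Reasoning

  r : Sign → ℤ → ℕ
  r ε z = ind (res? (ε ◁ z))

  ν μ : ℤ → ℕ
  ν = nonmultiple q
  μ = multiple q

  r-periodic : ∀ ε → ℕΣ.Periodic p (r ε)
  r-periodic Sign.+ = Cyc.r-periodic
  r-periodic Sign.- = Cyc.n-periodic

  2≤q : 2 ≤ q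
  2≤q = ℕ.nonTrivial⇒n>1 q {{prime⇒nonTrivial qp}}

  p-invertible : Invertible {q} (+ p)
  p-invertible = coprime⇒invertible (Coprimality.sym (≡.subst (Coprime q) (ℕ.*-identityʳ p)
    (coprime-prime^ pp (p∤q ∘ ∣⇒∣ᶻ) 1)))

  -- The summand has period qp and m is the number of periods. Within one period the conditions
  -- modulo p and modulo q separate.
  convolution : ∀ m c →
    ℕΣ.Σ[ u < m ℕ.* (q ℕ.* p) ] (r Sign.- (+ u) ℕ.* ν (+ u) ℕ.* (r Sign.- (c ℤ.- + u) ℕ.* ν (c ℤ.- + u))) ≡
    m ℕ.* ((k ℕ.* r Sign.- c ℕ.+ (1 ℕ.+ k) ℕ.* r Sign.+ c) ℕ.* ((q ∸ 2) ℕ.* ν c ℕ.+ (q ∸ 1) ℕ.* μ c))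
  convolution m c = begin
    ℕΣ.Σ[ u < m ℕ.* (q ℕ.* p) ] (r Sign.- (+ u) ℕ.* ν (+ u) ℕ.* (r Sign.- (c ℤ.- + u) ℕ.* ν (c ℤ.- + u)))
      ≡⟨ ℕΣ.Σ-cong (m ℕ.* (q ℕ.* p))
           (λ u → ring (r Sign.- (+ u)) (ν (+ u)) (r Sign.- (c ℤ.- + u)) (ν (c ℤ.- + u))) ⟩
    ℕΣ.Σ[ u < m ℕ.* (q ℕ.* p) ] (F (+ u) ℕ.* G (+ u))
      ≡⟨ ℕΣ.Σ-repeat m (q ℕ.* p) {λ z → F z ℕ.* G z}
           (*-periodic {F = F} {G} (periodic-∣ {F = F} (ℕ∣.n∣m*n q) F-periodic)
                                   (periodic-∣ {F = G} (ℕ∣.m∣m*n p) G-periodic)) ⟩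
    ℕΣ.Σ[ _ < m ] ℕΣ.Σ[ u < q ℕ.* p ] (F (+ u) ℕ.* G (+ u))
      ≡⟨ Σ-const m _ ⟩
    m ℕ.* ℕΣ.Σ[ u < q ℕ.* p ] (F (+ u) ℕ.* G (+ u))
      ≡⟨ ≡.cong (m ℕ.*_) (ℕΣ.Σ-crt p q (proj₁ p-invertible) {F} {G} (proj₂ p-invertible) F-periodic G-periodic) ⟩
    m ℕ.* (ℕΣ.Σ[ u < p ] F (+ u) ℕ.* ℕΣ.Σ[ u < q ] G (+ u))
      ≡⟨ ≡.cong (m ℕ.*_) (≡.cong₂ ℕ._*_ (Cyc.NN-value c) (Σ-nonmultiple² q 2≤q c)) ⟩
    m ℕ.* ((k ℕ.* r Sign.- c ℕ.+ (1 ℕ.+ k) ℕ.* r Sign.+ c) ℕ.* ((q ∸ 2) ℕ.* ν c ℕ.+ (q ∸ 1) ℕ.* μ c)) ∎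
    where
    F G : ℤ → ℕ
    F z = r Sign.- z ℕ.* r Sign.- (c ℤ.- z)
    G z = ν z ℕ.* ν (c ℤ.- z)
    F-periodic : ℕΣ.Periodic p F
    F-periodic = *-periodic (r-periodic Sign.-) (minus-periodic c (r-periodic Sign.-))
    G-periodic : ℕΣ.Periodic q G
    G-periodic = *-periodic (nonmultiple-periodic q) (minus-periodic c (nonmultiple-periodic q))
    ring : ∀ a b c d → a ℕ.* b ℕ.* (c ℕ.* d) ≡ a ℕ.* c ℕ.* (b ℕ.* d)
    ring = ℕ-Solver.solve-∀

  -- σ is the quadratic character of q modulo p: multiplication by q preserves `Res` or exchanges it
  -- with its negative.
  r-twist : ∀ σ ε → Res (σ ◁ + q) → ∀ y → r ε (+ (y ℕ.* q)) ≡ r (σ Sign.* ε) (+ y)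
  r-twist σ ε res y = ≡.trans (≡.cong (λ z → ind (res? z))
      (≡.trans (≡.cong (ε ◁_) (ℤ.pos-* y q)) (ring σ ε (+ y) (+ q))))
    (Cyc.r-scale res ((σ Sign.* ε) ◁ + y))
    where
    ring : ∀ σ ε y q → ε ◁ (y ℤ.* q) ≡ (σ ◁ q) ℤ.* ((σ Sign.* ε) ◁ y)
    ring Sign.+ Sign.+ y q = ℤ.*-comm y q
    ring Sign.+ Sign.- y q = ℤ.neg-distribˡ-* y q ⟨ ≡.trans ⟩ ℤ.*-comm (ℤ.- y) q
    ring Sign.- Sign.+ y q = negate y q
      where
      negate : ∀ y q → y ℤ.* q ≡ ℤ.- q ℤ.* ℤ.- y
      negate = solve-∀
    ring Sign.- Sign.- y q = ℤ.neg-distribʳ-* y q ⟨ ≡.trans ⟩ ℤ.*-comm y (ℤ.- q)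

-- Coset sums, their tails and the square.

module CosetSums {s t p q l k : ℕ} {g : ℤ} (admissible : Admissible s t p q l k g)
  {c ℓ} (R : CommutativeSemiring c ℓ) (hom : NatHom R) (X : CommutativeSemiring.Carrier R)
  (i : ℕ) (i≤s : i ≤ s) where

  open Arithmetic admissible
  open Counting admissible
  open CommutativeSemiring R
  open NatHom hom
  open RangeSum R
  open SelectedSum R
  open Generating R hom
  open Exp semiring
  open SemiringSum semiring using (sum)
  open SetoidReasoning setoid

  n : ℕ
  n = P ℕ.* Q

  -- Two clauses instead of a product with `core`, so that these are literally the representatives
  -- in the definitions of `χ` and `χ*`.
  γ : Sign → ℕ → ℤ
  γ Sign.+ m = + D i m
  γ Sign.- m = + D i m ℤ.* g

  γ≡core : ∀ ε m → γ ε m ≡ + D i m ℤ.* core ε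
  γ≡core Sign.+ m = ≡.sym (ℤ.*-identityʳ (+ D i m))
  γ≡core Sign.- m = ≡.refl

  χ : Sign → ℕ → Carrier
  χ ε m = sum {n} (λ α → when (cyclotomicCoset? l n (γ ε m) α) (X ^ toℕ α))

  Y : ℕ → Carrier
  Y m = X ^ D i m

  primitive? : ∀ m → Decidable (Primitive m)
  primitive? m u = (suc t ℕ.≤? m) ⊎-dec ¬? (q ∣ᶻ? + u)

  E? : ∀ ε m v → Dec (Res (ε ◁ + v) × Primitive m v)
  E? ε m v = res? (ε ◁ + v) ×-dec primitive? m v

  χ-multiples : ∀ ε m → m ≤ suc t → χ ε m ≈ Σ[ v < U i m ] (ι (ind (E? ε m v)) * Y m ^ v)
  χ-multiples ε m m≤t = sumWhere-multiples n (U i m) (D i m) {{D≢0 i m}} X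
    (cyclotomicCoset? l n (γ ε m)) (E? ε m)
    (≡.trans (≡.sym n≡DU) (ℕ.*-comm (D i m) (U i m)))
    (λ α (r , eq) → coset⇒multiple ε i≤s (toℕ α) r
      (≡.subst (λ N → + toℕ α ≡ (+ D i m ℤ.* core ε) ℤ.* lᶻ ℤ.^ r [mod N ]) (≡.sym n≡DU)
        (≡.subst (λ z → + toℕ α ≡ z ℤ.* lᶻ ℤ.^ r [mod n ]) (γ≡core ε m) eq)))
    (λ α v eq (res , prim) → let r , eq′ = multiple⇒coset ε {i} {m} v res prim in
      r , ≡.subst₂ (λ a z → + a ≡ z ℤ.* lᶻ ℤ.^ r [mod n ]) (≡.sym eq) (≡.sym (γ≡core ε m)) eq′)
    where
    n≡DU : D i m ℕ.* U i m ≡ n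
    n≡DU = D*U i m (ℕ.≤-trans i≤s (ℕ.n≤1+n s)) m≤t

  fullSum primitiveSum imprimitiveSum : Sign → ℕ → Carrier
  fullSum        ε m = gen (U i m) (Y m) (r ε)
  primitiveSum   ε m = gen (U i m) (Y m) (λ u → r ε u ℕ.* ν u)
  imprimitiveSum ε m = gen (U i m) (Y m) (λ u → r ε u ℕ.* μ u)

  full-split : ∀ ε m → fullSum ε m ≈ primitiveSum ε m + imprimitiveSum ε m
  full-split ε m = trans
    (gen-cong (U i m) (Y m) (r ε) (λ u → r ε u ℕ.* ν u ℕ.+ r ε u ℕ.* μ u) (λ u → split (+ u)))
    (gen-+ (U i m) (Y m) (λ u → r ε u ℕ.* ν u) (λ u → r ε u ℕ.* μ u))
    where
    split : ∀ u → r ε u ≡ r ε u ℕ.* ν u ℕ.+ r ε u ℕ.* μ u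
    split u = ≡.sym (≡.trans (≡.sym (ℕ.*-distribˡ-+ (r ε u) (ν u) (μ u)))
      (≡.trans (≡.cong (r ε u ℕ.*_) (nonmultiple+multiple q u)) (ℕ.*-identityʳ (r ε u))))

  χ-primitive : ∀ ε m → m ≤ t → χ ε m ≈ primitiveSum ε m
  χ-primitive ε m m≤t = trans (χ-multiples ε m (ℕ.≤-trans m≤t (ℕ.n≤1+n t)))
    (Σ-cong (U i m) λ v → *-congʳ (ι-cong (≡.trans (ind-× (res? (ε ◁ + v)) (primitive? m v))
      (≡.cong (r ε (+ v) ℕ.*_) (ind-cong (primitive? m v) (¬? (q ∣ᶻ? + v))
        [ (λ t<m → contradiction m≤t (ℕ.<⇒≱ t<m)) , (λ q∤v → q∤v) ]′ inj₂)))))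

  χ-full : ∀ ε → χ ε (suc t) ≈ fullSum ε (suc t)
  χ-full ε = trans (χ-multiples ε (suc t) ℕ.≤-refl)
    (Σ-cong (U i (suc t)) λ v → *-congʳ (ι-cong (ind-cong (E? ε (suc t) v) (res? (ε ◁ + v))
      proj₁ (λ res → res , inj₁ ℕ.≤-refl))))

  -- Put u = q y. Since `D i (suc m)` is q times `D i m`, the power of `Y m` becomes one of
  -- `Y (suc m)`, while dividing the coefficient's argument by q twists the sign by σ.
  imprimitive-full : ∀ σ ε → Res (σ ◁ + q) → ∀ m → m ≤ t → imprimitiveSum ε m ≈ fullSum (σ Sign.* ε) (suc m)
  imprimitive-full σ ε res m m≤t = begin
    Σ< (U i m) F
      ≡⟨ ≡.cong (λ N → Σ< N F) U-step ⟩
    Σ< (U i (suc m) ℕ.* q) F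
      ≈⟨ Σ-multiples (U i (suc m)) q {{prime⇒nonZero qp}} F vanish ⟩
    Σ[ y < U i (suc m) ] F (y ℕ.* q)
      ≈⟨ Σ-cong (U i (suc m)) (λ y → *-cong (ι-cong (coefficient y)) (power y)) ⟩
    fullSum (σ Sign.* ε) (suc m) ∎
    where
    F : ℕ → Carrier
    F u = ι (r ε (+ u) ℕ.* μ (+ u)) * Y m ^ u
    U-step : U i m ≡ U i (suc m) ℕ.* q
    U-step = ≡.trans (≡.cong (λ e → p ℕ.^ (suc s ∸ i) ℕ.* q ℕ.^ e) (ℕ.+-∸-assoc 1 m≤t))
      (ring (p ℕ.^ (suc s ∸ i)) q (q ℕ.^ (t ∸ m)))
      where
      ring : ∀ a b c → a ℕ.* (b ℕ.* c) ≡ a ℕ.* c ℕ.* b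
      ring = ℕ-Solver.solve-∀
    vanish : ∀ y x → 0 < x → x < q → F (y ℕ.* q ℕ.+ x) ≈ 0#
    vanish y x 0<x x<q = trans (*-congʳ (trans (ι-cong (≡.trans
        (≡.cong (r ε (+ (y ℕ.* q ℕ.+ x)) ℕ.*_) (ind-no (q ∣ᶻ? + (y ℕ.* q ℕ.+ x)) indivisible))
        (ℕ.*-zeroʳ (r ε (+ (y ℕ.* q ℕ.+ x)))))) ι-0)) (zeroˡ _)
      where
      indivisible : q ∤ᶻ + (y ℕ.* q ℕ.+ x)
      indivisible q∣ = not-multiple q y x 0<x x<q (ℕ∣.quotient (∣ᶻ⇒∣ q∣)) (ℕ∣.m∣n⇒n≡quotient*m (∣ᶻ⇒∣ q∣))
    coefficient : ∀ y → r ε (+ (y ℕ.* q)) ℕ.* μ (+ (y ℕ.* q)) ≡ r (σ Sign.* ε) (+ y)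
    coefficient y = ≡.trans (≡.cong₂ ℕ._*_ (r-twist σ ε res y)
      (ind-yes (q ∣ᶻ? + (y ℕ.* q)) (∣⇒∣ᶻ (ℕ∣.n∣m*n y)))) (ℕ.*-identityʳ _)
    power : ∀ y → Y m ^ (y ℕ.* q) ≈ Y (suc m) ^ y
    power y = trans (^-assocʳ X (D i m) (y ℕ.* q)) (trans
      (reflexive (≡.cong (X ^_) (ring (p ℕ.^ i) (q ℕ.^ m) y q))) (sym (^-assocʳ X (D i (suc m)) y)))
      where
      ring : ∀ a b y q → a ℕ.* b ℕ.* (y ℕ.* q) ≡ a ℕ.* (q ℕ.* b) ℕ.* y
      ring = ℕ-Solver.solve-∀

  -- Any family with this recurrence and end value will do: a full sum is χ plus its imprimitive
  -- part, which is the twisted full sum one level up. Induction on the distance to the last level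
  -- then identifies the two.
  imprimitive-tail : ∀ σ → Res (σ ◁ + q) → (tail : Sign → ℕ → Carrier) →
    (∀ ε → tail ε (suc t) ≈ 0#) →
    (∀ ε m → m ≤ t → tail ε m ≈ χ (σ Sign.* ε) (suc m) + tail (σ Sign.* ε) (suc m)) →
    ∀ ε m → m ≤ t → imprimitiveSum ε m ≈ tail ε m
  imprimitive-tail σ res tail tail-end tail-step ε m m≤t =
    trans (imprimitive-full σ ε res m m≤t)
      (trans (full-tail (t ∸ m) (σ Sign.* ε) (suc m) (≡.cong suc (ℕ.m+[n∸m]≡n m≤t))) (sym (tail-step ε m m≤t)))
    where
    full-tail : ∀ d ε m → m ℕ.+ d ≡ suc t → fullSum ε m ≈ χ ε m + tail ε m
    full-tail zero ε m m+0≡t with ≡.refl ← ≡.trans (≡.sym (ℕ.+-identityʳ m)) m+0≡t =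
      sym (trans (+-cong (χ-full ε) (tail-end ε)) (+-identityʳ _))
    full-tail (suc d) ε m m+d≡t = trans (full-split ε m) (+-cong (sym (χ-primitive ε m m≤t″))
      (trans (imprimitive-full σ ε res m m≤t″)
        (trans (full-tail d (σ Sign.* ε) (suc m) (≡.cong suc m+d≡t′)) (sym (tail-step ε m m≤t″)))))
      where
      m+d≡t′ : m ℕ.+ d ≡ t
      m+d≡t′ = ℕ.suc-injective (≡.trans (≡.sym (ℕ.+-suc m d)) m+d≡t)
      m≤t″ : m ≤ t
      m≤t″ = ≡.subst (m ≤_) m+d≡t′ (ℕ.m≤m+n m d)

  -- `U i j` is a b periods of length qp. In the value given by `convolution`, the c prime to q
  -- reassemble into χ and those divisible by q into the imprimitive sums.
  square : X ^ n ≈ 1# → ∀ j → j ≤ t → let a = p ℕ.^ (suc s ∸ i ∸ 1); b = q ℕ.^ (suc t ∸ j ∸ 1) in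
    χ Sign.- j ^ 2 ≈
      ι (k ℕ.* a) * (ι ((q ∸ 2) ℕ.* b) * χ Sign.- j + ι (b ℕ.* (q ∸ 1)) * imprimitiveSum Sign.- j) +
      ι ((1 ℕ.+ k) ℕ.* a) * (ι ((q ∸ 2) ℕ.* b) * χ Sign.+ j + ι (b ℕ.* (q ∸ 1)) * imprimitiveSum Sign.+ j)
  square Xⁿ≈1 j j≤t = begin
    χ Sign.- j ^ 2
      ≈⟨ *-cong χ≈f (trans (*-identityʳ _) χ≈f) ⟩
    gen (U i j) (Y j) f * gen (U i j) (Y j) f
      ≈⟨ gen-convolution (U i j) (Y j) f f Yᵁ≈1 f-periodic ⟩
    gen (U i j) (Y j) (λ c → ℕΣ.Σ[ u < U i j ] (f (+ u) ℕ.* f (c ℤ.- + u)))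
      ≈⟨ gen-cong (U i j) (Y j) (λ c → ℕΣ.Σ[ u < U i j ] (f (+ u) ℕ.* f (c ℤ.- + u)))
           (λ c → k ℕ.* a ℕ.* part Sign.- c ℕ.+ (1 ℕ.+ k) ℕ.* a ℕ.* part Sign.+ c) (λ c → coefficient (+ c)) ⟩
    gen (U i j) (Y j) (λ c → k ℕ.* a ℕ.* part Sign.- c ℕ.+ (1 ℕ.+ k) ℕ.* a ℕ.* part Sign.+ c)
      ≈⟨ gen-+ (U i j) (Y j) (λ c → k ℕ.* a ℕ.* part Sign.- c) (λ c → (1 ℕ.+ k) ℕ.* a ℕ.* part Sign.+ c) ⟩
    gen (U i j) (Y j) (λ c → k ℕ.* a ℕ.* part Sign.- c) + gen (U i j) (Y j) (λ c → (1 ℕ.+ k) ℕ.* a ℕ.* part Sign.+ c)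
      ≈⟨ +-cong (scaled (k ℕ.* a) Sign.-) (scaled ((1 ℕ.+ k) ℕ.* a) Sign.+) ⟩
    _ ∎
    where
    a b : ℕ
    a = p ℕ.^ (suc s ∸ i ∸ 1)
    b = q ℕ.^ (suc t ∸ j ∸ 1)
    f : ℤ → ℕ
    f u = r Sign.- u ℕ.* ν u
    part : Sign → ℤ → ℕ
    part ε c = (q ∸ 2) ℕ.* b ℕ.* (r ε c ℕ.* ν c) ℕ.+ b ℕ.* (q ∸ 1) ℕ.* (r ε c ℕ.* μ c)
    χ≈f : χ Sign.- j ≈ gen (U i j) (Y j) f
    χ≈f = χ-primitive Sign.- j j≤t
    f-periodic : ℕΣ.Periodic (U i j) f
    f-periodic = *-periodic {F = r Sign.-} {G = ν} (periodic-∣ {F = r Sign.-} (p∣U {i} {j} i≤s) (r-periodic Sign.-))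
                            (periodic-∣ {F = ν} (q∣U {i} {j} (s≤s j≤t)) (nonmultiple-periodic q))
    Yᵁ≈1 : Y j ^ U i j ≈ 1#
    Yᵁ≈1 = trans (^-assocʳ X (D i j) (U i j))
      (trans (reflexive (≡.cong (X ^_) (D*U i j (ℕ.≤-trans i≤s (ℕ.n≤1+n s)) (ℕ.≤-trans j≤t (ℕ.n≤1+n t))))) Xⁿ≈1)
    U≡ : U i j ≡ a ℕ.* b ℕ.* (q ℕ.* p)
    U≡ = ≡.trans (≡.cong₂ ℕ._*_ (^-∸ p (s≤s i≤s)) (^-∸ q (s≤s j≤t))) (ring a b p q)
      where
      ring : ∀ a b p q → a ℕ.* p ℕ.* (b ℕ.* q) ≡ a ℕ.* b ℕ.* (q ℕ.* p)
      ring = ℕ-Solver.solve-∀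
    coefficient : ∀ c → ℕΣ.Σ[ u < U i j ] (f (+ u) ℕ.* f (c ℤ.- + u)) ≡
                  k ℕ.* a ℕ.* part Sign.- c ℕ.+ (1 ℕ.+ k) ℕ.* a ℕ.* part Sign.+ c
    coefficient c = ≡.trans (≡.cong (λ N → ℕΣ.Σ[ u < N ] (f (+ u) ℕ.* f (c ℤ.- + u))) U≡)
      (≡.trans (convolution (a ℕ.* b) c) (ring a b k (r Sign.- c) (r Sign.+ c) (q ∸ 2) (q ∸ 1) (ν c) (μ c)))
      where
      ring : ∀ a b k n r d e ν μ →
        a ℕ.* b ℕ.* ((k ℕ.* n ℕ.+ (1 ℕ.+ k) ℕ.* r) ℕ.* (d ℕ.* ν ℕ.+ e ℕ.* μ)) ≡
        k ℕ.* a ℕ.* (d ℕ.* b ℕ.* (n ℕ.* ν) ℕ.+ b ℕ.* e ℕ.* (n ℕ.* μ)) ℕ.+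
        (1 ℕ.+ k) ℕ.* a ℕ.* (d ℕ.* b ℕ.* (r ℕ.* ν) ℕ.+ b ℕ.* e ℕ.* (r ℕ.* μ))
      ring = ℕ-Solver.solve-∀
    scaled : ∀ x ε → gen (U i j) (Y j) (λ c → x ℕ.* part ε c) ≈
             ι x * (ι ((q ∸ 2) ℕ.* b) * χ ε j + ι (b ℕ.* (q ∸ 1)) * imprimitiveSum ε j)
    scaled x ε = trans (gen-* (U i j) (Y j) x (part ε)) (*-congˡ (trans
      (gen-+ (U i j) (Y j) (λ c → (q ∸ 2) ℕ.* b ℕ.* (r ε c ℕ.* ν c)) (λ c → b ℕ.* (q ∸ 1) ℕ.* (r ε c ℕ.* μ c)))
      (+-cong (trans (gen-* (U i j) (Y j) ((q ∸ 2) ℕ.* b) (λ c → r ε c ℕ.* ν c)) (*-congˡ (sym (χ-primitive ε j j≤t))))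
              (gen-* (U i j) (Y j) (b ℕ.* (q ∸ 1)) (λ c → r ε c ℕ.* μ c)))))

  ∑≤ : ∀ {a} (u : ℕ) {S : Pred ℕ a} → Decidable S → (ℕ → Carrier) → Carrier
  ∑≤ u S? f = sum {suc u} (λ m → when (S? (toℕ m)) (f (toℕ m)))

  ∑≤≈Σ< : ∀ {a} (u : ℕ) {S : Pred ℕ a} (S? : Decidable S) (f : ℕ → Carrier) →
          ∑≤ u S? f ≈ Σ[ m < suc u ] when (S? m) (f m)
  ∑≤≈Σ< u S? f = reflexive (sum≡Σ< (suc u) (λ m → when (S? m) (f m)))

  after : Sign → ℕ → Carrier
  after ε j = ∑≤ (suc t) (λ m → j ℕ.<? m) (χ ε)

  odd? : ∀ j → Decidable (λ m → j < m × ¬ 2 ℕ∣.∣ m ∸ j)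
  odd? j m = (j ℕ.<? m) ×-dec ¬? (2 ℕ∣.∣? (m ∸ j))

  even? : ∀ j → Decidable (λ m → j < m × 2 ℕ∣.∣ m ∸ j)
  even? j m = (j ℕ.<? m) ×-dec (2 ℕ∣.∣? (m ∸ j))

  oddAfter evenAfter : Sign → ℕ → Carrier
  oddAfter  ε j = ∑≤ (suc t) (odd? j) (χ ε)
  evenAfter ε j = ∑≤ (suc t) (even? j) (χ ε)

  -- When q is a nonresidue each step up one level flips the sign, so terms at even distance keep ε
  -- and those at odd distance carry its opposite.
  alternating : Sign → ℕ → Carrier
  alternating ε j = oddAfter (Sign.opposite ε) j + evenAfter ε j

  ∑≤-none : ∀ {a} {S : Pred ℕ a} (S? : Decidable S) f → (∀ {m} → S m → suc t < m) → ∑≤ (suc t) S? f ≈ 0#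
  ∑≤-none S? f large = trans (∑≤≈Σ< (suc t) S? f)
    (Σ-when-none (suc (suc t)) S? f λ m m≤t Sm → ℕ.<⇒≱ (large Sm) (ℕ.≤-pred m≤t))

  ∑≤-split : ∀ {a b} {S : Pred ℕ a} {S′ : Pred ℕ b} (S? : Decidable S) (S′? : Decidable S′) f j → j ≤ t →
             (∀ {m} → S m → m ≡ suc j ⊎ S′ m) → S (suc j) → (∀ {m} → S′ m → S m) → ¬ S′ (suc j) →
             ∑≤ (suc t) S? f ≈ f (suc j) + ∑≤ (suc t) S′? f
  ∑≤-split S? S′? f j j≤t cases Sj S′⇒S ¬S′j = trans (∑≤≈Σ< (suc t) S? f)
    (trans (Σ-when-split (suc (suc t)) S? S′? f (suc j) (s≤s (s≤s j≤t)) cases Sj S′⇒S ¬S′j)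
      (+-congˡ (sym (∑≤≈Σ< (suc t) S′? f))))

  after-step : ∀ ε j → j ≤ t → after ε j ≈ χ ε (suc j) + after ε (suc j)
  after-step ε j j≤t = ∑≤-split (λ m → j ℕ.<? m) (λ m → suc j ℕ.<? m) (χ ε) j j≤t
    (λ j<m → [ inj₂ , inj₁ ∘ ≡.sym ]′ (ℕ.m≤n⇒m<n∨m≡n j<m)) (ℕ.n<1+n j) (ℕ.<-trans (ℕ.n<1+n j)) (ℕ.<-irrefl ≡.refl)

  -- The term m = j + 1 is at odd distance 1; beyond it, odd distance from j is even distance from j
  -- + 1.
  oddAfter-step : ∀ ε j → j ≤ t → oddAfter ε j ≈ χ ε (suc j) + evenAfter ε (suc j)
  oddAfter-step ε j j≤t = ∑≤-split (odd? j) (even? (suc j)) (χ ε) j j≤t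
    (λ {m} (j<m , odd) →
      [ (λ j+1<m → inj₂ (j+1<m , 2∤1+n⇒2∣n (≡.subst (λ x → ¬ 2 ℕ∣.∣ x) (∸-suc j<m) odd))) , inj₁ ∘ ≡.sym ]′
        (ℕ.m≤n⇒m<n∨m≡n j<m))
    (ℕ.n<1+n j , ≡.subst (λ x → ¬ 2 ℕ∣.∣ x) (≡.sym (ℕ.m+n∸n≡m 1 j)) λ 2∣1 → contradiction (ℕ∣.∣1⇒≡1 2∣1) λ ())
    (λ {m} (j+1<m , even) → ℕ.<-trans (ℕ.n<1+n j) j+1<m ,
      ≡.subst (λ x → ¬ 2 ℕ∣.∣ x) (≡.sym (∸-suc (ℕ.<-trans (ℕ.n<1+n j) j+1<m))) (2∣n⇒2∤1+n even))
    (ℕ.<-irrefl ≡.refl ∘ proj₁)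

  -- No term splits off here, because m = j + 1 is at distance 1 and was never selected.
  evenAfter-step : ∀ ε j → evenAfter ε j ≈ oddAfter ε (suc j)
  evenAfter-step ε j = trans (∑≤≈Σ< (suc t) (even? j) (χ ε))
    (trans (Σ-when-cong (suc (suc t)) (even? j) (odd? (suc j)) (χ ε) to from)
      (sym (∑≤≈Σ< (suc t) (odd? (suc j)) (χ ε))))
    where
    to : ∀ {m} → j < m × 2 ℕ∣.∣ m ∸ j → suc j < m × ¬ 2 ℕ∣.∣ m ∸ suc j
    to {m} (j<m , even) =
      [ (λ j+1<m → j+1<m , odd)
      , (λ { ≡.refl → contradiction (≡.subst (2 ℕ∣.∣_) (≡.sym (ℕ.n∸n≡0 j)) (2 ℕ∣.∣0)) odd }) ]′
        (ℕ.m≤n⇒m<n∨m≡n j<m)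
      where
      odd : ¬ 2 ℕ∣.∣ m ∸ suc j
      odd 2∣ = 2∣n⇒2∤1+n 2∣ (≡.subst (2 ℕ∣.∣_) (∸-suc j<m) even)
    from : ∀ {m} → suc j < m × ¬ 2 ℕ∣.∣ m ∸ suc j → j < m × 2 ℕ∣.∣ m ∸ j
    from {m} (j+1<m , odd) = j<m , ≡.subst (2 ℕ∣.∣_) (≡.sym (∸-suc j<m)) (2∤n⇒2∣1+n odd)
      where
      j<m : j < m
      j<m = ℕ.<-trans (ℕ.n<1+n j) j+1<m

  alternating-step : ∀ ε j → j ≤ t →
    alternating ε j ≈ χ (Sign.opposite ε) (suc j) + alternating (Sign.opposite ε) (suc j)
  alternating-step ε j j≤t = begin
    oddAfter ε′ j + evenAfter ε j
      ≈⟨ +-cong (oddAfter-step ε′ j j≤t) (evenAfter-step ε j) ⟩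
    χ ε′ (suc j) + evenAfter ε′ (suc j) + oddAfter ε (suc j)
      ≈⟨ trans (+-assoc _ _ _) (+-congˡ (+-comm _ _)) ⟩
    χ ε′ (suc j) + (oddAfter ε (suc j) + evenAfter ε′ (suc j))
      ≡⟨ ≡.cong (λ δ → χ ε′ (suc j) + (oddAfter δ (suc j) + evenAfter ε′ (suc j))) (involutive ε) ⟩
    χ ε′ (suc j) + (oddAfter (Sign.opposite ε′) (suc j) + evenAfter ε′ (suc j)) ∎
    where
    ε′ : Sign
    ε′ = Sign.opposite ε
    involutive : ∀ ε → ε ≡ Sign.opposite (Sign.opposite ε)
    involutive Sign.+ = ≡.refl
    involutive Sign.- = ≡.refl

  -- The right-hand side common to both cases, with coefficients spelled as in the theorem; the
  -- cases differ only in the tail.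
  expansion : (Sign → ℕ → Carrier) → ℕ → Carrier
  expansion tail j =
    ι ((p ∸ 3) ℕ./ 4 ℕ.* p ℕ.^ (suc s ∸ i ∸ 1)) *
      (ι ((q ∸ 2) ℕ.* q ℕ.^ (suc t ∸ j ∸ 1)) * χ Sign.- j + ι (φ (q ℕ.^ (suc t ∸ j))) * tail Sign.- j) +
    ι ((p ℕ.+ 1) ℕ./ 4 ℕ.* p ℕ.^ (suc s ∸ i ∸ 1)) *
      (ι ((q ∸ 2) ℕ.* q ℕ.^ (suc t ∸ j ∸ 1)) * χ Sign.+ j + ι (φ (q ℕ.^ (suc t ∸ j))) * tail Sign.+ j)

  square-with : X ^ n ≈ 1# → (tail : Sign → ℕ → Carrier) → ∀ j → j ≤ t →
    (∀ ε → imprimitiveSum ε j ≈ tail ε j) →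
    χ Sign.- j ^ 2 ≈ expansion tail j
  square-with Xⁿ≈1 tail j j≤t tail-eq = trans (square Xⁿ≈1 j j≤t)
    (+-cong (*-cong (ι-cong (≡.cong (ℕ._* p ℕ.^ (suc s ∸ i ∸ 1)) (≡.sym [p-3]/4))) (part Sign.-))
            (*-cong (ι-cong (≡.cong (ℕ._* p ℕ.^ (suc s ∸ i ∸ 1)) (≡.sym [p+1]/4))) (part Sign.+)))
    where
    [p-3]/4 : (p ∸ 3) ℕ./ 4 ≡ k
    [p-3]/4 = ≡.trans (≡.cong (λ x → (x ∸ 3) ℕ./ 4) p≡4k+3)
      (≡.trans (≡.cong (ℕ._/ 4) (≡.trans (ℕ.m+n∸n≡m (4 ℕ.* k) 3) (ℕ.*-comm 4 k))) (m*n/n≡m k 4))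
    [p+1]/4 : (p ℕ.+ 1) ℕ./ 4 ≡ 1 ℕ.+ k
    [p+1]/4 = ≡.trans (≡.cong (λ x → (x ℕ.+ 1) ℕ./ 4) p≡4k+3)
      (≡.trans (≡.cong (ℕ._/ 4) (ring k)) (m*n/n≡m (1 ℕ.+ k) 4))
      where
      ring : ∀ k → 4 ℕ.* k ℕ.+ 3 ℕ.+ 1 ≡ (1 ℕ.+ k) ℕ.* 4
      ring = ℕ-Solver.solve-∀
    totient : q ℕ.^ (suc t ∸ j ∸ 1) ℕ.* (q ∸ 1) ≡ φ (q ℕ.^ (suc t ∸ j))
    totient = ≡.sym (≡.trans (≡.cong (λ e → φ (q ℕ.^ e)) (ℕ.+-∸-assoc 1 j≤t))
      (≡.trans (φ-prime^ qp (t ∸ j)) (≡.cong (λ e → q ℕ.^ (e ∸ 1) ℕ.* (q ∸ 1)) (≡.sym (ℕ.+-∸-assoc 1 j≤t)))))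
    part : ∀ ε →
      ι ((q ∸ 2) ℕ.* q ℕ.^ (suc t ∸ j ∸ 1)) * χ ε j + ι (q ℕ.^ (suc t ∸ j ∸ 1) ℕ.* (q ∸ 1)) * imprimitiveSum ε j ≈
      ι ((q ∸ 2) ℕ.* q ℕ.^ (suc t ∸ j ∸ 1)) * χ ε j + ι (φ (q ℕ.^ (suc t ∸ j))) * tail ε j
    part ε = +-congˡ (*-cong (ι-cong totient) (tail-eq ε))

  square-residue : X ^ n ≈ 1# → Res (+ q) → ∀ j → j ≤ t →
    χ Sign.- j ^ 2 ≈ expansion after j
  square-residue Xⁿ≈1 res j j≤t = square-with Xⁿ≈1 after j j≤t λ ε →
    imprimitive-tail Sign.+ res after (λ ε → ∑≤-none (λ m → suc t ℕ.<? m) (χ ε) (λ t<m → t<m)) after-step ε j j≤t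

  square-nonresidue : X ^ n ≈ 1# → Res (ℤ.- + q) → ∀ j → j ≤ t →
    χ Sign.- j ^ 2 ≈ expansion alternating j
  square-nonresidue Xⁿ≈1 res j j≤t = square-with Xⁿ≈1 alternating j j≤t λ ε →
    imprimitive-tail Sign.- res alternating
      (λ ε → trans (+-cong (∑≤-none (odd? (suc t)) (χ (Sign.opposite ε)) proj₁)
                             (∑≤-none (even? (suc t)) (χ ε) proj₁)) (+-identityˡ 0#))
      alternating-step ε j j≤t

-- The quotient ring and the theorem.

open import Data.Nat.Base using (_+_; _*_; _^_; _/_; _%_)

module _ {c ℓ} (R : CommutativeRing c ℓ) (a : CommutativeRing.Carrier R) where

  open CommutativeRing R using (_≈_; _-_; 0#; 1#; zeroˡ; *-identityˡ; ring) renaming (trans to ≈-trans; sym to ≈-sym)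
  open RingProperties ring using (x≈y⇒x∙y⁻¹≈ε)
  open RingDivisibility (CommutativeRing.semiring R) using (_,_)

  ≈⇒congruent : ∀ {x y} → x ≈ y → CongruentModulo R a x y
  ≈⇒congruent x≈y = mkCong (0# , ≈-trans (zeroˡ a) (≈-sym (x≈y⇒x∙y⁻¹≈ε x≈y)))

-- The quotient is 1. Used with x the power of X and y = 1, which is how that power becomes 1.
congruent-modulus : ∀ {c ℓ} (R : CommutativeRing c ℓ) x y →
  CongruentModulo R (CommutativeRing._-_ R x y) x y
congruent-modulus R x y = mkCong (1# , *-identityˡ (x - y))
  where
  open CommutativeRing R using (_-_; 1#; *-identityˡ; semiring)
  open RingDivisibility semiring using (_,_)

-- The two powers are stuck on different raw monoids, which record the
-- equality relation as well as the product.
quotient-^ : ∀ {c ℓ} (R : CommutativeRing c ℓ) a x k →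
  Exp._^_ (CommutativeRing.semiring (R /⟨ a ⟩)) x k ≡ Exp._^_ (CommutativeRing.semiring R) x k
quotient-^ R a x zero    = ≡.refl
quotient-^ R a x (suc k) = ≡.cong (CommutativeRing._*_ R x) (quotient-^ R a x k)

module _ (l n : ℕ) where

  open Polynomial (ℤ/ l)

  𝔽[X]/⟨Xⁿ-1⟩ : CommutativeSemiring _ _
  𝔽[X]/⟨Xⁿ-1⟩ = CommutativeRing.commutativeSemiring (𝔽 l [X]/⟨X^ n -1⟩)

  constHom : NatHom 𝔽[X]/⟨Xⁿ-1⟩
  constHom = record
    { ι   = λ a → const (+ a)
    ; ι-0 = ≈⇒congruent polynomialRing _ 0∷[]≋[]
    ; ι-1 = CommutativeSemiring.refl 𝔽[X]/⟨Xⁿ-1⟩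
    ; ι-+ = λ a b → CommutativeSemiring.refl 𝔽[X]/⟨Xⁿ-1⟩
    ; ι-* = λ a b → ≈⇒congruent polynomialRing _ (∷-cong (CommutativeRing.reflexive (ℤ/ l)
              (≡.trans (ℤ.pos-* a b) (≡.sym (ℤ.+-identityʳ (+ a ℤ.* + b))))) (CommutativeRing.refl polynomialRing))
    }

p%4≡3⇒p≡4k+3 : ∀ p → p % 4 ≡ 3 → p ≡ 4 * (p / 4) + 3
p%4≡3⇒p≡4k+3 p p%4≡3 = ≡.trans (m≡m%n+[m/n]*n p 4)
  (≡.trans (≡.cong₂ _+_ p%4≡3 (ℕ.*-comm (p / 4) 4)) (ℕ.+-comm 3 (4 * (p / 4))))

theorem4p2 : (s t p q l : ℕ) (g : ℤ) →
    1 ≤ s → 1 ≤ t →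
    Prime p → Prime q → Prime l →
    p ≢ q → p ≢ l → q ≢ l →
    2 ∤ p → 2 ∤ q →
    p % 4 ≡ 3 →
    HasOrder (p ^ s) (+ l) (φ (p ^ s) / 2) →
    HasOrder (q ^ t) (+ l) (φ (q ^ t)) →
    gcd (φ (p ^ s)) (φ (q ^ t)) ≡ 2 →
    IsPrimitiveRoot g (p ^ s) →
    IsPrimitiveRoot g (q ^ t) →
    (i j : ℕ) → i ≤ s ∸ 1 → j ≤ t ∸ 1 →
    let open Setting s t p q l g in
    (IsQuadraticResidue (+ q) p →
    χ* i j ^ᴿ 2 ≈ᴿ
    ((p ∸ 3) / 4 * p ^ (s ∸ i ∸ 1)) ·
    (((q ∸ 2) * q ^ (t ∸ j ∸ 1)) · χ* i j
    +ᴿ φ (q ^ (t ∸ j)) · ∑≤ t (λ m → j <? m) (λ m → χ* i m))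
    +ᴿ ((p + 1) / 4 * p ^ (s ∸ i ∸ 1)) ·
    (((q ∸ 2) * q ^ (t ∸ j ∸ 1)) · χ i j
    +ᴿ φ (q ^ (t ∸ j)) · ∑≤ t (λ m → j <? m) (λ m → χ i m)))
    ×
    (IsQuadraticNonresidue (+ q) p →
    χ* i j ^ᴿ 2 ≈ᴿ
    ((p ∸ 3) / 4 * p ^ (s ∸ i ∸ 1)) ·
    (((q ∸ 2) * q ^ (t ∸ j ∸ 1)) · χ* i j
    +ᴿ φ (q ^ (t ∸ j)) ·
    (∑≤ t (λ m → (j <? m) ×-dec ¬? (2 ∣? (m ∸ j))) (λ m → χ i m)
    +ᴿ ∑≤ t (λ m → (j <? m) ×-dec (2 ∣? (m ∸ j))) (λ m → χ* i m)))
    +ᴿ ((p + 1) / 4 * p ^ (s ∸ i ∸ 1)) ·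
    (((q ∸ 2) * q ^ (t ∸ j ∸ 1)) · χ i j
    +ᴿ φ (q ^ (t ∸ j)) ·
    (∑≤ t (λ m → (j <? m) ×-dec ¬? (2 ∣? (m ∸ j))) (λ m → χ* i m)
    +ᴿ ∑≤ t (λ m → (j <? m) ×-dec (2 ∣? (m ∸ j))) (λ m → χ i m))))
-- From here on `s` and `t` are the predecessors of the exponents, so the bounds on i and j reduce
-- to `i ≤ s` and `j ≤ t`.
theorem4p2 (suc s) (suc t) p q l g _ _ pp qp _ p≢q _ _ _ _ p%4≡3
  l-order-P l-order-Q gcd≡2 g-order-P g-order-Q i j i≤s j≤t =
    (λ residue → square-residue Xⁿ≈1 (quadraticResidue⇒res residue) j j≤t)
  , (λ nonresidue → square-nonresidue Xⁿ≈1 (quadraticNonresidue⇒res nonresidue) j j≤t)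
  where
  admissible : Admissible s t p q l (p / 4) g
  admissible = record
    { pp        = pp
    ; qp        = qp
    ; p≢q       = p≢q
    ; p≡4k+3    = p%4≡3⇒p≡4k+3 p p%4≡3
    ; l-order-P = l-order-P
    ; l-order-Q = l-order-Q
    ; gcd≡2     = gcd≡2
    ; g-order-P = g-order-P
    ; g-order-Q = g-order-Q
    }
  N : ℕ
  N = p ^ suc s * q ^ suc t
  open Arithmetic admissible using (quadraticResidue⇒res; quadraticNonresidue⇒res)
  open Polynomial (ℤ/ l) using (X; polynomialRing)
  open CosetSums admissible (𝔽[X]/⟨Xⁿ-1⟩ l N) (constHom l N) X i i≤s using (square-residue; square-nonresidue)
  open CommutativeSemiring (𝔽[X]/⟨Xⁿ-1⟩ l N) using (_≈_; 1#; semiring)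
  open Exp semiring using () renaming (_^_ to _^ᴿ_)
  Xⁿ≈1 : (X ^ᴿ N) ≈ 1#
  Xⁿ≈1 = CommutativeSemiring.trans (𝔽[X]/⟨Xⁿ-1⟩ l N)
    (CommutativeSemiring.reflexive (𝔽[X]/⟨Xⁿ-1⟩ l N) (quotient-^ polynomialRing _ X N))
    (congruent-modulus polynomialRing _ (CommutativeRing.1# polynomialRing))
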